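{- Let $G=G(n)$ be a sequence of finite $d$-regular graphs, where $G(n)$ has $n$ vertices and the degree $d=d(n)$ is even with $d\to\infty$ as $n\to\infty$. Suppose that there exist $\ell_{\max}=\ell_{\max}(n)$ with $\ell_{\max}/\log d\to\infty$ and a fixed constant $C>0$ such that \[ c_\ell(G)\le C e^{ -(\ell+1)}d^{\ell-1}n\qquad\text{for all integers }3\le \ell\le \ell_{\max}. \] Then $\rho(G)=\widehat\rho(G)+o(1)$ as $n\to\infty$.
   Context: Graphs are finite and simple. An Eulerian orientation of $G$ is an orientation of all edges such that every vertex has in-degree equal to out-degree; $\operatorname{EO}(G)$ denotes their number. For a $d$-regular graph $G$ on $n$ vertices with $d$ even, the residual entropy is $\rho(G)=\frac1n\log\operatorname{EO}(G)$ and Pauling's estimate is $\widehat\rho(G)=\log\binom{d}{d/2}-\frac d2\log 2$. A closed trail is a closed walk using no edge more than once; two closed trails differing only in starting point or direction of traversal are considered the same. $c_\ell(G)$ is the number of closed trails of length $\ell$ in $G$. Asymptotic notation is as $n\to\infty$. -}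

module Defs where

open import Data.Nat using (ℕ; zero; suc; _+_; _*_; _∸_; _^_; _≤_; _<_; ⌊_/2⌋)
open import Data.Nat using () renaming (_≟_ to _≟ℕ_; _<?_ to _<?ℕ_)
open import Data.Nat.Combinatorics using (_C_)
open import Data.Bool using (Bool; true; false; _∧_; _∨_; not; if_then_else_)
open import Data.Fin using (Fin; toℕ)
open import Data.Fin.Properties using () renaming (_≟_ to _≟ᶠ_)
open import Data.Product using (_×_; _,_)
open import Data.List using (List; []; _∷_; [_]; _++_; map; concatMap; length;
  filterᵇ; allFin; zip; take; drop; reverse; upTo)
open import Data.Nat.ListAction using (sum)
open import Data.Bool.ListAction using (and)
open import Relation.Nullary.Decidable using (⌊_⌋)
open import Relation.Binary.PropositionalEquality using (_≡_)

record Graph (n : ℕ) : Set where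
  field
    adj    : Fin n → Fin n → Bool
    sym    : ∀ u v → adj u v ≡ adj v u
    irrefl : ∀ v → adj v v ≡ false
open Graph public

all : ∀ {A : Set} → (A → Bool) → List A → Bool
all p xs = and (map p xs)

countFin : (n : ℕ) → (Fin n → Bool) → ℕ
countFin n p = length (filterᵇ p (allFin n))

degree : ∀ {n} → Graph n → Fin n → ℕ
degree {n} G v = countFin n (adj G v)

IsRegular : ∀ {n} → ℕ → Graph n → Set
IsRegular d G = ∀ v → degree G v ≡ d

consF : ∀ {A : Set} {m} → A → (Fin m → A) → Fin (suc m) → A
consF a f Fin.zero    = a
consF a f (Fin.suc i) = f i

allFuns : ∀ {A : Set} → List A → (m : ℕ) → List (Fin m → A)
allFuns xs zero    = [ (λ ()) ]
allFuns xs (suc m) = concatMap (λ a → map (consF a) (allFuns xs m)) xs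

allLists : ∀ {A : Set} → List A → (m : ℕ) → List (List A)
allLists xs zero    = [ [] ]
allLists xs (suc m) = concatMap (λ a → map (a ∷_) (allLists xs m)) xs

-- Eulerian orientations.  An orientation is recorded by o : Fin n → Fin n → Bool,
-- o u v = true meaning the edge uv is oriented u → v.

_==_ : ∀ {n} → Fin n → Fin n → Bool
u == v = ⌊ u ≟ᶠ v ⌋

_==ℕ_ : ℕ → ℕ → Bool
a ==ℕ b = ⌊ a ≟ℕ b ⌋

isOrientation : ∀ {n} → Graph n → (Fin n → Fin n → Bool) → Bool
isOrientation {n} G o =
  all (λ u → all (λ v →
    if adj G u v then not (o u v ==ᵇ o v u) else not (o u v)) (allFin n)) (allFin n)
  where
  _==ᵇ_ : Bool → Bool → Bool
  true  ==ᵇ b = b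
  false ==ᵇ b = not b

outDeg inDeg : ∀ {n} → (Fin n → Fin n → Bool) → Fin n → ℕ
outDeg {n} o v = countFin n (λ u → o v u)
inDeg  {n} o v = countFin n (λ u → o u v)

isEulerianOrientation : ∀ {n} → Graph n → (Fin n → Fin n → Bool) → Bool
isEulerianOrientation {n} G o =
  isOrientation G o ∧ all (λ v → outDeg o v ==ℕ inDeg o v) (allFin n)

EO : ∀ {n} → Graph n → ℕ
EO {n} G =
  length (filterᵇ (isEulerianOrientation G)
                  (allFuns (allFuns (true ∷ false ∷ []) n) n))

-- Closed trails.  A closed walk of length ℓ is given by its cyclic vertex
-- sequence w = v₀ … v_{ℓ-1}; its edges are v_i v_{i+1 mod ℓ}.

rotate1 : ∀ {A : Set} → List A → List A
rotate1 []       = []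
rotate1 (x ∷ xs) = xs ++ [ x ]

walkEdges : ∀ {n} → List (Fin n) → List (Fin n × Fin n)
walkEdges w = zip w (rotate1 w)

sameEdge : ∀ {n} → Fin n × Fin n → Fin n × Fin n → Bool
sameEdge (a , b) (c , d) = (a == c ∧ b == d) ∨ (a == d ∧ b == c)

pairwiseDistinctEdges : ∀ {n} → List (Fin n × Fin n) → Bool
pairwiseDistinctEdges []       = true
pairwiseDistinctEdges (e ∷ es) =
  all (λ f → not (sameEdge e f)) es ∧ pairwiseDistinctEdges es

isClosedTrail : ∀ {n} → Graph n → List (Fin n) → Bool
isClosedTrail G w =
  all (λ { (a , b) → adj G a b }) (walkEdges w) ∧
  pairwiseDistinctEdges (walkEdges w)

_≤lex_ : ∀ {n} → List (Fin n) → List (Fin n) → Bool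
[]       ≤lex _        = true
(_ ∷ _)  ≤lex []       = false
(x ∷ xs) ≤lex (y ∷ ys) =
  if x == y then xs ≤lex ys else ⌊ toℕ x <?ℕ toℕ y ⌋

-- all sequences representing the same closed trail (change of starting
-- point and/or direction)
rotations : ∀ {A : Set} → List A → List (List A)
rotations w = map (λ k → drop k w ++ take k w) (upTo (length w))

equivalentSeqs : ∀ {A : Set} → List A → List (List A)
equivalentSeqs w = rotations w ++ rotations (reverse w)

isCanonical : ∀ {n} → List (Fin n) → Bool
isCanonical w = all (w ≤lex_) (equivalentSeqs w)

closedTrails : ∀ {n} → ℕ → Graph n → ℕ
closedTrails {n} ℓ G =
  length (filterᵇ (λ w → isClosedTrail G w ∧ isCanonical w) (allLists (allFin n) ℓ))

-- N! / k!  =  (k+1)(k+2)…N  (equal to 1 when N ≤ k)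
fallProd : ℕ → ℕ → ℕ
fallProd k zero    = 1
fallProd k (suc N) = if ⌊ k <?ℕ suc N ⌋ then suc N * fallProd k N else 1

-- N! * Σ_{k=0}^{N} x^k / k!   (N! times the N-th partial sum of e^x)
expPartialScaled : ℕ → ℕ → ℕ
expPartialScaled N x = sum (map (λ k → x ^ k * fallProd k N) (upTo (suc N)))

-- Pauling's numerator  binom(d, d/2);  exp(n ρ̂) = binom(d,d/2)^n / 2^{dn/2}
paulingBinom : ℕ → ℕ
paulingBinom d = d C ⌊ d /2⌋

{-# OPTIONS --safe #-}
-- Write d = 2m.  At every vertex list the neighbours as m pairs (X , Y); this can be done in
-- (2m)!ⁿ ways, and exchanging the members of pairs gives an action of 2^(mn) flips.  The pairs
-- decompose the edges into circuits.  Orienting every pair as X → v → Y is consistent along all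
-- edges for exactly EO(G) (m!)^(2n) of these labellings, and a flip class contains 2^c consistent
-- labellings, where c is the number of circuits.  Since c ≥ 0, Pauling's estimate is a lower bound
-- for EO(G); it is sharp up to e^o(n) as soon as the average of c over the consistent labellings
-- is o(n).
--
-- Permuting the X-entries at a vertex v permutes the successors on the circuits at v, so the number
-- of circuits through v is on average at most a harmonic number, O(log d).  Hence there are on
-- average O(n log d / L) circuits through at least L vertices.  A circuit through fewer than L
-- vertices consists of positions from which the circuit repeats a vertex within L steps.  Such a
-- repetition closes a trail of length ℓ ≤ L, and switching shows that a given closed trail is
-- followed with probability at most about m^(1-ℓ); by the hypothesis on the number of closed trails
-- there are only O(n L³) such positions, and resampling at a vertex turns this into O(n L³ log d / d)
-- circuits.  Take L to be a large constant times log d.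
module Submission where

open import Defs hiding (sym)
open import Data.Bool using (Bool; true; false; _∧_; not; if_then_else_; T; _xor_)
open import Data.Bool.Properties using (T?; T-∧; not-involutive)
open import Data.Empty using (⊥; ⊥-elim)
open import Data.Fin using (Fin; zero; suc; toℕ; fromℕ<; combine; inject≤; splitAt; _↑ˡ_; _↑ʳ_)
open import Data.Fin.Properties using (toℕ<n; toℕ-fromℕ<; toℕ-injective; combine-injective; toℕ-combine; inject≤-injective; toℕ-inject≤; any?; all?; pigeonhole; splitAt-↑ˡ; splitAt-↑ʳ; splitAt⁻¹-↑ˡ; splitAt⁻¹-↑ʳ) renaming (_≟_ to _≟ᶠ_; suc-injective to Fin-suc-injective)
open import Data.List using (List; []; _∷_; [_]; _++_; map; concatMap; length; filter; filterᵇ; allFin; zip; take; drop; reverse; upTo; applyUpTo; cartesianProduct; cartesianProductWith)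
open import Data.List.Properties using (length-map; length-++; length-filter; length-tabulate; filter-none; filter-all; filter-≐; ++-assoc; ++-identityʳ; ∷-injective; ∷-injectiveˡ; ∷-injectiveʳ; ≡-dec; map-cong; map-applyUpTo; length-applyUpTo; applyUpTo-∷ʳ; drop-drop; unfold-reverse; reverse-involutive; reverse-++; length-reverse; length-take; take++drop≡id; length-upTo)
open import Data.List.Membership.Propositional using (_∈_; _∉_)
open import Data.List.Membership.Propositional.Properties using (∈-map⁺; ∈-map⁻; ∈-++⁺ˡ; ∈-++⁺ʳ; ∈-++⁻; ∈-∃++; ∈-filter⁺; ∈-filter⁻; ∈-allFin; ∈-cartesianProduct⁺; ∈-upTo⁺; ∈-upTo⁻; ∈-concat⁺′; ∈-concat⁻′; ∈-cartesianProductWith⁺; ∈-cartesianProductWith⁻; ∈-cartesianProduct⁻)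
open import Data.List.Relation.Unary.All as All using (All; []; _∷_)
import Data.List.Relation.Unary.All.Properties as Allₚ
open import Data.List.Relation.Unary.Any as Any using (Any; here; there)
open import Data.List.Relation.Unary.AllPairs as AllPairs using (AllPairs; []; _∷_)
import Data.List.Relation.Unary.AllPairs.Properties as AllPairsₚ
open import Data.List.Relation.Unary.Unique.Propositional using (Unique)
import Data.List.Relation.Unary.Unique.Propositional.Properties as Uniqueₚ
open import Data.Nat using (ℕ; zero; suc; _+_; _*_; _∸_; _^_; _≤_; _<_; _!; ⌊_/2⌋; z≤n; s≤s; _≤?_; _<?_; >-nonZero)
open import Data.Nat.Divisibility using (_∣_)
open import Data.Nat.Combinatorics using (nCk≡n!/k![n-k]!; k![n∸k]!∣n!) renaming (_C_ to _choose_)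
open import Data.Nat.DivMod using (_/_; _%_; m/n*n≡m; m≡m%n+[m/n]*n; m%n<n)
open import Data.Nat.ListAction using (sum)
open import Data.Nat.Properties
open import Data.Nat.Solver using (module +-*-Solver)
open import Data.Product using (Σ; _×_; _,_; proj₁; proj₂; ∃-syntax) renaming (swap to swapₚ)
open import Data.Sum using (_⊎_; inj₁; inj₂; [_,_]′)
open import Data.Unit using (⊤; tt)
open import Data.Vec using (Vec; []; _∷_; lookup; tabulate)
open import Data.Vec.Properties using (lookup∘tabulate; tabulate∘lookup; tabulate-cong)
open import Function using (_∘_; id; case_of_)
open import Function.Bundles using (Equivalence)
open import Relation.Binary.Definitions using (tri<; tri≈; tri>)
open import Relation.Binary.PropositionalEquality using (_≡_; _≢_; refl; sym; trans; cong; cong₂; subst; subst₂; module ≡-Reasoning)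
open import Relation.Nullary using (¬_; Dec; yes; no; contradiction)
open import Relation.Nullary.Decidable using (⌊_⌋; map′; _×-dec_; _⊎-dec_; ¬?; _→-dec_; toWitness; fromWitness; decidable-stable)
open import Relation.Unary using (Decidable)

-- Counting in lists

-- The obstacle is that pairings cannot be resampled freely: the labellings are conditioned on being
-- consistent, and no independence survives. The only move used on this set exchanges two X-entries
-- at one vertex, which composes the successor permutation with a transposition inside the fibre of
-- that vertex. Every probabilistic claim therefore becomes a count of exchanges that can be undone:
-- the result must reveal which exchange was made. For cycles it is revealed by the first return to
-- a prescribed set of labels, for a followed trail by the successor of a known position. The
-- hypothesis on closed trails enters through the comparison of m^(1-ℓ) = 2^(ℓ-1) d^(1-ℓ), the
-- chance of following a trail, with its count: the surplus 2^(ℓ-1) is paid by the factor e^-(ℓ+1).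
-- No logarithms appear. log d is replaced by the binary length Λ of m, and ρ = ρ̂ + o(1) by exp(n
-- (ρ - ρ̂)) lying between (b/a)^n and (a/b)^n for every rational a/b > 1 and all large n.

length-insert : ∀ {A : Set} (xs : List A) {y zs} → length (xs ++ y ∷ zs) ≡ suc (length (xs ++ zs))
length-insert []       = refl
length-insert (_ ∷ xs) = cong suc (length-insert xs)

∈-remove : ∀ {A : Set} (xs : List A) {y z zs} → z ∈ xs ++ y ∷ zs → z ≢ y → z ∈ xs ++ zs
∈-remove []       (here z≡y)  z≢y = contradiction z≡y z≢y
∈-remove []       (there z∈)  _   = z∈
∈-remove (_ ∷ _)  (here z≡x)  _   = here z≡x
∈-remove (_ ∷ xs) (there z∈)  z≢y = there (∈-remove xs z∈ z≢y)

-- Counting by a relation instead of a function spares decidability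
-- and uniqueness on the target side.
rel-length : ∀ {A B : Set} {R : A → B → Set} {xs : List A} {ys : List B} → Unique xs →
  (∀ {x} → x ∈ xs → ∃[ y ] (y ∈ ys × R x y)) →
  (∀ {x x′ y} → x ∈ xs → x′ ∈ xs → R x y → R x′ y → x ≡ x′) →
  length xs ≤ length ys
rel-length {xs = []} _ _ _ = z≤n
rel-length {R = R} {xs = x ∷ xs} {ys} (x∉ ∷ u) ex inj
  with ex (here refl)
... | y , y∈ , Rxy with ∈-∃++ y∈
... | as , bs , refl = subst (suc (length xs) ≤_) (sym (length-insert as))
  (s≤s (rel-length {R = R} u ex′ λ x∈ x′∈ → inj (there x∈) (there x′∈)))
  where
  ex′ : ∀ {x′} → x′ ∈ xs → ∃[ y′ ] (y′ ∈ as ++ bs × R x′ y′)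
  ex′ x′∈ with ex (there x′∈)
  ... | y′ , y′∈ , R′ = y′ , ∈-remove as y′∈
    (λ { refl → All.lookup x∉ x′∈ (inj (here refl) (there x′∈) Rxy R′) }) , R′

⊆-length : ∀ {A : Set} {xs ys : List A} → Unique xs → (∀ {x} → x ∈ xs → x ∈ ys) → length xs ≤ length ys
⊆-length u sub = rel-length {R = _≡_} u (λ x∈ → _ , sub x∈ , refl) λ { _ _ refl refl → refl }

inj-length : ∀ {A B : Set} {xs : List A} {ys : List B} (f : A → B) → Unique xs →
  (∀ {x} → x ∈ xs → f x ∈ ys) → (∀ {x x′} → x ∈ xs → x′ ∈ xs → f x ≡ f x′ → x ≡ x′) →
  length xs ≤ length ys
inj-length f u mem inj = rel-length {R = λ x y → f x ≡ y} u (λ x∈ → _ , mem x∈ , refl)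
  λ { x∈ x′∈ refl e → inj x∈ x′∈ (sym e) }

length-product : ∀ {A B C : Set} (f : A → B → C) xs ys → length (cartesianProductWith f xs ys) ≡ length xs * length ys
length-product f []       ys = refl
length-product f (x ∷ xs) ys = trans (length-++ (map (f x) ys)) (cong₂ _+_ (length-map (f x) ys) (length-product f xs ys))

length-concatMap : ∀ {A B : Set} (f : A → List B) {t} xs → (∀ {x} → x ∈ xs → length (f x) ≡ t) → length (concatMap f xs) ≡ length xs * t
length-concatMap f []       _ = refl
length-concatMap f (x ∷ xs) h = trans (length-++ (f x)) (cong₂ _+_ (h (here refl)) (length-concatMap f xs (λ x∈ → h (there x∈))))

length-allFin : ∀ n → length (allFin n) ≡ n
length-allFin n = length-tabulate {n = n} id

-- Double counting without division: the pairs (x , y) are listed explicitly, and since y determines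
-- x the second projection is injective on that list. The switchings below all end in this
-- inequality.
mult-length : ∀ {A B : Set} {R : A → B → Set} {xs : List A} {ys : List B} (t : ℕ) → Unique xs →
  (∀ {x} → x ∈ xs → ∃[ ls ] (Unique ls × t ≤ length ls × (∀ {y} → y ∈ ls → y ∈ ys × R x y))) →
  (∀ {x x′ y} → x ∈ xs → x′ ∈ xs → R x y → R x′ y → x ≡ x′) →
  t * length xs ≤ length ys
mult-length {A} {B} {R} {xs} {ys} t u ex inj with gather u ex
  where
  gather : ∀ {zs} → Unique zs →
    (∀ {x} → x ∈ zs → ∃[ ls ] (Unique ls × t ≤ length ls × (∀ {y} → y ∈ ls → y ∈ ys × R x y))) →
    ∃[ ps ] (Unique ps × t * length zs ≤ length ps × (∀ {x y} → (x , y) ∈ ps → x ∈ zs × y ∈ ys × R x y))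
  gather {[]} _ _ = [] , [] , ≤-reflexive (*-zeroʳ t) , λ ()
  gather {z ∷ zs} (z∉ ∷ uzs) f
    with f (here refl) | gather uzs (λ x∈ → f (there x∈))
  ... | ls , uls , t≤ , mem | ps , ups , tz≤ , pmem =
    map (z ,_) ls ++ ps ,
    Uniqueₚ.++⁺ (Uniqueₚ.map⁺ (λ { refl → refl }) uls) ups disj ,
    subst₂ _≤_ (sym (*-suc t (length zs))) (sym (trans (length-++ (map (z ,_) ls)) (cong (_+ _) (length-map (z ,_) ls)))) (+-mono-≤ t≤ tz≤) ,
    λ p∈ → case ∈-++⁻ (map (z ,_) ls) p∈ of λ where
      (inj₁ q) → case ∈-map⁻ (z ,_) q of λ { (_ , y∈ , refl) → here refl , mem y∈ }
      (inj₂ q) → case pmem q of λ { (x∈ , r) → there x∈ , r }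
    where
    disj : ∀ {p} → ¬ (p ∈ map (z ,_) ls × p ∈ ps)
    disj (p∈ , q∈) with ∈-map⁻ (z ,_) p∈
    ... | _ , _ , refl = All.lookup z∉ (proj₁ (pmem q∈)) refl
... | ps , ups , le , mem = ≤-trans le (inj-length proj₂ ups (λ p∈ → proj₁ (proj₂ (mem p∈)))
  λ { {x , y} {x′ , y′} p∈ p′∈ refl → case mem p∈ of λ { (x∈ , _ , r) → case mem p′∈ of λ { (x′∈ , _ , r′) → cong (_, y) (inj x∈ x′∈ r r′) } } })

sumTo : ℕ → (ℕ → ℕ) → ℕ
sumTo zero    f = 0
sumTo (suc t) f = sumTo t f + f t

sumTo-const : ∀ t {f : ℕ → ℕ} {B} → (∀ i → i < t → f i ≤ B) → sumTo t f ≤ t * B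
sumTo-const zero    _ = z≤n
sumTo-const (suc t) {f} {B} h = subst (sumTo t f + f t ≤_) (+-comm (t * B) B)
  (+-mono-≤ (sumTo-const t λ i i<t → h i (m<n⇒m<1+n i<t)) (h t ≤-refl))

filter-⊎ : ∀ {A : Set} {P Q R : A → Set} (P? : Decidable P) (Q? : Decidable Q) (R? : Decidable R) xs →
  (∀ {x} → x ∈ xs → P x → Q x ⊎ R x) →
  length (filter P? xs) ≤ length (filter Q? xs) + length (filter R? xs)
filter-⊎ P? Q? R? [] _ = z≤n
filter-⊎ P? Q? R? (x ∷ xs) h with filter-⊎ P? Q? R? xs (λ x∈ → h (there x∈)) | P? x | Q? x | R? x
... | ih | no _  | yes _ | yes _ = m≤n⇒m≤1+n (≤-trans ih (+-monoʳ-≤ _ (n≤1+n _)))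
... | ih | no _  | yes _ | no _  = m≤n⇒m≤1+n ih
... | ih | no _  | no _  | yes _ = ≤-trans ih (+-monoʳ-≤ _ (n≤1+n _))
... | ih | no _  | no _  | no _  = ih
... | ih | yes _ | yes _ | yes _ = s≤s (≤-trans ih (+-monoʳ-≤ _ (n≤1+n _)))
... | ih | yes _ | yes _ | no _  = s≤s ih
... | ih | yes _ | no _  | yes _ = ≤-trans (s≤s ih) (≤-reflexive (sym (+-suc _ _)))
... | ih | yes p | no ¬q | no ¬r with h (here refl) p
...   | inj₁ q = contradiction q ¬q
...   | inj₂ r = contradiction r ¬r

-- Union bound. The classes may overlap, so the last class is split off and only its complement is
-- passed to the induction.
filter-cover : ∀ {A : Set} {P : A → Set} {Q : ℕ → A → Set} (P? : Decidable P) (Q? : ∀ i → Decidable (Q i)) xs t →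
  (∀ {x} → x ∈ xs → P x → ∃[ i ] (i < t × Q i x)) →
  length (filter P? xs) ≤ sumTo t (λ i → length (filter (Q? i) xs))
filter-cover {P = P} P? Q? xs zero h = ≤-trans (≤-reflexive (cong length (filter-none′ xs (λ x∈ p → case h x∈ p of λ ())))) z≤n
  where
  filter-none′ : ∀ zs → (∀ {x} → x ∈ zs → ¬ P x) → filter P? zs ≡ []
  filter-none′ zs n = filter-none P? (All.tabulate n)
filter-cover {P = P} {Q} P? Q? xs (suc t) h = ≤-trans
  (filter-⊎ P? (λ x → P? x ×-dec ¬? (Q? t x)) (Q? t) xs
    (λ {x} _ p → case Q? t x of λ { (yes q) → inj₂ q ; (no ¬q) → inj₁ (p , ¬q) }))
  (+-monoˡ-≤ _ (filter-cover (λ x → P? x ×-dec ¬? (Q? t x)) Q? xs t below))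
  where
  below : ∀ {x} → x ∈ xs → P x × ¬ Q t x → ∃[ i ] (i < t × Q i x)
  below x∈ (p , ¬q) with h x∈ p
  ... | i , i<1+t , q with m≤n⇒m<n∨m≡n (≤-pred i<1+t)
  ...   | inj₁ i<t = i , i<t , q
  ...   | inj₂ refl = contradiction q ¬q

filter-split : ∀ {A : Set} {P : A → Set} (P? : Decidable P) xs →
  length xs ≡ length (filter P? xs) + length (filter (λ x → ¬? (P? x)) xs)
filter-split P? [] = refl
filter-split P? (x ∷ xs) with filter-split P? xs | P? x
... | ih | yes _ = cong suc ih
... | ih | no _  = trans (cong suc ih) (sym (+-suc _ _))

least : ∀ {P : ℕ → Set} → Decidable P → ∀ k → P k → ∃[ i ] (P i × i ≤ k × (∀ j → j < i → ¬ P j))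
least P? zero p = zero , p , z≤n , λ _ ()
least {P} P? (suc k) p with P? zero
... | yes p₀ = zero , p₀ , z≤n , λ _ ()
... | no ¬p₀ with least (λ i → P? (suc i)) k p
...   | i , pi , i≤k , min = suc i , pi , s≤s i≤k , λ { zero _ → ¬p₀ ; (suc j) (s≤s j<i) → min j j<i }

-- Dyadic blocks: at most 2^k indices satisfy 2^k ≤ i + 1 < 2^(k+1), each with a term of at most X /
-- 2^k, so each of the Λ blocks contributes at most X.
harmonic : ∀ Λ {m X} (x : ℕ → ℕ) → m < 2 ^ Λ → (∀ i → i < m → suc i * x i ≤ X) → sumTo m x ≤ Λ * X
harmonic zero    {zero} x _ _ = z≤n
harmonic zero    {suc m} x (s≤s ()) _
harmonic (suc Λ) {m} {X} x m< h with m <? 2 ^ Λ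
... | yes m<′ = ≤-trans (harmonic Λ x m<′ h) (m≤n+m (Λ * X) X)
... | no m≮ = begin
  sumTo m x                                    ≡⟨ cong (λ k → sumTo k x) (sym (m+[n∸m]≡n a≤m)) ⟩
  sumTo (a + (m ∸ a)) x                        ≡⟨ split a (m ∸ a) ⟩
  sumTo a x + sumTo (m ∸ a) (λ i → x (a + i))  ≤⟨ +-mono-≤ (harmonic Λ x a< λ i i<a → h i (≤-trans i<a a≤m)) tail ⟩
  Λ * X + X                                    ≡⟨ +-comm (Λ * X) X ⟩
  X + Λ * X                                    ∎
  where
  open ≤-Reasoning
  -- Indices start at 0, so the top block begins at the index a with a + 1 = 2^Λ.
  a = 2 ^ Λ ∸ 1
  sa : suc a ≡ 2 ^ Λ
  sa = m+[n∸m]≡n {1} (m^n>0 2 Λ)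
  a< : a < 2 ^ Λ
  a< = ≤-reflexive sa
  a≤m : a ≤ m
  a≤m = ≤-trans (n≤1+n a) (≤-trans a< (≮⇒≥ m≮))
  split : ∀ s r → sumTo (s + r) x ≡ sumTo s x + sumTo r (λ i → x (s + i))
  split s zero rewrite +-identityʳ s = sym (+-identityʳ _)
  split s (suc r) rewrite +-suc s r | split s r = +-assoc (sumTo s x) _ _
  r≤ : m ∸ a ≤ suc a
  r≤ = ≤-trans (∸-monoˡ-≤ a (≤-pred (subst (suc m ≤_) e m<))) (≤-reflexive (m+n∸m≡n a (suc a)))
    where
    e : 2 ^ suc Λ ≡ suc (a + suc a)
    e = trans (cong (2 ^ Λ +_) (+-identityʳ _)) (cong₂ _+_ (sym sa) (sym sa))
  scaled : ∀ r → r ≤ m ∸ a → suc a * sumTo r (λ i → x (a + i)) ≤ r * X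
  scaled zero _ = ≤-reflexive (*-zeroʳ (suc a))
  scaled (suc r) r≤ = begin
    suc a * (sumTo r _ + x (a + r))           ≡⟨ *-distribˡ-+ (suc a) _ (x (a + r)) ⟩
    suc a * sumTo r _ + suc a * x (a + r)     ≤⟨ +-mono-≤ (scaled r (≤-trans (n≤1+n r) r≤)) (≤-trans (*-monoˡ-≤ (x (a + r)) (s≤s (m≤m+n a r))) (h (a + r) (≤-trans (≤-reflexive (sym (+-suc a r))) (≤-trans (+-monoʳ-≤ a r≤) (≤-reflexive (m+[n∸m]≡n a≤m)))))) ⟩
    r * X + X                                 ≡⟨ +-comm (r * X) X ⟩
    X + r * X                                 ∎
  tail : sumTo (m ∸ a) (λ i → x (a + i)) ≤ X
  tail = *-cancelˡ-≤ (suc a) (≤-trans (scaled (m ∸ a) ≤-refl) (*-monoˡ-≤ X r≤))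

-- Orbits of permutations

iter : ∀ {P : Set} → (P → P) → ℕ → P → P
iter φ zero    p = p
iter φ (suc k) p = φ (iter φ k p)

iter-+ : ∀ {P : Set} (φ : P → P) j k p → iter φ (j + k) p ≡ iter φ j (iter φ k p)
iter-+ φ zero    k p = refl
iter-+ φ (suc j) k p = cong φ (iter-+ φ j k p)

iter-shift : ∀ {P : Set} (φ : P → P) k p → iter φ k (φ p) ≡ φ (iter φ k p)
iter-shift φ zero    p = refl
iter-shift φ (suc k) p = cong φ (iter-shift φ k p)

iter-injective : ∀ {P : Set} {φ : P → P} → (∀ {p q} → φ p ≡ φ q → p ≡ q) →
  ∀ k {p q} → iter φ k p ≡ iter φ k q → p ≡ q
iter-injective inj zero    e = e
iter-injective inj (suc k) e = iter-injective inj k (inj e)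

module Orbit {P : Set} {K : ℕ} (idx : P → Fin K) (idx-inj : ∀ {p q} → idx p ≡ idx q → p ≡ q) where

  _≟ᴾ_ : (p q : P) → Dec (p ≡ q)
  p ≟ᴾ q = map′ idx-inj (cong idx) (idx p ≟ᶠ idx q)

  -- The bound on the number of steps makes the relation decidable; for an
  -- injective φ it is no restriction.
  Reach : (P → P) → P → P → Set
  Reach φ p q = ∃[ k ] (iter φ (toℕ {suc K} k) p ≡ q)

  reach? : ∀ φ p q → Dec (Reach φ p q)
  reach? φ p q = any? (λ k → iter φ (toℕ k) p ≟ᴾ q)

  module _ (φ : P → P) (φ-inj : ∀ {p q} → φ p ≡ φ q → p ≡ q) where

    iter-∸ : ∀ {i j} p → i ≤ j → iter φ i p ≡ iter φ j p → p ≡ iter φ (j ∸ i) p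
    iter-∸ {i} {j} p i≤j e = iter-injective φ-inj i
      (trans e (trans (cong (λ t → iter φ t p) (sym (m+[n∸m]≡n i≤j))) (iter-+ φ i (j ∸ i) p)))

    period : ∀ p → ∃[ k ] (k < K × iter φ (suc k) p ≡ p)
    period p with pigeonhole ≤-refl (λ i → idx (iter φ (toℕ {suc K} i) p))
    ... | i , j , i<j , e with iter-∸ p (<⇒≤ i<j) (idx-inj e) | toℕ j ∸ toℕ i in eq
    ...   | e′ | zero = contradiction (m∸n≡0⇒m≤n eq) (<⇒≱ i<j)
    ...   | e′ | suc k = k , ≤-trans (≤-reflexive (sym eq)) (≤-trans (m∸n≤m (toℕ j) (toℕ i)) (≤-pred (toℕ<n j))) , trans (sym (cong (λ t → iter φ t p) eq)) (sym e′)

    -- Periods of p are subtracted until the exponent fits the bound built into `Reach`, which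
    -- thereby becomes transitive. The fuel only makes the recursion structural.
    iter-reduce : ∀ fuel {k} p → k ≤ fuel → ∃[ j ] (j < suc K × iter φ j p ≡ iter φ k p)
    iter-reduce fuel {k} p k≤ with k <? suc K
    ... | yes k< = k , k< , refl
    iter-reduce zero p z≤n | no k≮ = contradiction (s≤s z≤n) k≮
    iter-reduce (suc f) {k} p k≤ | no k≮ with period p
    ... | t , t<K , e with iter-reduce f {k ∸ suc t} p (≤-pred (≤-trans (∸-monoʳ-< (s≤s z≤n) st≤k) k≤))
      where
      st≤k : suc t ≤ k
      st≤k = ≤-trans t<K (≤-trans (n≤1+n K) (≮⇒≥ k≮))
    ...   | j , j< , e′ = j , j< , trans e′ (trans (cong (iter φ (k ∸ suc t)) (sym e))
              (trans (sym (iter-+ φ (k ∸ suc t) (suc t) p)) (cong (λ s → iter φ s p)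
                (m∸n+n≡m (≤-trans t<K (≤-trans (n≤1+n K) (≮⇒≥ k≮)))))))

    reach-iter : ∀ k {p q} → iter φ k p ≡ q → Reach φ p q
    reach-iter k {p} e with iter-reduce k {k} p ≤-refl
    ... | j , j< , e′ = fromℕ< j< , trans (cong (λ s → iter φ s p) (toℕ-fromℕ< j<)) (trans e′ e)

    reach-refl : ∀ {p} → Reach φ p p
    reach-refl = reach-iter 0 refl

    reach-trans : ∀ {p q r} → Reach φ p q → Reach φ q r → Reach φ p r
    reach-trans {p} (j , refl) (k , e) = reach-iter (toℕ k + toℕ j) (trans (iter-+ φ (toℕ k) (toℕ j) p) e)

    -- An injective map of a finite set is inverted by its own powers: if p has period t + 1, then t
    -- further steps undo one.
    iter-back : ∀ k p → Reach φ (iter φ k p) p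
    iter-back zero    p = reach-refl
    iter-back (suc k) p with period p
    ... | t , _ , e = reach-trans step (iter-back k p)
      where
      step : Reach φ (φ (iter φ k p)) (iter φ k p)
      step = reach-iter t (trans (iter-shift φ t (iter φ k p)) (trans (sym (iter-+ φ (suc t) k p))
        (trans (cong (λ s → iter φ s p) (+-comm (suc t) k)) (trans (iter-+ φ k (suc t) p) (cong (iter φ k) e)))))

    reach-sym : ∀ {p q} → Reach φ p q → Reach φ q p
    reach-sym {p} (k , refl) = iter-back (toℕ k) p

    reach-invariant : ∀ {B : Set} (f : P → B) → (∀ p → f (φ p) ≡ f p) → ∀ {p q} → Reach φ p q → f q ≡ f p
    reach-invariant f inv {p} (k , refl) = go (toℕ k)
      where
      go : ∀ k → f (iter φ k p) ≡ f p
      go zero    = refl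
      go (suc k) = trans (inv (iter φ k p)) (go k)

    reach-stable : (Q : P → Set) → (∀ {p} → Q p → Q (φ p)) → ∀ {p q} → Reach φ p q → Q p → Q q
    reach-stable Q st {p} (k , refl) q₀ = go (toℕ k)
      where
      go : ∀ k → Q (iter φ k p)
      go zero    = q₀
      go (suc k) = st (go k)

  -- Each orbit has exactly one leader, so the number of circuits becomes the length of a filtered
  -- list.
  Leader : (P → P) → P → Set
  Leader φ p = ∀ (k : Fin (suc K)) → ¬ (toℕ (idx (iter φ (toℕ k) p)) < toℕ (idx p))

  leader? : ∀ φ p → Dec (Leader φ p)
  leader? φ p = all? (λ k → ¬? (toℕ (idx (iter φ (toℕ k) p)) <? toℕ (idx p)))

  leader-least : ∀ {φ p q} → Leader φ p → Reach φ p q → toℕ (idx p) ≤ toℕ (idx q)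
  leader-least {p = p} ℓ (k , refl) = ≮⇒≥ (ℓ k)

  leader-intro : ∀ {φ p} → (∀ q → Reach φ p q → toℕ (idx p) ≤ toℕ (idx q)) → Leader φ p
  leader-intro h k lt = <⇒≱ lt (h _ (k , refl))

  leader-unique : ∀ {φ} → (∀ {p q} → φ p ≡ φ q → p ≡ q) → ∀ {p q} → Leader φ p → Leader φ q → Reach φ p q → p ≡ q
  leader-unique inj ℓp ℓq r = idx-inj (toℕ-injective (≤-antisym (leader-least ℓp r) (leader-least ℓq (reach-sym _ inj r))))

  leader-exists : ∀ {φ} → (∀ {p q} → φ p ≡ φ q → p ≡ q) → ∀ p → ∃[ q ] (Leader φ q × Reach φ p q)
  leader-exists {φ} inj p with least (λ i → any? (λ k → toℕ (idx (iter φ (toℕ {suc K} k) p)) ≟ i)) (toℕ (idx p)) (zero , refl)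
  ... | i , (k , e) , _ , min = iter φ (toℕ k) p ,
    leader-intro (λ r pr → subst (_≤ toℕ (idx r)) (sym e) (≮⇒≥ λ lt →
      let (j , f) = reach-trans φ inj (k , refl) pr in min _ lt (j , cong (toℕ ∘ idx) f))) ,
    (k , refl)

-- Switchings

exchange : ∀ {m} → Fin m → Fin m → Fin m → Fin m
exchange i j k with k ≟ᶠ i
... | yes _ = j
... | no _ with k ≟ᶠ j
...   | yes _ = i
...   | no _  = k

exchange-left : ∀ {m} (i j : Fin m) → exchange i j i ≡ j
exchange-left i j with i ≟ᶠ i
... | yes _  = refl
... | no i≢i = contradiction refl i≢i

exchange-fix : ∀ {m} {i j k : Fin m} → k ≢ i → k ≢ j → exchange i j k ≡ k
exchange-fix {i = i} {j} {k} k≢i k≢j with k ≟ᶠ i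
... | yes k≡i = contradiction k≡i k≢i
... | no _ with k ≟ᶠ j
...   | yes k≡j = contradiction k≡j k≢j
...   | no _    = refl

exchange-involutive : ∀ {m} (i j k : Fin m) → exchange i j (exchange i j k) ≡ k
exchange-involutive i j k with k ≟ᶠ i
exchange-involutive i j k | yes refl with j ≟ᶠ k
... | yes j≡k = j≡k
... | no _ with j ≟ᶠ j
...   | yes _  = refl
...   | no j≢j = contradiction refl j≢j
exchange-involutive i j k | no k≢i with k ≟ᶠ j
... | yes refl = exchange-left i j
... | no k≢j   = exchange-fix k≢i k≢j

exchangeAt : ∀ {n m} → Fin n → Fin m → Fin m → Fin n × Fin m → Fin n × Fin m
exchangeAt v i j (u , k) with u ≟ᶠ v
... | yes _ = u , exchange i j k
... | no _  = u , k

exchangeAt-left : ∀ {n m} (v : Fin n) (i j : Fin m) → exchangeAt v i j (v , i) ≡ (v , j)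
exchangeAt-left v i j with v ≟ᶠ v
... | yes _  = cong (v ,_) (exchange-left i j)
... | no v≢v = contradiction refl v≢v

exchangeAt-other : ∀ {n m} {v : Fin n} {i j : Fin m} {q} → proj₁ q ≢ v → exchangeAt v i j q ≡ q
exchangeAt-other {v = v} {q = u , k} u≢v with u ≟ᶠ v
... | yes u≡v = contradiction u≡v u≢v
... | no _    = refl

exchangeAt-fix : ∀ {n m} {v : Fin n} {i j : Fin m} {q} → q ≢ (v , i) → q ≢ (v , j) → exchangeAt v i j q ≡ q
exchangeAt-fix {v = v} {q = u , k} q≢i q≢j with u ≟ᶠ v
... | yes refl = cong (u ,_) (exchange-fix (λ { refl → q≢i refl }) (λ { refl → q≢j refl }))
... | no _     = refl

-- A family Φ of permutations φ ω of the positions Fin n × Fin m, stable under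
-- composition with transpositions inside a fibre {v} × Fin m.  Position (v , i)
-- stands for an edge leaving v, and y ω (v , i) is its head.
record SwitchSystem {n : ℕ} (G : Graph n) (m : ℕ) : Set₁ where
  field
    S    : Set
    Φ    : List S
    Φ!   : Unique Φ
    y    : S → Fin n × Fin m → Fin n
    φ    : S → Fin n × Fin m → Fin n × Fin m
    swap : Fin n → Fin m → Fin m → S → S
    φ-tail      : ∀ {ω} → ω ∈ Φ → ∀ p → proj₁ (φ ω p) ≡ y ω p
    y-inj       : ∀ {ω} → ω ∈ Φ → ∀ {v i j} → y ω (v , i) ≡ y ω (v , j) → i ≡ j
    φ-inj       : ∀ {ω} → ω ∈ Φ → ∀ {p q} → φ ω p ≡ φ ω q → p ≡ q
    adj-y       : ∀ {ω} → ω ∈ Φ → ∀ p → T (adj G (proj₁ p) (y ω p))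
    y-antisym   : ∀ {ω} → ω ∈ Φ → ∀ {p q} → y ω p ≡ proj₁ q → y ω q ≡ proj₁ p → ⊥
    swap-∈      : ∀ {ω} → ω ∈ Φ → ∀ v i j → swap v i j ω ∈ Φ
    swap-invol  : ∀ {ω} → ω ∈ Φ → ∀ v i j → swap v i j (swap v i j ω) ≡ ω
    swap-y      : ∀ {ω} → ω ∈ Φ → ∀ v i j p → y (swap v i j ω) p ≡ y ω p
    swap-φ      : ∀ {ω} → ω ∈ Φ → ∀ v i j p → φ (swap v i j ω) p ≡ exchangeAt v i j (φ ω p)

position-index : ∀ {n m} → Fin n × Fin m → Fin (n * m)
position-index (v , i) = combine v i

position-index-injective : ∀ {n m} {p q : Fin n × Fin m} → position-index p ≡ position-index q → p ≡ q
position-index-injective {p = v , i} {u , j} e with combine-injective v i u j e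
... | refl , refl = refl

positions : ∀ n m → List (Fin n × Fin m)
positions n m = cartesianProduct (allFin n) (allFin m)

positions! : ∀ n m → Unique (positions n m)
positions! n m = Uniqueₚ.cartesianProduct⁺ (Uniqueₚ.allFin⁺ n) (Uniqueₚ.allFin⁺ m)

∈-positions : ∀ {n m} (p : Fin n × Fin m) → p ∈ positions n m
∈-positions (v , i) = ∈-cartesianProduct⁺ (∈-allFin v) (∈-allFin i)

module Switching {n : ℕ} {G : Graph n} {m : ℕ} (sys : SwitchSystem G m) where
  open SwitchSystem sys
  open Orbit {Fin n × Fin m} position-index position-index-injective public

  ΦP : List (S × (Fin n × Fin m))
  ΦP = cartesianProduct Φ (positions n m)

  ΦP! : Unique ΦP
  ΦP! = Uniqueₚ.cartesianProduct⁺ Φ! (positions! n m)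

  ∈-ΦP⁺ : ∀ {ω p} → ω ∈ Φ → (ω , p) ∈ ΦP
  ∈-ΦP⁺ {p = p} ω∈ = ∈-cartesianProduct⁺ ω∈ (∈-positions p)

  ∈-ΦP⁻ : ∀ {x} → x ∈ ΦP → proj₁ x ∈ Φ
  ∈-ΦP⁻ x∈ = proj₁ (∈-cartesianProduct⁻ Φ (positions n m) x∈)

  -- The trace left by an exchange: the label in `B` at which the circuit leaving p first re-enters
  -- the vertex of p. It can be read in the new labelling alone, provided `B` can.
  FirstHit : S → (Fin n × Fin m) → (Fin m → Set) → Fin m → Set
  FirstHit ω p B a = ∃[ k ] (iter (φ ω) (suc k) p ≡ (proj₁ p , a) ×
    (∀ j → j < k → ∀ b → B b → iter (φ ω) (suc j) p ≢ (proj₁ p , b)))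

  firstHit-unique : ∀ {ω p B a b} → B a → B b → FirstHit ω p B a → FirstHit ω p B b → a ≡ b
  firstHit-unique Ba Bb (k , e , min) (l , f , min′) with <-cmp k l
  ... | tri< k<l _ _ = contradiction e (min′ k k<l _ Ba)
  ... | tri≈ _ refl _ = cong proj₂ (trans (sym e) f)
  ... | tri> _ _ l<k = contradiction f (min l l<k _ Bb)

  Avoids : S → (Fin n × Fin m) → (Fin m → Set) → Set
  Avoids ω p A = ∀ a → A a → ¬ Reach (φ ω) p (proj₁ p , a)

  -- Swapping p with a ∈ A splices the cycle of p, which avoids A, in front of a.
  firstHit-swap : ∀ {ω} → ω ∈ Φ → ∀ {v i} {A : Fin m → Set} → Avoids ω (v , i) A →
    ∀ {a} → a ≡ i ⊎ A a → FirstHit (swap v i a ω) (v , i) (λ b → b ≡ i ⊎ A b) a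
  firstHit-swap {ω} ω∈ {v} {i} {A} av {a} a? with period (φ ω) (φ-inj ω∈) (v , i)
  ... | k₀ , _ , e₀ with least (λ k → iter (φ ω) (suc k) (v , i) ≟ᴾ (v , i)) k₀ e₀
  ...   | k , e , _ , min = k ,
    trans (cong φ′ (same k ≤-refl)) (trans (swap-φ ω∈ v i a _) (trans (cong (exchangeAt v i a) e) (exchangeAt-left v i a))) ,
    λ j j<k b b? f → off j j<k b b? (trans (sym (same (suc j) j<k)) f)
    where
    φ′ = φ (swap v i a ω)
    -- Before the cycle of p closes it meets neither i, by minimality of k, nor a label of A, by
    -- avoidance, so the transposition touches none of these steps.
    off : ∀ j → j < k → ∀ b → b ≡ i ⊎ A b → iter (φ ω) (suc j) (v , i) ≢ (v , b)
    off j j<k b (inj₁ refl) f = min j j<k f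
    off j j<k b (inj₂ Ab) f = av b Ab (reach-iter (φ ω) (φ-inj ω∈) (suc j) f)
    same : ∀ j → j ≤ k → iter φ′ j (v , i) ≡ iter (φ ω) j (v , i)
    same zero    _   = refl
    same (suc j) j<k = trans (cong φ′ (same j (<⇒≤ j<k))) (trans (swap-φ ω∈ v i a _)
      (exchangeAt-fix (off j j<k i (inj₁ refl)) (off j j<k a a?)))

  module _ {X Y : S × (Fin n × Fin m) → Set} (X? : Decidable X) (Y? : Decidable Y)
    (A : S → Fin n × Fin m → Fin m → Set) (t : ℕ)
    (avoid : ∀ {ω} → ω ∈ Φ → ∀ {p} → X (ω , p) → Avoids ω p (A ω p))
    (enough : ∀ {ω} → ω ∈ Φ → ∀ {p} → X (ω , p) → ∃[ ls ] (Unique ls × t ≤ length ls × (∀ {a} → a ∈ ls → A ω p a)))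
    (XY : ∀ {ω} → ω ∈ Φ → ∀ {v i} j → X (ω , (v , i)) → Y (swap v i j ω , (v , i)))
    (invA : ∀ {ω} → ω ∈ Φ → ∀ {v i} j {a} → A ω (v , i) a → A (swap v i j ω) (v , i) a)
    where

    private
      R : S × (Fin n × Fin m) → S × (Fin n × Fin m) → Set
      R (ω , p) (ω′ , p′) = p′ ≡ p × ∃[ a ] ((a ≡ proj₂ p ⊎ A ω p a) × ω′ ≡ swap (proj₁ p) (proj₂ p) a ω)

      back : ∀ {ω} → ω ∈ Φ → ∀ {v i} j {a} → A (swap v i j ω) (v , i) a → A ω (v , i) a
      back ω∈ {v} {i} j Aa = subst (λ z → A z (v , i) _) (swap-invol ω∈ v i j) (invA (swap-∈ ω∈ v i j) j Aa)

      mem : ∀ {x} → x ∈ filter X? ΦP → proj₁ x ∈ Φ × X x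
      mem x∈ = let (x∈′ , Xx) = ∈-filter⁻ X? {xs = ΦP} x∈ in ∈-ΦP⁻ x∈′ , Xx

      determined : ∀ {ω₁ ω₂ v i a b} → ω₁ ∈ Φ → ω₂ ∈ Φ → X (ω₁ , (v , i)) → X (ω₂ , (v , i)) →
        a ≡ i ⊎ A ω₁ (v , i) a → b ≡ i ⊎ A ω₂ (v , i) b → swap v i a ω₁ ≡ swap v i b ω₂ → a ≡ b
      determined {ω₁} {ω₂} {v} {i} {a} {b} ∈₁ ∈₂ X₁ X₂ a? b? e =
        firstHit-unique {ω = swap v i a ω₁} {p = v , i} {B = B} a? (tr b?) (firstHit-swap ∈₁ (avoid ∈₁ X₁) a?)
          (subst (λ z → FirstHit z (v , i) B b) (sym e) (weaken (firstHit-swap ∈₂ (avoid ∈₂ X₂) b?)))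
        where
        -- The label set may be evaluated at ω₁ or at ω₂. `tr` and `rt` transport between the two
        -- through the common image, so that both first hits refer to one set.
        B : Fin m → Set
        B c = c ≡ i ⊎ A ω₁ (v , i) c
        tr : ∀ {c} → c ≡ i ⊎ A ω₂ (v , i) c → B c
        tr (inj₁ c≡i) = inj₁ c≡i
        tr (inj₂ Ac)  = inj₂ (back ∈₁ a (subst (λ z → A z (v , i) _) (sym e) (invA ∈₂ b Ac)))
        rt : ∀ {c} → B c → c ≡ i ⊎ A ω₂ (v , i) c
        rt (inj₁ c≡i) = inj₁ c≡i
        rt (inj₂ Ac)  = inj₂ (back ∈₂ b (subst (λ z → A z (v , i) _) e (invA ∈₁ a Ac)))
        weaken : FirstHit (swap v i b ω₂) (v , i) (λ c → c ≡ i ⊎ A ω₂ (v , i) c) b → FirstHit (swap v i b ω₂) (v , i) B b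
        weaken (k , f , min) = k , f , λ j j<k c Bc → min j j<k c (rt Bc)

      module Partners {ω : S} {v : Fin n} {i : Fin m} (ω∈ : ω ∈ Φ) (Xx : X (ω , (v , i))) where
        f : Fin m → S × (Fin n × Fin m)
        f a = swap v i a ω , (v , i)

        f-unique : ∀ as → Unique as → (∀ {a} → a ∈ as → a ≡ i ⊎ A ω (v , i) a) → Unique (map f as)
        f-unique [] _ _ = []
        f-unique (a ∷ as) (a∉ ∷ u) h = All.tabulate fresh ∷ f-unique as u (λ b∈ → h (there b∈))
          where
          fresh : ∀ {z} → z ∈ map f as → f a ≢ z
          fresh z∈ e with ∈-map⁻ f z∈
          ... | b , b∈ , e′ = All.lookup a∉ b∈ (determined ω∈ ω∈ Xx Xx (h (here refl)) (h (there b∈)) (cong proj₁ (trans e e′)))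

        -- i is outside A because p reaches itself; this makes a = i an additional partner and gives
        -- t + 1 instead of t.
        i∉ : ∀ {ls} → (∀ {a} → a ∈ ls → A ω (v , i) a) → All (i ≢_) ls
        i∉ lsA = All.tabulate λ { a∈ refl → avoid ω∈ Xx i (lsA a∈) (reach-refl (φ ω) (φ-inj ω∈)) }

        inA : ∀ {ls} → (∀ {a} → a ∈ ls → A ω (v , i) a) → ∀ {a} → a ∈ i ∷ ls → a ≡ i ⊎ A ω (v , i) a
        inA lsA (here e)   = inj₁ e
        inA lsA (there a∈) = inj₂ (lsA a∈)

        partners : ∃[ ls ] (Unique ls × suc t ≤ length ls × (∀ {z} → z ∈ ls → z ∈ filter Y? ΦP × R (ω , (v , i)) z))
        partners = let (ls , uls , t≤ , lsA) = enough ω∈ Xx in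
          map f (i ∷ ls) , f-unique (i ∷ ls) (i∉ lsA ∷ uls) (inA lsA) ,
          s≤s (≤-trans t≤ (≤-reflexive (sym (length-map f ls)))) ,
          λ z∈ → let (a , a∈ , e) = ∈-map⁻ f z∈ in
            subst (λ z → z ∈ filter Y? ΦP × R (ω , (v , i)) z) (sym e)
              (∈-filter⁺ Y? (∈-ΦP⁺ (swap-∈ ω∈ v i a)) (XY ω∈ a Xx) , refl , a , inA lsA a∈ , refl)

      functional : ∀ {x x′ z} → x ∈ filter X? ΦP → x′ ∈ filter X? ΦP → R x z → R x′ z → x ≡ x′
      functional {ω₁ , (v , i)} {ω₂ , _} x∈ x′∈ (refl , a , a? , e) (refl , b , b? , e′) =
        cong (_, (v , i)) (trans (sym (swap-invol ∈₁ v i a)) (trans (cong (swap v i a) (trans (sym e) e′))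
          (trans (cong (λ c → swap v i c (swap v i b ω₂)) a≡b) (swap-invol ∈₂ v i b))))
        where
        ∈₁ = proj₁ (mem x∈)
        ∈₂ = proj₁ (mem x′∈)
        a≡b : a ≡ b
        a≡b = determined ∈₁ ∈₂ (proj₂ (mem x∈)) (proj₂ (mem x′∈)) a? b? (trans (sym e) e′)

    -- Exchanging p with itself or with a label in A leads into Y. Conversely, A survives the
    -- exchange by `invA`, the label used is the first hit in {i} ∪ A, and the exchange is an
    -- involution, so ω is recovered.
    switch-bound : suc t * length (filter X? ΦP) ≤ length (filter Y? ΦP)
    switch-bound = mult-length {R = R} (suc t) (Uniqueₚ.filter⁺ X? ΦP!)
      (λ x∈ → Partners.partners (proj₁ (mem x∈)) (proj₂ (mem x∈))) functional

-- Counting circuits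

module Circuits {n : ℕ} {G : Graph n} {m : ℕ} (sys : SwitchSystem G m) (L : ℕ) where
  open SwitchSystem sys
  open Switching sys

  -- Counts the circuits through a vertex: each circuit through v has exactly one local leader at v.
  LocalLeader : S × (Fin n × Fin m) → Set
  LocalLeader (ω , p) = ∀ j → toℕ j < toℕ (proj₂ p) → ¬ Reach (φ ω) p (proj₁ p , j)

  localLeader? : Decidable LocalLeader
  localLeader? (ω , p) = all? (λ j → (toℕ j <? toℕ (proj₂ p)) →-dec ¬? (reach? (φ ω) p (proj₁ p , j)))

  ΦV : List (S × Fin n)
  ΦV = cartesianProduct Φ (allFin n)

  below : (i : Fin m) → ∃[ ls ] (Unique ls × toℕ i ≤ length ls × (∀ {a} → a ∈ ls → toℕ a < toℕ i))
  below i = map f (allFin (toℕ i)) ,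
    Uniqueₚ.map⁺ (λ {a} {b} → inject≤-injective (<⇒≤ (toℕ<n i)) (<⇒≤ (toℕ<n i)) a b) (Uniqueₚ.allFin⁺ (toℕ i)) ,
    ≤-reflexive (sym (trans (length-map f (allFin (toℕ i))) (length-allFin (toℕ i)))) ,
    λ a∈ → let (b , _ , e) = ∈-map⁻ f a∈ in
      subst (λ z → toℕ z < toℕ i) (sym e) (subst (_< toℕ i) (sym (toℕ-inject≤ b _)) (toℕ<n b))
    where
    f : Fin (toℕ i) → Fin m
    f a = inject≤ a (<⇒≤ (toℕ<n i))

  module _ {C : S → Fin n → Set} (C? : ∀ ω v → Dec (C ω v))
    (C-swap : ∀ {ω} → ω ∈ Φ → ∀ {v} i j → C ω v → C (swap v i j ω) v) where

    private
      X Y : ℕ → S × (Fin n × Fin m) → Set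
      Y i (ω , p) = C ω (proj₁ p) × toℕ (proj₂ p) ≡ i
      X i x = Y i x × LocalLeader x

      Y? : ∀ i → Decidable (Y i)
      Y? i (ω , p) = C? ω (proj₁ p) ×-dec (toℕ (proj₂ p) ≟ i)

      X? : ∀ i → Decidable (X i)
      X? i x = Y? i x ×-dec localLeader? x

      C?′ : Decidable (λ (x : S × Fin n) → C (proj₁ x) (proj₂ x))
      C?′ x = C? (proj₁ x) (proj₂ x)

    -- In the permutation that the circuits induce on the labels 0, ..., i at v, the label i is a
    -- local leader exactly when it is a fixed point. Exchanges with the smaller labels turn this
    -- into i + 1 different images of i, hence the proportion 1 / (i + 1).
    localLeader-class : ∀ i → suc i * length (filter (X? i) ΦP) ≤ length (filter C?′ ΦV)
    localLeader-class i = ≤-trans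
      (switch-bound (X? i) (Y? i) (λ _ p a → toℕ a < toℕ (proj₂ p)) i
        (λ _ Xx a a< → proj₂ Xx a a<)
        (λ { _ {v , k} ((_ , refl) , _) → below k })
        (λ { ω∈ j ((c , e) , _) → C-swap ω∈ _ j c , e })
        (λ _ _ a< → a<))
      (inj-length (λ x → proj₁ x , proj₁ (proj₂ x)) (Uniqueₚ.filter⁺ (Y? i) ΦP!)
        (λ {x} x∈ → let (x∈′ , (c , _)) = ∈-filter⁻ (Y? i) {xs = ΦP} x∈ in
          ∈-filter⁺ C?′ (∈-cartesianProduct⁺ (∈-ΦP⁻ x∈′) (∈-allFin (proj₁ (proj₂ x)))) c)
        (λ {x} {x′} x∈ x′∈ e → cong₂ _,_ (cong proj₁ e) (cong₂ _,_ (cong proj₂ e)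
          (toℕ-injective (trans (proj₂ (proj₂ (∈-filter⁻ (Y? i) {xs = ΦP} x∈)))
            (sym (proj₂ (proj₂ (∈-filter⁻ (Y? i) {xs = ΦP} x′∈)))))))))

    -- The class C only has to be closed under exchanges at v; the bound is used for all vertices
    -- and again for the heavy ones.
    localLeader-bound : ∀ Λ → m < 2 ^ Λ →
      length (filter (λ x → C? (proj₁ x) (proj₁ (proj₂ x)) ×-dec localLeader? x) ΦP) ≤ Λ * length (filter C?′ ΦV)
    localLeader-bound Λ m< = ≤-trans
      (filter-cover _ X? ΦP m (λ {x} _ (c , ll) → toℕ (proj₂ (proj₂ x)) , toℕ<n _ , (c , refl) , ll))
      (harmonic Λ (λ i → length (filter (X? i) ΦP)) m< (λ i _ → localLeader-class i))

  Good : S × (Fin n × Fin m) → Set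
  Good (ω , p) = ∀ (a b : Fin L) → toℕ a < toℕ b → proj₁ (iter (φ ω) (toℕ a) p) ≢ proj₁ (iter (φ ω) (toℕ b) p)

  good? : Decidable Good
  good? (ω , p) = all? λ a → all? λ b → (toℕ a <? toℕ b) →-dec ¬? (_ ≟ᶠ _)

  -- A good walk does not come back to v in its first L - 1 steps, and an exchange at v alters only
  -- steps that arrive at v, so the walk is unchanged.
  good-swap : ∀ {ω} → ω ∈ Φ → ∀ {v a} i j → Good (ω , (v , a)) → Good (swap v i j ω , (v , a))
  good-swap {ω} ω∈ {v} {a} i j g b c b<c e = g b c b<c
    (trans (cong proj₁ (sym (same (toℕ b) (toℕ<n b)))) (trans e (cong proj₁ (same (toℕ c) (toℕ<n c)))))
    where
    same : ∀ k → k < L → iter (φ (swap v i j ω)) k (v , a) ≡ iter (φ ω) k (v , a)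
    same zero    _    = refl
    same (suc k) k<L = trans (cong (φ (swap v i j ω)) (same k (<⇒≤ k<L))) (trans (swap-φ ω∈ v i j _)
      (exchangeAt-other λ e′ → g (fromℕ< 0<L) (fromℕ< k<L)
        (subst₂ _<_ (sym (toℕ-fromℕ< 0<L)) (sym (toℕ-fromℕ< k<L)) (s≤s z≤n))
        (subst₂ (λ s t → proj₁ (iter (φ ω) s (v , a)) ≡ proj₁ (iter (φ ω) t (v , a)))
          (sym (toℕ-fromℕ< 0<L)) (sym (toℕ-fromℕ< k<L)) (sym e′))))
      where
      0<L : 0 < L
      0<L = ≤-trans (s≤s z≤n) k<L

  good-swap⁻ : ∀ {ω} → ω ∈ Φ → ∀ {v a} i j → Good (swap v i j ω , (v , a)) → Good (ω , (v , a))
  good-swap⁻ ω∈ {v} {a} i j g = subst (λ z → Good (z , (v , a))) (swap-invol ω∈ v i j) (good-swap (swap-∈ ω∈ v i j) i j g)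

  goods bads : S → Fin n → List (Fin m)
  goods ω v = filter (λ i → good? (ω , (v , i))) (allFin m)
  bads ω v = filter (λ i → ¬? (good? (ω , (v , i)))) (allFin m)

  badTotal : ℕ
  badTotal = length (filter (λ x → ¬? (good? x)) ΦP)

  -- At a light vertex a circuit that avoids all good positions is rare; at the few
  -- heavy vertices all circuits are counted.
  Light : S → Fin n → Set
  Light ω v = ⌊ m /2⌋ ≤ length (goods ω v)

  light? : ∀ ω v → Dec (Light ω v)
  light? ω v = ⌊ m /2⌋ ≤? length (goods ω v)

  goods-swap : ∀ {ω} → ω ∈ Φ → ∀ v i j → goods (swap v i j ω) v ≡ goods ω v
  goods-swap {ω} ω∈ v i j = filter-≐ (λ k → good? (swap v i j ω , (v , k))) (λ k → good? (ω , (v , k)))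
    (good-swap⁻ ω∈ i j , good-swap ω∈ i j) (allFin m)

  halves : ∀ k → 2 * ⌊ k /2⌋ ≤ k × k ≤ 2 * suc ⌊ k /2⌋
  halves zero          = z≤n , z≤n
  halves (suc zero)    = z≤n , s≤s z≤n
  halves (suc (suc k)) = let (a , b) = halves k in
    subst (_≤ suc (suc k)) (sym (*-suc 2 ⌊ k /2⌋)) (+-monoʳ-≤ 2 a) ,
    subst (suc (suc k) ≤_) (sym (*-suc 2 (suc ⌊ k /2⌋))) (+-monoʳ-≤ 2 b)

  heavy-bads : ∀ {ω v} → ¬ Light ω v → m ≤ 2 * length (bads ω v)
  heavy-bads {ω} {v} ¬l = +-cancelˡ-≤ (2 * length (goods ω v)) m _ (begin
    2 * length (goods ω v) + m                         ≤⟨ +-monoˡ-≤ m (≤-trans (*-monoʳ-≤ 2 (<⇒≤ (≰⇒> ¬l))) (proj₁ (halves m))) ⟩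
    m + m                                              ≡⟨ cong (m +_) (+-identityʳ m) ⟨
    2 * m                                              ≡⟨ cong (2 *_) (trans (sym (length-allFin m)) (filter-split (λ i → good? (ω , (v , i))) (allFin m))) ⟩
    2 * (length (goods ω v) + length (bads ω v))       ≡⟨ *-distribˡ-+ 2 (length (goods ω v)) _ ⟩
    2 * length (goods ω v) + 2 * length (bads ω v)     ∎)
    where open ≤-Reasoning

  heavyTotal : ℕ
  heavyTotal = length (filter (λ x → ¬? (light? (proj₁ x) (proj₂ x))) ΦV)

  -- A heavy vertex has at least m / 2 bad positions. Taking each bad position twice, by the factor
  -- `allFin 2`, avoids halving m.
  heavy-bound : m * heavyTotal ≤ 2 * badTotal
  heavy-bound = subst (m * heavyTotal ≤_) (trans (length-product _,_ Bad (allFin 2)) (trans (cong (badTotal *_) (length-allFin 2)) (*-comm badTotal 2)))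
    (mult-length {R = λ x z → proj₁ x ≡ proj₁ (proj₁ z) × proj₂ x ≡ proj₁ (proj₂ (proj₁ z))} m
      (Uniqueₚ.filter⁺ heavy? (Uniqueₚ.cartesianProduct⁺ Φ! (Uniqueₚ.allFin⁺ n)))
      partners
      (λ { _ _ (refl , refl) (refl , refl) → refl }))
    where
    heavy? : Decidable (λ (x : S × Fin n) → ¬ Light (proj₁ x) (proj₂ x))
    heavy? x = ¬? (light? (proj₁ x) (proj₂ x))
    Bad = filter (λ x → ¬? (good? x)) ΦP
    partners : ∀ {x} → x ∈ filter heavy? ΦV → ∃[ ls ] (Unique ls × m ≤ length ls ×
      (∀ {z} → z ∈ ls → z ∈ cartesianProduct Bad (allFin 2) × (proj₁ x ≡ proj₁ (proj₁ z) × proj₂ x ≡ proj₁ (proj₂ (proj₁ z)))))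
    partners {ω , v} x∈ = cartesianProduct (map f (bads ω v)) (allFin 2) ,
      Uniqueₚ.cartesianProduct⁺ (Uniqueₚ.map⁺ (λ { refl → refl }) (Uniqueₚ.filter⁺ _ (Uniqueₚ.allFin⁺ m))) (Uniqueₚ.allFin⁺ 2) ,
      subst (m ≤_) (sym len) (heavy-bads (proj₂ mem)) ,
      inBad
      where
      f : Fin m → S × (Fin n × Fin m)
      f i = ω , (v , i)
      mem = ∈-filter⁻ heavy? {xs = ΦV} x∈
      ω∈ : ω ∈ Φ
      ω∈ = proj₁ (∈-cartesianProduct⁻ Φ (allFin n) (proj₁ mem))
      len : length (cartesianProduct (map f (bads ω v)) (allFin 2)) ≡ 2 * length (bads ω v)
      len = trans (length-product _,_ (map f (bads ω v)) (allFin 2)) (trans (cong₂ _*_ (length-map f (bads ω v)) (length-allFin 2)) (*-comm (length (bads ω v)) 2))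
      inBad : ∀ {z} → z ∈ cartesianProduct (map f (bads ω v)) (allFin 2) → z ∈ cartesianProduct Bad (allFin 2) × (ω ≡ proj₁ (proj₁ z) × v ≡ proj₁ (proj₂ (proj₁ z)))
      inBad {z₁ , z₂} z∈ with ∈-cartesianProduct⁻ (map f (bads ω v)) (allFin 2) z∈
      ... | z₁∈ , _ with ∈-map⁻ f z₁∈
      ...   | i , i∈ , refl = ∈-cartesianProduct⁺ (∈-filter⁺ _ (∈-ΦP⁺ ω∈) (proj₂ (∈-filter⁻ _ {xs = allFin m} i∈))) (∈-allFin z₂) , refl , refl

  AvoidsGood : S × (Fin n × Fin m) → Set
  AvoidsGood (ω , p) = ∀ j → Good (ω , (proj₁ p , j)) → ¬ Reach (φ ω) p (proj₁ p , j)

  avoidsGood? : Decidable AvoidsGood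
  avoidsGood? (ω , p) = all? λ j → good? (ω , (proj₁ p , j)) →-dec ¬? (reach? (φ ω) p (proj₁ p , j))

  LightBad : S × (Fin n × Fin m) → Set
  LightBad x = (Light (proj₁ x) (proj₁ (proj₂ x)) × ¬ Good x) × AvoidsGood x

  lightBad? : Decidable LightBad
  lightBad? x = (light? (proj₁ x) (proj₁ (proj₂ x)) ×-dec ¬? (good? x)) ×-dec avoidsGood? x

  -- Switching with A the good labels at v, of which a light vertex has at least ⌊m/2⌋. Goodness at
  -- v is invariant under exchanges at v, so the image is still a bad position.
  light-bound : m * length (filter lightBad? ΦP) ≤ 2 * badTotal
  light-bound = begin
    m * k                        ≤⟨ *-monoˡ-≤ k (proj₂ (halves m)) ⟩
    2 * suc ⌊ m /2⌋ * k          ≡⟨ *-assoc 2 (suc ⌊ m /2⌋) k ⟩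
    2 * (suc ⌊ m /2⌋ * k)        ≤⟨ *-monoʳ-≤ 2 (switch-bound lightBad? (λ x → ¬? (good? x)) (λ ω p a → Good (ω , (proj₁ p , a))) ⌊ m /2⌋
                                      (λ _ Xx a ga → proj₂ Xx a ga)
                                      (λ { {ω} _ {p} ((l , _) , _) → goods ω (proj₁ p) , Uniqueₚ.filter⁺ _ (Uniqueₚ.allFin⁺ m) , l ,
                                           λ a∈ → proj₂ (∈-filter⁻ _ {xs = allFin m} a∈) })
                                      (λ { ω∈ j ((_ , ¬g) , _) g → ¬g (good-swap⁻ ω∈ _ j g) })
                                      (λ ω∈ j g → good-swap ω∈ _ j g)) ⟩
    2 * badTotal                 ∎
    where
    open ≤-Reasoning
    k = length (filter lightBad? ΦP)

  HeavyLeader : S × (Fin n × Fin m) → Set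
  HeavyLeader x = ¬ Light (proj₁ x) (proj₁ (proj₂ x)) × LocalLeader x

  heavyLeader? : Decidable HeavyLeader
  heavyLeader? x = ¬? (light? (proj₁ x) (proj₁ (proj₂ x))) ×-dec localLeader? x

  heavyLeader-bound : ∀ Λ → m < 2 ^ Λ → length (filter heavyLeader? ΦP) ≤ Λ * heavyTotal
  heavyLeader-bound = localLeader-bound (λ ω v → ¬? (light? ω v))
    (λ {ω} ω∈ {v} i j ¬l l → ¬l (subst (λ z → ⌊ m /2⌋ ≤ length z) (goods-swap ω∈ v i j) l))

  Many : S × (Fin n × Fin m) → Set
  Many (ω , p) = Leader (φ ω) p × ∃[ j ] (Good (ω , (proj₁ p , j)) × Reach (φ ω) p (proj₁ p , j))

  many? : Decidable Many
  many? (ω , p) = leader? (φ ω) p ×-dec any? λ j → good? (ω , (proj₁ p , j)) ×-dec reach? (φ ω) p (proj₁ p , j)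

  localLeader-exists : ∀ {ω} → ω ∈ Φ → ∀ q → ∃[ i ] (LocalLeader (ω , (proj₁ q , i)) × Reach (φ ω) q (proj₁ q , i))
  localLeader-exists {ω} ω∈ q
    with least (λ k → any? λ i → (toℕ i ≟ k) ×-dec reach? (φ ω) q (proj₁ q , i)) (toℕ (proj₂ q))
           (proj₂ q , refl , reach-refl (φ ω) (φ-inj ω∈))
  ... | _ , (i , refl , r) , _ , min = i , (λ j j<i r′ → min (toℕ j) j<i (j , refl , reach-trans (φ ω) (φ-inj ω∈) r r′)) , r

  -- The walk from the good position visits L distinct vertices, and each of them has a local leader
  -- of this circuit. Any of these determines the circuit, hence its leader.
  many-bound : L * length (filter many? ΦP) ≤ length (filter localLeader? ΦP)
  many-bound = mult-length {R = R} L (Uniqueₚ.filter⁺ many? ΦP!) partners functional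
    where
    R : S × (Fin n × Fin m) → S × (Fin n × Fin m) → Set
    R (ω , p) (ω′ , q) = ω ≡ ω′ × Leader (φ ω) p × Reach (φ ω) p q
    functional : ∀ {x x′ z} → x ∈ filter many? ΦP → x′ ∈ filter many? ΦP → R x z → R x′ z → x ≡ x′
    functional {ω , p} {_ , p′} x∈ _ (refl , ℓ , r) (refl , ℓ′ , r′) = cong (ω ,_) (leader-unique inj ℓ ℓ′
      (reach-trans (φ ω) inj r (reach-sym (φ ω) inj r′)))
      where
      inj : ∀ {p q} → φ ω p ≡ φ ω q → p ≡ q
      inj = φ-inj (∈-ΦP⁻ (proj₁ (∈-filter⁻ many? {xs = ΦP} x∈)))
    partners : ∀ {x} → x ∈ filter many? ΦP → ∃[ ls ] (Unique ls × L ≤ length ls ×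
      (∀ {z} → z ∈ ls → z ∈ filter localLeader? ΦP × R x z))
    partners {ω , p} x∈ with ∈-filter⁻ many? {xs = ΦP} x∈
    ... | x∈′ , ℓ , j , g , r = map f (allFin L) , Uniqueₚ.map⁺ f-inj (Uniqueₚ.allFin⁺ L) ,
      ≤-reflexive (sym (trans (length-map f (allFin L)) (length-allFin L))) ,
      λ z∈ → let (k , _ , e) = ∈-map⁻ f z∈ in subst (λ z → z ∈ filter localLeader? ΦP × R (ω , p) z) (sym e)
        (∈-filter⁺ localLeader? (∈-ΦP⁺ ω∈) (proj₁ (proj₂ (loc k))) ,
         refl , ℓ , reach-trans (φ ω) inj r (reach-trans (φ ω) inj (reach-iter (φ ω) inj (toℕ k) refl) (proj₂ (proj₂ (loc k)))))
      where
      ω∈ = ∈-ΦP⁻ x∈′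
      inj : ∀ {p q} → φ ω p ≡ φ ω q → p ≡ q
      inj = φ-inj ω∈
      q : Fin L → Fin n × Fin m
      q k = iter (φ ω) (toℕ k) (proj₁ p , j)
      loc : ∀ k → ∃[ i ] (LocalLeader (ω , (proj₁ (q k) , i)) × Reach (φ ω) (q k) (proj₁ (q k) , i))
      loc k = localLeader-exists ω∈ (q k)
      f : Fin L → S × (Fin n × Fin m)
      f k = ω , (proj₁ (q k) , proj₁ (loc k))
      f-inj : ∀ {k l} → f k ≡ f l → k ≡ l
      f-inj {k} {l} e with <-cmp (toℕ k) (toℕ l)
      ... | tri< k<l _ _ = contradiction (cong (proj₁ ∘ proj₂) e) (g k l k<l)
      ... | tri≈ _ k≡l _ = toℕ-injective k≡l
      ... | tri> _ _ l<k = contradiction (sym (cong (proj₁ ∘ proj₂) e)) (g l k l<k)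

  leaderTotal : ℕ
  leaderTotal = length (filter (λ x → leader? (φ (proj₁ x)) (proj₂ x)) ΦP)

  -- `position-index` orders by vertex first, so inside one fibre it compares labels.
  leader⇒localLeader : ∀ {ω p} → Leader (φ ω) p → LocalLeader (ω , p)
  leader⇒localLeader {ω} {v , i} ℓ j j<i r = <⇒≱ j<i (+-cancelˡ-≤ (m * toℕ v) _ _
    (subst₂ _≤_ (toℕ-combine v i) (toℕ-combine v j) (leader-least ℓ r)))

  -- Only the vertex v of the leader p is examined: either the circuit has a good position at v, or
  -- it misses all of them, so that p itself is bad, and v is light, or v is heavy and p is at least
  -- a local leader there.
  leader-split : leaderTotal ≤ length (filter many? ΦP) + (length (filter lightBad? ΦP) + length (filter heavyLeader? ΦP))
  leader-split = ≤-trans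
    (filter-⊎ (λ x → leader? (φ (proj₁ x)) (proj₂ x)) many? (λ x → lightBad? x ⊎-dec heavyLeader? x) ΦP cases)
    (+-monoʳ-≤ (length (filter many? ΦP)) (filter-⊎ (λ x → lightBad? x ⊎-dec heavyLeader? x) lightBad? heavyLeader? ΦP (λ _ → id)))
    where
    cases : ∀ {x} → x ∈ ΦP → Leader (φ (proj₁ x)) (proj₂ x) → Many x ⊎ (LightBad x ⊎ HeavyLeader x)
    cases {ω , p} x∈ ℓ with any? (λ j → good? (ω , (proj₁ p , j)) ×-dec reach? (φ ω) p (proj₁ p , j)) | light? ω (proj₁ p)
    ... | yes (j , g , r) | _      = inj₁ (ℓ , j , g , r)
    ... | no ¬gr          | yes l  = inj₂ (inj₁ ((l , λ g → ¬gr (proj₂ p , g , reach-refl (φ ω) (φ-inj (∈-ΦP⁻ x∈)))) , λ j g r → ¬gr (j , g , r)))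
    ... | no _            | no ¬l  = inj₂ (inj₂ (¬l , leader⇒localLeader ℓ))

  -- Divided by L m |Φ|, the right side reads Λ n / L for the long circuits plus 2 (1 + Λ) / m times
  -- the average number of bad positions.
  leaderTotal-bound : ∀ Λ → m < 2 ^ Λ →
    L * (m * leaderTotal) ≤ m * (Λ * (length Φ * n)) + L * (2 * badTotal + Λ * (2 * badTotal))
  leaderTotal-bound Λ m< = begin
    L * (m * leaderTotal)                          ≤⟨ *-monoʳ-≤ L (*-monoʳ-≤ m leader-split) ⟩
    L * (m * (M + (B + H)))                        ≡⟨ rearrange ⟩
    m * (L * M) + L * (m * B + m * H)              ≤⟨ +-mono-≤ (*-monoʳ-≤ m (≤-trans many-bound all-local)) (*-monoʳ-≤ L (+-mono-≤ light-bound heavy)) ⟩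
    m * (Λ * (length Φ * n)) + L * (2 * badTotal + Λ * (2 * badTotal)) ∎
    where
    open ≤-Reasoning
    open +-*-Solver
    M = length (filter many? ΦP)
    B = length (filter lightBad? ΦP)
    H = length (filter heavyLeader? ΦP)
    rearrange : L * (m * (M + (B + H))) ≡ m * (L * M) + L * (m * B + m * H)
    rearrange = solve 5 (λ l k x b h → l :* (k :* (x :+ (b :+ h))) := k :* (l :* x) :+ l :* (k :* b :+ k :* h)) refl L m M B H
    true? : ∀ (ω : S) (v : Fin n) → Dec (ω ≡ ω)
    true? _ _ = yes refl
    all-local : length (filter localLeader? ΦP) ≤ Λ * (length Φ * n)
    all-local = ≤-trans (⊆-length (Uniqueₚ.filter⁺ localLeader? ΦP!) (λ x∈ →
        let (x∈′ , ll) = ∈-filter⁻ localLeader? {xs = ΦP} x∈ in ∈-filter⁺ _ x∈′ (refl , ll)))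
      (≤-trans (localLeader-bound true? (λ _ _ _ _ → refl) Λ m<) (*-monoʳ-≤ Λ (≤-trans (length-filter _ ΦV)
        (≤-reflexive (trans (length-product _,_ Φ (allFin n)) (cong (length Φ *_) (length-allFin n)))))))
    heavy : m * H ≤ Λ * (2 * badTotal)
    heavy = ≤-trans (*-monoʳ-≤ m (heavyLeader-bound Λ m<)) (≤-trans
      (≤-reflexive (solve 3 (λ k a b → k :* (a :* b) := a :* (k :* b)) refl m Λ heavyTotal)) (*-monoʳ-≤ Λ heavy-bound))

-- Returning circuits and closed trails

concatMap-product : ∀ {A B C : Set} (f : A → B → C) xs ys → concatMap (λ a → map (f a) ys) xs ≡ cartesianProductWith f xs ys
concatMap-product f []       ys = refl
concatMap-product f (x ∷ xs) ys = cong (map (f x) ys ++_) (concatMap-product f xs ys)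

allLists! : ∀ {A : Set} {xs : List A} → Unique xs → ∀ ℓ → Unique (allLists xs ℓ)
allLists! u zero = [] ∷ []
allLists! {xs = xs} u (suc ℓ) = subst Unique (sym (concatMap-product _∷_ xs (allLists xs ℓ)))
  (Uniqueₚ.cartesianProductWith⁺ _∷_ ∷-injective u (allLists! u ℓ))

∈-allLists : ∀ {A : Set} {xs : List A} → (∀ a → a ∈ xs) → ∀ as → as ∈ allLists xs (length as)
∈-allLists full [] = here refl
∈-allLists {xs = xs} full (a ∷ as) = subst (a ∷ as ∈_) (sym (concatMap-product _∷_ xs (allLists xs (length as))))
  (∈-cartesianProductWith⁺ _∷_ (full a) (∈-allLists full as))

allLists-length : ∀ {A : Set} (xs : List A) ℓ {as} → as ∈ allLists xs ℓ → length as ≡ ℓ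
allLists-length xs zero (here refl) = refl
allLists-length xs (suc ℓ) as∈ with ∈-cartesianProductWith⁻ _∷_ xs (allLists xs ℓ) (subst (_ ∈_) (concatMap-product _∷_ xs (allLists xs ℓ)) as∈)
... | _ , _ , _ , bs∈ , refl = cong suc (allLists-length xs ℓ bs∈)

all⁺ : ∀ {A : Set} (p : A → Bool) {xs} → All (T ∘ p) xs → T (all p xs)
all⁺ p [] = tt
all⁺ p (px ∷ pxs) = Equivalence.from T-∧ (px , all⁺ p pxs)

all⁻ : ∀ {A : Set} (p : A → Bool) xs → T (all p xs) → All (T ∘ p) xs
all⁻ p [] _ = []
all⁻ p (x ∷ xs) t = let (px , pxs) = Equivalence.to T-∧ t in px ∷ all⁻ p xs pxs

pairwiseDistinct⁺ : ∀ {n} {es : List (Fin n × Fin n)} → AllPairs (λ e f → T (not (sameEdge e f))) es → T (pairwiseDistinctEdges es)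
pairwiseDistinct⁺ [] = tt
pairwiseDistinct⁺ (h ∷ t) = Equivalence.from T-∧ (all⁺ _ h , pairwiseDistinct⁺ t)

pairwiseDistinct⁻ : ∀ {n} (es : List (Fin n × Fin n)) → T (pairwiseDistinctEdges es) → AllPairs (λ e f → T (not (sameEdge e f))) es
pairwiseDistinct⁻ [] _ = []
pairwiseDistinct⁻ (e ∷ es) t = let (h , t′) = Equivalence.to T-∧ t in all⁻ _ es h ∷ pairwiseDistinct⁻ es t′

¬sameEdge⁺ : ∀ {n} {a b c d : Fin n} → ¬ (a ≡ c × b ≡ d) → ¬ (a ≡ d × b ≡ c) → T (not (sameEdge (a , b) (c , d)))
¬sameEdge⁺ {a = a} {b} {c} {d} h h′ with a ≟ᶠ c | b ≟ᶠ d | a ≟ᶠ d | b ≟ᶠ c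
... | yes p | yes q | _     | _     = contradiction (p , q) h
... | _     | _     | yes p | yes q = contradiction (p , q) h′
... | yes _ | no _  | yes _ | no _  = tt
... | yes _ | no _  | no _  | _     = tt
... | no _  | _     | yes _ | no _  = tt
... | no _  | _     | no _  | _     = tt

closedTrailSeqs : ∀ {n} → Graph n → ℕ → List (List (Fin n))
closedTrailSeqs {n} G ℓ = filterᵇ (isClosedTrail G) (allLists (allFin n) ℓ)

zip-map : ∀ {A B C : Set} (f : A → B) (g : A → C) xs → zip (map f xs) (map g xs) ≡ map (λ x → f x , g x) xs
zip-map f g []       = refl
zip-map f g (x ∷ xs) = cong (_ ∷_) (zip-map f g xs)

map-jointly-injective : ∀ {A B C : Set} {f : A → B} {g : A → C} → (∀ {x z} → f x ≡ f z → g x ≡ g z → x ≡ z) →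
  ∀ xs zs → map f xs ≡ map f zs → map g xs ≡ map g zs → xs ≡ zs
map-jointly-injective inj []       []       _ _ = refl
map-jointly-injective inj (x ∷ xs) (z ∷ zs) e e′ = cong₂ _∷_ (inj (∷-injectiveˡ e) (∷-injectiveˡ e′))
  (map-jointly-injective inj xs zs (∷-injectiveʳ e) (∷-injectiveʳ e′))

module Returns {n : ℕ} {G : Graph n} {m : ℕ} (sys : SwitchSystem G m) (L : ℕ) where
  open SwitchSystem sys
  open Switching sys
  open Circuits sys L

  Ret : S × (Fin n × Fin m) → Set
  Ret (ω , q) = ∃[ t ] (1 ≤ toℕ {L} t × proj₁ (iter (φ ω) (toℕ t) q) ≡ proj₁ q)

  ret? : Decidable Ret
  ret? (ω , q) = any? λ t → (1 ≤? toℕ t) ×-dec (_ ≟ᶠ _)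

  retTotal : ℕ
  retTotal = length (filter ret? ΦP)

  bad⇒ret : ∀ {ω p} → ¬ Good (ω , p) → ∃[ i ] (i < L × Ret (ω , iter (φ ω) i p))
  bad⇒ret {ω} {p} ¬g with any? (λ a → any? λ b → (toℕ {L} a <? toℕ {L} b) ×-dec (proj₁ (iter (φ ω) (toℕ a) p) ≟ᶠ proj₁ (iter (φ ω) (toℕ b) p)))
  ... | no ¬ab = contradiction (λ a b a<b e → ¬ab (a , b , a<b , e)) ¬g
  ... | yes (a , b , a<b , e) = toℕ a , toℕ<n a , fromℕ< t<L , subst (1 ≤_) (sym (toℕ-fromℕ< t<L)) (m<n⇒0<n∸m a<b) ,
    trans (cong proj₁ (trans (cong (λ s → iter (φ ω) s (iter (φ ω) (toℕ a) p)) (toℕ-fromℕ< t<L))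
      (trans (sym (iter-+ (φ ω) (toℕ b ∸ toℕ a) (toℕ a) p)) (cong (λ s → iter (φ ω) s p) (m∸n+n≡m (<⇒≤ a<b)))))) (sym e)
    where
    t<L : toℕ b ∸ toℕ a < L
    t<L = ≤-trans (s≤s (m∸n≤m (toℕ b) (toℕ a))) (toℕ<n b)

  -- A repetition at steps a < b is a return of the position reached after a steps. For each fixed
  -- shift the map is injective because φ is, hence the factor L.
  bad-bound : badTotal ≤ L * retTotal
  bad-bound = ≤-trans (filter-cover (λ x → ¬? (good? x)) (λ i x → ret? (shift i x)) ΦP L (λ _ → bad⇒ret))
    (sumTo-const L λ i _ → inj-length (shift i) (Uniqueₚ.filter⁺ (λ x → ret? (shift i x)) ΦP!)
      (λ x∈ → let (x∈′ , r) = ∈-filter⁻ (λ x → ret? (shift i x)) {xs = ΦP} x∈ in ∈-filter⁺ ret? (∈-ΦP⁺ (∈-ΦP⁻ x∈′)) r)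
      (shift-inj i))
    where
    shift : ℕ → S × (Fin n × Fin m) → S × (Fin n × Fin m)
    shift i (ω , p) = ω , iter (φ ω) i p
    shift-inj : ∀ i {x x′} → x ∈ filter (λ x → ret? (shift i x)) ΦP → x′ ∈ filter (λ x → ret? (shift i x)) ΦP → shift i x ≡ shift i x′ → x ≡ x′
    shift-inj i {ω , p} {ω′ , p′} x∈ _ e with cong proj₁ e
    ... | refl = cong (ω ,_) (iter-injective (φ-inj (∈-ΦP⁻ (proj₁ (∈-filter⁻ (λ x → ret? (shift i x)) {xs = ΦP} x∈)))) i (cong proj₂ e))

  FirstRet : ℕ → S × (Fin n × Fin m) → Set
  FirstRet ℓ (ω , q) = (1 ≤ ℓ × proj₁ (iter (φ ω) ℓ q) ≡ proj₁ q) × (∀ (k : Fin ℓ) → ¬ (1 ≤ toℕ k × proj₁ (iter (φ ω) (toℕ k) q) ≡ proj₁ q))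

  firstRet? : ∀ ℓ → Decidable (FirstRet ℓ)
  firstRet? ℓ (ω , q) = ((1 ≤? ℓ) ×-dec (_ ≟ᶠ _)) ×-dec all? λ k → ¬? ((1 ≤? toℕ k) ×-dec (_ ≟ᶠ _))

  firstRetTotal : ℕ → ℕ
  firstRetTotal ℓ = length (filter (firstRet? ℓ) ΦP)

  ret-split : retTotal ≤ sumTo L firstRetTotal
  ret-split = filter-cover ret? firstRet? ΦP L first
    where
    first : ∀ {x} → x ∈ ΦP → Ret x → ∃[ ℓ ] (ℓ < L × FirstRet ℓ x)
    first {ω , q} _ (t , r) with least (λ k → (1 ≤? k) ×-dec (proj₁ (iter (φ ω) k q) ≟ᶠ proj₁ q)) (toℕ t) r
    ... | ℓ , r′ , ℓ≤ , min = ℓ , ≤-trans (s≤s ℓ≤) (toℕ<n t) , r′ , λ k → min (toℕ k) (toℕ<n k)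

  -- Length 1 would be a loop, and length 2 would traverse one edge in both directions.
  firstRet≥3 : ∀ {ℓ ω q} → ω ∈ Φ → FirstRet ℓ (ω , q) → 3 ≤ ℓ
  firstRet≥3 {zero} ω∈ ((() , _) , _)
  firstRet≥3 {suc zero} {ω} {q} ω∈ ((_ , e) , _) = ⊥-elim (subst T (irrefl G (proj₁ q))
    (subst (λ z → T (adj G (proj₁ q) z)) (trans (sym (φ-tail ω∈ q)) e) (adj-y ω∈ q)))
  firstRet≥3 {suc (suc zero)} {ω} {q} ω∈ ((_ , e) , _) = ⊥-elim (y-antisym ω∈ {q} {φ ω q} (sym (φ-tail ω∈ q)) (trans (sym (φ-tail ω∈ (φ ω q))) e))
  firstRet≥3 {suc (suc (suc _))} _ _ = s≤s (s≤s (s≤s z≤n))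

  Base : S × List (Fin n × Fin m) → Set
  Base (ω , qs) = Unique qs × map (y ω) qs ≡ rotate1 (map proj₁ qs)

  Follows : S → List (Fin n × Fin m) → Set
  Follows ω []            = ⊤
  Follows ω (_ ∷ [])      = ⊤
  Follows ω (q ∷ q′ ∷ qs) = φ ω q ≡ q′ × Follows ω (q′ ∷ qs)

  follows? : ∀ ω qs → Dec (Follows ω qs)
  follows? ω []            = yes tt
  follows? ω (_ ∷ [])      = yes tt
  follows? ω (q ∷ q′ ∷ qs) = (φ ω q ≟ᴾ q′) ×-dec follows? ω (q′ ∷ qs)

  -- Interpolates between a trail followed by φ, at k = 0, and an arbitrary closed trail by
  -- releasing the first k transitions. There are only ℓ - 1 of them: the last step must return to
  -- the first vertex, not to the first position.
  Partial : ℕ → S × List (Fin n × Fin m) → Set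
  Partial k (ω , qs) = Base (ω , qs) × Follows ω (drop k qs)

  partial? : ∀ k → Decidable (Partial k)
  partial? k (ω , qs) = (AllPairs.allPairs? (λ p q → ¬? (p ≟ᴾ q)) qs ×-dec ≡-dec _≟ᶠ_ _ _) ×-dec follows? ω (drop k qs)

  ΦQ : ℕ → List (S × List (Fin n × Fin m))
  ΦQ ℓ = cartesianProduct Φ (allLists (positions n m) ℓ)

  ΦQ! : ∀ ℓ → Unique (ΦQ ℓ)
  ΦQ! ℓ = Uniqueₚ.cartesianProduct⁺ Φ! (allLists! (positions! n m) ℓ)

  ∈-ΦQ⁻ : ∀ ℓ {x} → x ∈ ΦQ ℓ → proj₁ x ∈ Φ × proj₂ x ∈ allLists (positions n m) ℓ
  ∈-ΦQ⁻ ℓ = ∈-cartesianProduct⁻ Φ (allLists (positions n m) ℓ)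

  follows-applyUpTo : ∀ ω (f : ℕ → Fin n × Fin m) → (∀ j → φ ω (f j) ≡ f (suc j)) → ∀ k → Follows ω (applyUpTo f k)
  follows-applyUpTo ω f h zero          = tt
  follows-applyUpTo ω f h (suc zero)    = tt
  follows-applyUpTo ω f h (suc (suc k)) = h 0 , follows-applyUpTo ω (f ∘ suc) (λ j → h (suc j)) (suc k)

  firstRet-trace : ∀ k → firstRetTotal (suc k) ≤ length (filter (partial? 0) (ΦQ (suc k)))
  firstRet-trace k = inj-length trace (Uniqueₚ.filter⁺ (firstRet? (suc k)) ΦP!) mem
    (λ _ _ e → cong₂ _,_ (cong proj₁ e) (∷-injectiveˡ (cong proj₂ e)))
    where
    trace : S × (Fin n × Fin m) → S × List (Fin n × Fin m)
    trace (ω , q) = ω , applyUpTo (λ j → iter (φ ω) j q) (suc k)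
    mem : ∀ {x} → x ∈ filter (firstRet? (suc k)) ΦP → trace x ∈ filter (partial? 0) (ΦQ (suc k))
    mem {ω , q} x∈ = ∈-filter⁺ (partial? 0)
      (∈-cartesianProduct⁺ ω∈ (subst (λ s → applyUpTo it (suc k) ∈ allLists (positions n m) s) (length-applyUpTo it (suc k)) (∈-allLists ∈-positions (applyUpTo it (suc k)))))
      ((Uniqueₚ.applyUpTo⁺₁ it (suc k) distinct , closed) , follows-applyUpTo ω it (λ _ → refl) (suc k))
      where
      it : ℕ → Fin n × Fin m
      it j = iter (φ ω) j q
      ω∈ = ∈-ΦP⁻ (proj₁ (∈-filter⁻ (firstRet? (suc k)) {xs = ΦP} x∈))
      fr = proj₂ (∈-filter⁻ (firstRet? (suc k)) {xs = ΦP} x∈)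
      -- Equal positions at i < j would, φ being injective, force a return after j - i steps,
      -- earlier than the first one.
      distinct : ∀ {i j} → i < j → j < suc k → it i ≢ it j
      distinct {i} {j} i<j j<ℓ e = proj₂ fr (fromℕ< d<) (subst (1 ≤_) (sym (toℕ-fromℕ< d<)) (m<n⇒0<n∸m i<j) ,
        cong proj₁ (trans (cong it (toℕ-fromℕ< d<)) (sym (iter-∸ (φ ω) (φ-inj ω∈) q (<⇒≤ i<j) e))))
        where
        d< : j ∸ i < suc k
        d< = ≤-trans (s≤s (m∸n≤m j i)) j<ℓ
      closed : map (y ω) (applyUpTo it (suc k)) ≡ rotate1 (map proj₁ (applyUpTo it (suc k)))
      closed = begin
        map (y ω) (applyUpTo it (suc k))                        ≡⟨ map-applyUpTo it (y ω) (suc k) ⟩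
        applyUpTo (y ω ∘ it) (suc k)                            ≡⟨ applyUpTo-cong′ (λ j → sym (φ-tail ω∈ (it j))) (suc k) ⟩
        applyUpTo (proj₁ ∘ it ∘ suc) (suc k)                    ≡⟨ applyUpTo-∷ʳ (proj₁ ∘ it ∘ suc) k ⟨
        applyUpTo (proj₁ ∘ it ∘ suc) k ++ [ proj₁ (it (suc k)) ] ≡⟨ cong₂ (λ as a → as ++ [ a ]) (sym (map-applyUpTo (it ∘ suc) proj₁ k)) (proj₂ (proj₁ fr)) ⟩
        map proj₁ (applyUpTo (it ∘ suc) k) ++ [ proj₁ q ]        ∎
        where
        open ≡-Reasoning
        applyUpTo-cong′ : ∀ {f g : ℕ → Fin n} → (∀ j → f j ≡ g j) → ∀ s → applyUpTo f s ≡ applyUpTo g s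
        applyUpTo-cong′ h zero    = refl
        applyUpTo-cong′ h (suc s) = cong₂ _∷_ (h 0) (applyUpTo-cong′ (λ j → h (suc j)) s)

  -- Two positions on the same edge either have the same direction and agree by `y-inj`, or have
  -- opposite directions, which `y-antisym` excludes.
  base-closedTrail : ∀ {ω qs} → ω ∈ Φ → Base (ω , qs) → T (isClosedTrail G (map proj₁ qs))
  base-closedTrail {ω} {qs} ω∈ (u , e) = Equivalence.from T-∧ (
    subst (λ es → T (all isEdge es)) (sym edges) (all⁺ isEdge {map edge qs} (tabulate-map {T ∘ isEdge} (adj-y ω∈) {qs})) ,
    subst (λ es → T (pairwiseDistinctEdges es)) (sym edges) (pairwiseDistinct⁺ (distinct u)))
    where
    isEdge : Fin n × Fin n → Bool
    isEdge e = adj G (proj₁ e) (proj₂ e)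
    edge : Fin n × Fin m → Fin n × Fin n
    edge q = proj₁ q , y ω q
    edges : walkEdges (map proj₁ qs) ≡ map edge qs
    edges = trans (cong (zip (map proj₁ qs)) (sym e)) (zip-map proj₁ (y ω) qs)
    tabulate-map : ∀ {Q : Fin n × Fin n → Set} → (∀ q → Q (edge q)) → ∀ {as} → All Q (map edge as)
    tabulate-map h {[]}     = []
    tabulate-map h {a ∷ as} = h a ∷ tabulate-map h
    sep : ∀ {p q} → p ≢ q → T (not (sameEdge (edge p) (edge q)))
    sep {v , i} {u , j} p≢q = ¬sameEdge⁺ {a = v} {y ω (v , i)} {u} {y ω (u , j)}
      (λ { (refl , f) → p≢q (cong (v ,_) (y-inj ω∈ f)) })
      (λ { (f , g) → y-antisym ω∈ {v , i} {u , j} g (sym f) })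
    distinct : ∀ {as} → Unique as → AllPairs (λ e f → T (not (sameEdge e f))) (map edge as)
    distinct [] = []
    distinct (h ∷ u) = Allₚ.map⁺ (All.map sep h) ∷ distinct u

  -- For fixed ω the vertex sequence determines the positions: each is given by its tail and head,
  -- and the heads are the tails rotated by one.
  partial-end : ∀ k ℓ → length (filter (partial? k) (ΦQ ℓ)) ≤ length Φ * length (closedTrailSeqs G ℓ)
  partial-end k ℓ = subst (length (filter (partial? k) (ΦQ ℓ)) ≤_) (length-product _,_ Φ (closedTrailSeqs G ℓ))
    (inj-length (λ x → proj₁ x , map proj₁ (proj₂ x)) (Uniqueₚ.filter⁺ (partial? k) (ΦQ! ℓ)) mem inj)
    where
    un : ∀ {x} → x ∈ filter (partial? k) (ΦQ ℓ) → x ∈ ΦQ ℓ × Partial k x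
    un = ∈-filter⁻ (partial? k) {xs = ΦQ ℓ}
    mem : ∀ {x} → x ∈ filter (partial? k) (ΦQ ℓ) → (proj₁ x , map proj₁ (proj₂ x)) ∈ cartesianProduct Φ (closedTrailSeqs G ℓ)
    mem {ω , qs} x∈ = let (x∈′ , (b , _)) = un x∈ ; (ω∈ , qs∈) = ∈-ΦQ⁻ ℓ x∈′ in
      ∈-cartesianProduct⁺ ω∈ (∈-filter⁺ (T? ∘ isClosedTrail G)
        (subst (λ s → map proj₁ qs ∈ allLists (allFin n) s) (trans (length-map proj₁ qs) (allLists-length (positions n m) ℓ qs∈)) (∈-allLists ∈-allFin (map proj₁ qs)))
        (base-closedTrail ω∈ b))
    inj : ∀ {x x′} → x ∈ filter (partial? k) (ΦQ ℓ) → x′ ∈ filter (partial? k) (ΦQ ℓ) →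
      (proj₁ x , map proj₁ (proj₂ x)) ≡ (proj₁ x′ , map proj₁ (proj₂ x′)) → x ≡ x′
    inj {ω , qs} {ω′ , qs′} x∈ x′∈ e with cong proj₁ e
    ... | refl = cong (ω ,_) (map-jointly-injective joint qs qs′ (cong proj₂ e)
        (trans (proj₂ (proj₁ (proj₂ (un x∈)))) (trans (cong rotate1 (cong proj₂ e)) (sym (proj₂ (proj₁ (proj₂ (un x′∈))))))))
      where
      joint : ∀ {p q} → proj₁ p ≡ proj₁ q → y ω p ≡ y ω q → p ≡ q
      joint {v , i} refl f = cong (v ,_) (y-inj (proj₁ (∈-ΦQ⁻ ℓ (proj₁ (un x∈)))) f)

  module Step (k ℓ : ℕ) (k+1<ℓ : suc k < ℓ) where
    Split : List (Fin n × Fin m) → Fin n × Fin m → Fin n × Fin m → List (Fin n × Fin m) → Set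
    Split qs q q′ rest = drop k qs ≡ q ∷ q′ ∷ rest

    R : S × List (Fin n × Fin m) → S × List (Fin n × Fin m) → Set
    R (ω , qs) (ω′ , qs′) = qs′ ≡ qs × ∃[ q ] ∃[ q′ ] ∃[ rest ] ∃[ r ] (Split qs q q′ rest × φ ω q ≡ q′ × ω′ ≡ swap (proj₁ q′) (proj₂ q′) r ω)

    split : ∀ k {ℓ} (qs : List (Fin n × Fin m)) → length qs ≡ ℓ → suc k < ℓ → ∃[ q ] ∃[ q′ ] ∃[ rest ] (drop k qs ≡ q ∷ q′ ∷ rest × length rest ≤ ℓ)
    split zero (q ∷ q′ ∷ rest) refl lt = q , q′ , rest , refl , ≤-trans (n≤1+n _) (n≤1+n _)
    split zero (q ∷ []) refl (s≤s ())
    split (suc k) (q ∷ qs) refl (s≤s lt) = let (a , b , c , e , le) = split k qs refl lt in a , b , c , e , ≤-trans le (n≤1+n _)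

    -- The label used is visible as the new successor of q, and q is known because the list of
    -- positions is kept.
    recover : ∀ {ω q q′} r → ω ∈ Φ → φ ω q ≡ q′ → φ (swap (proj₁ q′) (proj₂ q′) r ω) q ≡ (proj₁ q′ , r)
    recover {ω} {q} r ω∈ refl = trans (swap-φ ω∈ _ _ r q) (exchangeAt-left _ _ r)

    mem : ∀ {x} → x ∈ filter (partial? k) (ΦQ ℓ) → proj₁ x ∈ Φ × proj₂ x ∈ allLists (positions n m) ℓ × Partial k x
    mem x∈ = let (x∈′ , p) = ∈-filter⁻ (partial? k) {xs = ΦQ ℓ} x∈ ; (a , b) = ∈-ΦQ⁻ ℓ x∈′ in a , b , p

    functional : ∀ {x x′ z} → x ∈ filter (partial? k) (ΦQ ℓ) → x′ ∈ filter (partial? k) (ΦQ ℓ) → R x z → R x′ z → x ≡ x′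
    functional {ω₁ , qs} {ω₂ , _} x∈ x′∈ (refl , q , q′ , rest , r , sp , f , e) (refl , q₂ , q₂′ , rest₂ , r₂ , sp₂ , f₂ , e₂)
      with trans (sym sp) sp₂
    ... | refl = cong (_, qs) (trans (sym (swap-invol ∈₁ (proj₁ q′) (proj₂ q′) r)) (trans (cong (swap (proj₁ q′) (proj₂ q′) r) (trans (sym e) e₂))
        (trans (cong (λ c → swap (proj₁ q′) (proj₂ q′) c (swap (proj₁ q′) (proj₂ q′) r₂ ω₂)) r≡) (swap-invol ∈₂ (proj₁ q′) (proj₂ q′) r₂))))
      where
      ∈₁ = proj₁ (mem x∈)
      ∈₂ = proj₁ (mem x′∈)
      r≡ : r ≡ r₂
      r≡ = cong proj₂ (trans (sym (recover r ∈₁ f)) (trans (cong (λ z → φ z q) (trans (sym e) e₂)) (recover r₂ ∈₂ f₂)))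

    follows-swap : ∀ {ω v i r} → ω ∈ Φ → ∀ q qs → All (_≢ (v , i)) qs → All (_≢ (v , r)) qs → Follows ω (q ∷ qs) → Follows (swap v i r ω) (q ∷ qs)
    follows-swap ω∈ q [] _ _ _ = tt
    follows-swap {v = v} {i} {r} ω∈ q (q′ ∷ qs) (a ∷ as) (b ∷ bs) (e , f) =
      trans (swap-φ ω∈ v i r q) (trans (cong (exchangeAt v i r) e) (exchangeAt-fix a b)) , follows-swap ω∈ q′ qs as bs f

    module _ {ω : S} {qs : List (Fin n × Fin m)} (ω∈ : ω ∈ Φ) (qs∈ : qs ∈ allLists (positions n m) ℓ) (px : Partial k (ω , qs))
      {q q′ : Fin n × Fin m} {rest : List (Fin n × Fin m)} (sp : Split qs q q′ rest) (rest≤ : length rest ≤ ℓ) where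

      private
        v = proj₁ q′
        i = proj₂ q′

        fol : Follows ω (q ∷ q′ ∷ rest)
        fol = subst (Follows ω) sp (proj₂ px)

        u : Unique (q ∷ q′ ∷ rest)
        u = subst Unique sp (Uniqueₚ.drop⁺ k (proj₁ (proj₁ px)))

        allowed? : Decidable (λ r → (v , r) ∉ rest)
        allowed? r = ¬? (Any.any? ((v , r) ≟ᴾ_) rest)

        allowed : List (Fin m)
        allowed = filter allowed? (allFin m)

        f : Fin m → S × List (Fin n × Fin m)
        f r = swap v i r ω , qs

        f-inj : ∀ {r r′} → f r ≡ f r′ → r ≡ r′
        f-inj {r} {r′} e = cong proj₂ (trans (sym (recover r ω∈ (proj₁ fol))) (trans (cong (λ z → φ (proj₁ z) q) e) (recover r′ ω∈ (proj₁ fol))))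

        forbidden≤ : length (filter (λ r → ¬? (allowed? r)) (allFin m)) ≤ length rest
        forbidden≤ = inj-length (v ,_) (Uniqueₚ.filter⁺ _ (Uniqueₚ.allFin⁺ m))
          (λ {r} r∈ → decidable-stable (Any.any? ((v , r) ≟ᴾ_) rest) (proj₂ (∈-filter⁻ (λ r → ¬? (allowed? r)) {xs = allFin m} r∈)))
          (λ { _ _ refl → refl })

        enough : m ∸ ℓ ≤ length allowed
        enough = m≤n+o⇒m∸n≤o m ℓ (begin
          m                                                  ≡⟨ length-allFin m ⟨
          length (allFin m)                                  ≡⟨ filter-split allowed? (allFin m) ⟩
          length allowed + _                                 ≤⟨ +-monoʳ-≤ (length allowed) (≤-trans forbidden≤ rest≤) ⟩
          length allowed + ℓ                                 ≡⟨ +-comm (length allowed) ℓ ⟩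
          ℓ + length allowed                                 ∎)
          where open ≤-Reasoning

        target : ∀ {r} → (v , r) ∉ rest → Partial (suc k) (f r)
        target {r} r∉ = (proj₁ (proj₁ px) , trans (map-cong (swap-y ω∈ v i r) qs) (proj₂ (proj₁ px))) ,
          subst (Follows (swap v i r ω)) (sym sp′) (follows-swap ω∈ q′ rest (All.map (λ h e → h (sym e)) (AllPairs.head (AllPairs.tail u))) (All.tabulate λ { z∈ refl → r∉ z∈ }) (proj₂ fol))
          where
          sp′ : drop (suc k) qs ≡ q′ ∷ rest
          sp′ = trans (trans (cong (λ s → drop s qs) (+-comm 1 k)) (sym (drop-drop k 1 qs))) (cong (drop 1) sp)

      partners : ∃[ ls ] (Unique ls × m ∸ ℓ ≤ length ls × (∀ {z} → z ∈ ls → z ∈ filter (partial? (suc k)) (ΦQ ℓ) × R (ω , qs) z))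
      partners = map f allowed , Uniqueₚ.map⁺ f-inj (Uniqueₚ.filter⁺ allowed? (Uniqueₚ.allFin⁺ m)) ,
        subst (m ∸ ℓ ≤_) (sym (length-map f allowed)) enough ,
        λ z∈ → let (r , r∈ , e) = ∈-map⁻ f z∈ in
          subst (λ z → z ∈ filter (partial? (suc k)) (ΦQ ℓ) × R (ω , qs) z) (sym e)
            (∈-filter⁺ (partial? (suc k)) (∈-cartesianProduct⁺ (swap-∈ ω∈ v i r) qs∈) (target (proj₂ (∈-filter⁻ allowed? {xs = allFin m} r∈))) ,
             refl , q , q′ , rest , r , sp , proj₁ fol , refl)

    -- The transition q → q′ is released by exchanging q′ with another label at its vertex. The
    -- later transitions survive unless that label occurs in `rest`, which rules out at most ℓ
    -- labels.
    step : (m ∸ ℓ) * length (filter (partial? k) (ΦQ ℓ)) ≤ length (filter (partial? (suc k)) (ΦQ ℓ))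
    step = mult-length {R = R} (m ∸ ℓ) (Uniqueₚ.filter⁺ (partial? k) (ΦQ! ℓ))
      (λ {x} x∈ → let (ω∈ , qs∈ , px) = mem x∈ ; (q , q′ , rest , sp , le) = split k (proj₂ x) (allLists-length (positions n m) ℓ qs∈) k+1<ℓ in
        partners ω∈ qs∈ px sp le)
      functional

  partial-chain : ∀ k ℓ → k < ℓ → (m ∸ ℓ) ^ k * length (filter (partial? 0) (ΦQ ℓ)) ≤ length (filter (partial? k) (ΦQ ℓ))
  partial-chain zero    ℓ _   = ≤-reflexive (*-identityˡ _)
  partial-chain (suc k) ℓ k<ℓ = begin
    (m ∸ ℓ) * (m ∸ ℓ) ^ k * X₀           ≡⟨ *-assoc (m ∸ ℓ) ((m ∸ ℓ) ^ k) X₀ ⟩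
    (m ∸ ℓ) * ((m ∸ ℓ) ^ k * X₀)         ≤⟨ *-monoʳ-≤ (m ∸ ℓ) (partial-chain k ℓ (<⇒≤ k<ℓ)) ⟩
    (m ∸ ℓ) * length (filter (partial? k) (ΦQ ℓ)) ≤⟨ Step.step k ℓ k<ℓ ⟩
    length (filter (partial? (suc k)) (ΦQ ℓ)) ∎
    where
    open ≤-Reasoning
    X₀ = length (filter (partial? 0) (ΦQ ℓ))

  firstRet-bound : ∀ k → (m ∸ suc k) ^ k * firstRetTotal (suc k) ≤ length Φ * length (closedTrailSeqs G (suc k))
  firstRet-bound k = ≤-trans (*-monoʳ-≤ ((m ∸ suc k) ^ k) (firstRet-trace k))
    (≤-trans (partial-chain k (suc k) ≤-refl) (partial-end k (suc k)))

-- Closed trails up to rotation and reflection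

zip-++ : ∀ {A B : Set} (as : List A) (bs : List B) {cs ds} → length as ≡ length bs →
  zip (as ++ cs) (bs ++ ds) ≡ zip as bs ++ zip cs ds
zip-++ []       []       _ = refl
zip-++ (a ∷ as) (b ∷ bs) e = cong (_ ∷_) (zip-++ as bs (suc-injective e))

zip-reverse : ∀ {A B : Set} (as : List A) (bs : List B) → length as ≡ length bs →
  zip (reverse as) (reverse bs) ≡ reverse (zip as bs)
zip-reverse []       []       _ = refl
zip-reverse (a ∷ as) (b ∷ bs) e = begin
  zip (reverse (a ∷ as)) (reverse (b ∷ bs))            ≡⟨ cong₂ zip (unfold-reverse a as) (unfold-reverse b bs) ⟩
  zip (reverse as ++ [ a ]) (reverse bs ++ [ b ])      ≡⟨ zip-++ (reverse as) (reverse bs) (trans (length-reverse as) (trans (suc-injective e) (sym (length-reverse bs)))) ⟩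
  zip (reverse as) (reverse bs) ++ [ (a , b) ]         ≡⟨ cong (_++ [ (a , b) ]) (zip-reverse as bs (suc-injective e)) ⟩
  reverse (zip as bs) ++ [ (a , b) ]                   ≡⟨ unfold-reverse (a , b) (zip as bs) ⟨
  reverse ((a , b) ∷ zip as bs)                        ∎
  where open ≡-Reasoning

zip-swap : ∀ {A B : Set} (as : List A) (bs : List B) → zip bs as ≡ map swapₚ (zip as bs)
zip-swap []       []       = refl
zip-swap []       (_ ∷ _)  = refl
zip-swap (_ ∷ _)  []       = refl
zip-swap (a ∷ as) (b ∷ bs) = cong (_ ∷_) (zip-swap as bs)

length-rotate1 : ∀ {A : Set} (w : List A) → length (rotate1 w) ≡ length w
length-rotate1 []       = refl
length-rotate1 (x ∷ xs) = trans (length-++ xs) (+-comm (length xs) 1)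

rotate1-reverse : ∀ {A : Set} (w : List A) → rotate1 (reverse (rotate1 w)) ≡ reverse w
rotate1-reverse []       = refl
rotate1-reverse (x ∷ xs) = trans (cong rotate1 (reverse-++ xs [ x ])) (sym (unfold-reverse x xs))

walkEdges-rotate1 : ∀ {n} (w : List (Fin n)) → walkEdges (rotate1 w) ≡ rotate1 (walkEdges w)
walkEdges-rotate1 []           = refl
walkEdges-rotate1 (x ∷ [])     = refl
walkEdges-rotate1 (x ∷ z ∷ ws) = zip-++ (z ∷ ws) (ws ++ [ x ]) (sym (length-rotate1 (x ∷ ws)))

-- Reversing w itself would list the reversed edges shifted by one place; rotating first makes them
-- come out exactly backwards.
walkEdges-reverse : ∀ {n} (w : List (Fin n)) → walkEdges (reverse (rotate1 w)) ≡ reverse (map swapₚ (walkEdges w))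
walkEdges-reverse w = begin
  zip (reverse (rotate1 w)) (rotate1 (reverse (rotate1 w)))   ≡⟨ cong (zip (reverse (rotate1 w))) (rotate1-reverse w) ⟩
  zip (reverse (rotate1 w)) (reverse w)                       ≡⟨ zip-reverse (rotate1 w) w (length-rotate1 w) ⟩
  reverse (zip (rotate1 w) w)                                 ≡⟨ cong reverse (zip-swap w (rotate1 w)) ⟩
  reverse (map swapₚ (walkEdges w))                           ∎
  where open ≡-Reasoning

Distinct : ∀ {n} → Fin n × Fin n → Fin n × Fin n → Set
Distinct e f = T (not (sameEdge e f))

distinct⁻ : ∀ {n} {a b c d : Fin n} → Distinct (a , b) (c , d) → ¬ (a ≡ c × b ≡ d) × ¬ (a ≡ d × b ≡ c)
distinct⁻ {a = a} {b} {c} {d} t with a ≟ᶠ c | b ≟ᶠ d | a ≟ᶠ d | b ≟ᶠ c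
... | yes _ | yes _ | _     | _     = ⊥-elim t
... | no p  | _     | no q  | _     = (λ (e , _) → p e) , λ (e , _) → q e
... | no p  | _     | yes _ | no q  = (λ (e , _) → p e) , λ (_ , e) → q e
... | yes _ | no p  | no q  | _     = (λ (_ , e) → p e) , λ (e , _) → q e
... | yes _ | no p  | yes _ | no q  = (λ (_ , e) → p e) , λ (_ , e) → q e

distinct-sym : ∀ {n} {e f : Fin n × Fin n} → Distinct e f → Distinct f e
distinct-sym {e = a , b} {c , d} t with distinct⁻ {a = a} {b} {c} {d} t
... | p , q = ¬sameEdge⁺ {a = c} {d} {a} {b} (λ { (refl , refl) → p (refl , refl) }) (λ { (refl , refl) → q (refl , refl) })

distinct-swap : ∀ {n} {e f : Fin n × Fin n} → Distinct e f → Distinct (swapₚ e) (swapₚ f)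
distinct-swap {e = a , b} {c , d} t with distinct⁻ {a = a} {b} {c} {d} t
... | p , q = ¬sameEdge⁺ {a = b} {a} {d} {c} (λ { (refl , refl) → p (refl , refl) }) (λ { (refl , refl) → q (refl , refl) })

all-reverse : ∀ {A : Set} {P : A → Set} {xs} → All P xs → All P (reverse xs)
all-reverse [] = []
all-reverse {P = P} {x ∷ xs} (p ∷ h) = subst (All P) (sym (unfold-reverse x xs)) (Allₚ.++⁺ (all-reverse h) (p ∷ []))

module _ {A : Set} {R : A → A → Set} (R-sym : ∀ {a b} → R a b → R b a) where

  allPairs-snoc : ∀ {x xs} → All (R x) xs → AllPairs R xs → AllPairs R (xs ++ [ x ])
  allPairs-snoc h u = AllPairsₚ.++⁺ u ([] ∷ []) (All.map (λ r → R-sym r ∷ []) h)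

  allPairs-rotate1 : ∀ {xs} → AllPairs R xs → AllPairs R (rotate1 xs)
  allPairs-rotate1 []      = []
  allPairs-rotate1 (h ∷ u) = allPairs-snoc h u

  allPairs-reverse : ∀ {xs} → AllPairs R xs → AllPairs R (reverse xs)
  allPairs-reverse [] = []
  allPairs-reverse {x ∷ xs} (h ∷ u) = subst (AllPairs R) (sym (unfold-reverse x xs))
    (allPairs-snoc (all-reverse h) (allPairs-reverse u))

all-rotate1 : ∀ {A : Set} {P : A → Set} {xs} → All P xs → All P (rotate1 xs)
all-rotate1 []      = []
all-rotate1 (p ∷ h) = Allₚ.++⁺ h (p ∷ [])

module _ {n : ℕ} (G : Graph n) where

  isEdge : Fin n × Fin n → Bool
  isEdge e = adj G (proj₁ e) (proj₂ e)

  ClosedTrail : List (Fin n) → Set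
  ClosedTrail w = All (T ∘ isEdge) (walkEdges w) × AllPairs Distinct (walkEdges w)

  closedTrail⁻ : ∀ {w} → T (isClosedTrail G w) → ClosedTrail w
  closedTrail⁻ {w} t = let (a , b) = Equivalence.to T-∧ t in all⁻ isEdge (walkEdges w) a , pairwiseDistinct⁻ (walkEdges w) b

  closedTrail⁺ : ∀ {w} → ClosedTrail w → T (isClosedTrail G w)
  closedTrail⁺ {w} (a , b) = Equivalence.from T-∧ (all⁺ isEdge {walkEdges w} a , pairwiseDistinct⁺ b)

  closedTrail-rotate1 : ∀ {w} → ClosedTrail w → ClosedTrail (rotate1 w)
  closedTrail-rotate1 {w} (a , b) = subst (All (T ∘ isEdge)) (sym (walkEdges-rotate1 w)) (all-rotate1 a) ,
    subst (AllPairs Distinct) (sym (walkEdges-rotate1 w)) (allPairs-rotate1 (λ {e} {f} → distinct-sym {e = e} {f}) b)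

  closedTrail-reverse : ∀ {w} → ClosedTrail w → ClosedTrail (reverse w)
  closedTrail-reverse {w} (a , b) = subst ClosedTrail (rotate1-reverse w) (closedTrail-rotate1
    (subst (All (T ∘ isEdge)) (sym (walkEdges-reverse w)) (all-reverse (Allₚ.map⁺ (All.map (λ {e} t → subst T (Graph.sym G (proj₁ e) (proj₂ e)) t) a))) ,
     subst (AllPairs Distinct) (sym (walkEdges-reverse w)) (allPairs-reverse (λ {e} {f} → distinct-sym {e = e} {f})
       (AllPairsₚ.map⁺ (AllPairs.map (λ {e} {f} → distinct-swap {e = e} {f}) b)))))

module _ {A : Set} where

  length-iter-rotate1 : ∀ k (w : List A) → length (iter rotate1 k w) ≡ length w
  length-iter-rotate1 zero    w = refl
  length-iter-rotate1 (suc k) w = trans (length-rotate1 (iter rotate1 k w)) (length-iter-rotate1 k w)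

  iter-rotate1 : ∀ (us vs : List A) → iter rotate1 (length us) (us ++ vs) ≡ vs ++ us
  iter-rotate1 []       vs = sym (++-identityʳ vs)
  iter-rotate1 (u ∷ us) vs = begin
    rotate1 (iter rotate1 (length us) (u ∷ us ++ vs))   ≡⟨ iter-shift rotate1 (length us) (u ∷ us ++ vs) ⟨
    iter rotate1 (length us) ((us ++ vs) ++ [ u ])      ≡⟨ cong (iter rotate1 (length us)) (++-assoc us vs [ u ]) ⟩
    iter rotate1 (length us) (us ++ (vs ++ [ u ]))      ≡⟨ iter-rotate1 us (vs ++ [ u ]) ⟩
    (vs ++ [ u ]) ++ us                                 ≡⟨ ++-assoc vs [ u ] us ⟩
    vs ++ u ∷ us                                        ∎
    where open ≡-Reasoning

  rotation-iter : ∀ {k} (w : List A) → k ≤ length w → drop k w ++ take k w ≡ iter rotate1 k w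
  rotation-iter {k} w k≤ = begin
    drop k w ++ take k w                                        ≡⟨ iter-rotate1 (take k w) (drop k w) ⟨
    iter rotate1 (length (take k w)) (take k w ++ drop k w)     ≡⟨ cong₂ (iter rotate1) (trans (length-take k w) (m≤n⇒m⊓n≡m k≤)) (take++drop≡id k w) ⟩
    iter rotate1 k w                                            ∎
    where open ≡-Reasoning

  iter-rotate1-full : ∀ (w : List A) → iter rotate1 (length w) w ≡ w
  iter-rotate1-full w = trans (cong (iter rotate1 (length w)) (sym (++-identityʳ w))) (iter-rotate1 w [])

  iter-rotate1-reduce : ∀ (w : List A) → 1 ≤ length w → ∀ k → ∃[ j ] (j < length w × iter rotate1 j w ≡ iter rotate1 k w)
  iter-rotate1-reduce w 1≤ zero = 0 , 1≤ , refl
  iter-rotate1-reduce w 1≤ (suc k) with iter-rotate1-reduce w 1≤ k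
  ... | j , j< , e with m≤n⇒m<n∨m≡n j<
  ...   | inj₁ 1+j< = suc j , 1+j< , cong rotate1 e
  ...   | inj₂ 1+j≡ = 0 , 1≤ , trans (sym (iter-rotate1-full w)) (trans (cong (λ s → iter rotate1 s w) (sym 1+j≡)) (cong rotate1 e))

  -- Rotation by any k, so that composition is addition; `rotations` lists only k below the length.
  Rot Equiv : List A → List A → Set
  Rot w u = ∃[ k ] (u ≡ iter rotate1 k w)
  Equiv w u = Rot w u ⊎ Rot (reverse w) u

  rot-trans : ∀ {w u z} → Rot w u → Rot u z → Rot w z
  rot-trans {w} (k , refl) (l , refl) = l + k , sym (iter-+ rotate1 l k w)

  rot-sym : ∀ {w u} → 1 ≤ length w → Rot w u → Rot u w
  rot-sym {w} 1≤ (k , refl) with iter-rotate1-reduce w 1≤ k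
  ... | j , j< , e = length w ∸ j , sym (trans (cong (iter rotate1 (length w ∸ j)) (sym e))
    (trans (sym (iter-+ rotate1 (length w ∸ j) j w)) (trans (cong (λ s → iter rotate1 s w) (m∸n+n≡m (<⇒≤ j<))) (iter-rotate1-full w))))

  -- The dihedral relation: reversal turns a rotation into its inverse. It makes `Equiv` symmetric
  -- and transitive.
  iter-rotate1-reverse : ∀ k (w : List A) → iter rotate1 k (reverse (iter rotate1 k w)) ≡ reverse w
  iter-rotate1-reverse zero    w = refl
  iter-rotate1-reverse (suc k) w = begin
    rotate1 (iter rotate1 k (reverse (rotate1 (iter rotate1 k w))))   ≡⟨ iter-shift rotate1 k _ ⟨
    iter rotate1 k (rotate1 (reverse (rotate1 (iter rotate1 k w))))   ≡⟨ cong (iter rotate1 k) (rotate1-reverse (iter rotate1 k w)) ⟩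
    iter rotate1 k (reverse (iter rotate1 k w))                       ≡⟨ iter-rotate1-reverse k w ⟩
    reverse w                                                         ∎
    where open ≡-Reasoning

  rot-length : ∀ {w u : List A} → Rot w u → length u ≡ length w
  rot-length {w} (k , refl) = length-iter-rotate1 k w

  rot-reverse : ∀ {w u} → 1 ≤ length w → Rot w u → Rot (reverse w) (reverse u)
  rot-reverse {w} {u} 1≤ r@(k , refl) = rot-sym (subst (1 ≤_) (sym (trans (length-reverse u) (rot-length {w} r))) 1≤) (k , sym (iter-rotate1-reverse k w))

  equiv-length : ∀ {w u} → Equiv w u → length u ≡ length w
  equiv-length {w} (inj₁ r) = rot-length {w} r
  equiv-length {w} (inj₂ r) = trans (rot-length {reverse w} r) (length-reverse w)

  equiv-trans : ∀ {w u z} → 1 ≤ length w → Equiv w u → Equiv u z → Equiv w z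
  equiv-trans 1≤ (inj₁ r) (inj₁ s) = inj₁ (rot-trans r s)
  equiv-trans 1≤ (inj₁ r) (inj₂ s) = inj₂ (rot-trans (rot-reverse 1≤ r) s)
  equiv-trans 1≤ (inj₂ r) (inj₁ s) = inj₂ (rot-trans r s)
  equiv-trans {w} {u} 1≤ (inj₂ r) (inj₂ s) = inj₁ (rot-trans (subst (λ z → Rot z (reverse u)) (reverse-involutive w)
    (rot-reverse (subst (1 ≤_) (sym (length-reverse w)) 1≤) r)) s)

  equiv-sym : ∀ {w u} → 1 ≤ length w → Equiv w u → Equiv u w
  equiv-sym 1≤ (inj₁ r) = inj₁ (rot-sym 1≤ r)
  equiv-sym {w} {u} 1≤ (inj₂ (k , refl)) = inj₂ (k , sym (trans (iter-rotate1-reverse k (reverse w)) (reverse-involutive w)))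

  ∈-rotations⁻ : ∀ {w u} → u ∈ rotations w → Rot w u
  ∈-rotations⁻ {w} u∈ with ∈-map⁻ (λ k → drop k w ++ take k w) u∈
  ... | k , k∈ , refl = k , rotation-iter w (<⇒≤ (∈-upTo⁻ k∈))

  ∈-rotations⁺ : ∀ {w u} → 1 ≤ length w → Rot w u → u ∈ rotations w
  ∈-rotations⁺ {w} 1≤ (k , refl) with iter-rotate1-reduce w 1≤ k
  ... | j , j< , e = subst (_∈ rotations w) (trans (rotation-iter w (<⇒≤ j<)) e) (∈-map⁺ (λ k → drop k w ++ take k w) (∈-upTo⁺ j<))

  ∈-equivalentSeqs⁻ : ∀ {w u} → u ∈ equivalentSeqs w → Equiv w u
  ∈-equivalentSeqs⁻ {w} u∈ with ∈-++⁻ (rotations w) u∈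
  ... | inj₁ h = inj₁ (∈-rotations⁻ h)
  ... | inj₂ h = inj₂ (∈-rotations⁻ h)

  ∈-equivalentSeqs⁺ : ∀ {w u} → 1 ≤ length w → Equiv w u → u ∈ equivalentSeqs w
  ∈-equivalentSeqs⁺ 1≤ (inj₁ r) = ∈-++⁺ˡ (∈-rotations⁺ 1≤ r)
  ∈-equivalentSeqs⁺ {w} 1≤ (inj₂ r) = ∈-++⁺ʳ (rotations w) (∈-rotations⁺ (subst (1 ≤_) (sym (length-reverse w)) 1≤) r)

  length-equivalentSeqs : ∀ (w : List A) → length (equivalentSeqs w) ≡ 2 * length w
  length-equivalentSeqs w = trans (length-++ (rotations w)) (cong₂ _+_ (len w)
    (trans (len (reverse w)) (trans (length-reverse w) (sym (+-identityʳ (length w))))))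
    where
    len : ∀ (w : List A) → length (rotations w) ≡ length w
    len w = trans (length-map _ (upTo (length w))) (length-upTo (length w))

-- Lexicographically least representatives

≤lex-total : ∀ {n} (xs ys : List (Fin n)) → T (xs ≤lex ys) ⊎ T (ys ≤lex xs)
≤lex-total []       _        = inj₁ tt
≤lex-total (_ ∷ _)  []       = inj₂ tt
≤lex-total (x ∷ xs) (z ∷ zs) with x ≟ᶠ z | z ≟ᶠ x
... | yes _   | yes _   = ≤lex-total xs zs
... | yes x≡z | no z≢x  = contradiction (sym x≡z) z≢x
... | no x≢z  | yes z≡x = contradiction (sym z≡x) x≢z
... | no x≢z  | no _ with <-cmp (toℕ x) (toℕ z)
...   | tri< lt _ _ = inj₁ (fromWitness lt)
...   | tri≈ _ e _  = contradiction (toℕ-injective e) x≢z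
...   | tri> _ _ gt = inj₂ (fromWitness gt)

≤lex-trans : ∀ {n} (xs ys zs : List (Fin n)) → T (xs ≤lex ys) → T (ys ≤lex zs) → T (xs ≤lex zs)
≤lex-trans []       _        _        _ _ = tt
≤lex-trans (_ ∷ _)  []       _        ()
≤lex-trans (_ ∷ _)  (_ ∷ _)  []       _ ()
≤lex-trans (x ∷ xs) (y ∷ ys) (z ∷ zs) p q with x ≟ᶠ y | y ≟ᶠ z | x ≟ᶠ z
... | yes refl | yes refl | yes _    = ≤lex-trans xs ys zs p q
... | yes refl | yes refl | no ne    = contradiction refl ne
... | yes refl | no ne    | yes refl = contradiction refl ne
... | yes refl | no _     | no _     = q
... | no ne    | yes refl | yes refl = contradiction refl ne
... | no _     | yes refl | no _     = p
... | no _     | no _     | yes refl = contradiction (<-trans (toWitness p) (toWitness q)) (<-irrefl refl)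
... | no _     | no _     | no _     = fromWitness (<-trans (toWitness p) (toWitness q))

≤lex-minimum : ∀ {n} (z : List (Fin n)) zs → ∃[ w ] (w ∈ z ∷ zs × (∀ {u} → u ∈ z ∷ zs → T (w ≤lex u)))
≤lex-minimum z [] = z , here refl , λ { (here refl) → case ≤lex-total z z of λ { (inj₁ p) → p ; (inj₂ p) → p } }
≤lex-minimum z (z′ ∷ zs) with ≤lex-minimum z′ zs
... | w , w∈ , min with ≤lex-total z w | ≤lex-total z z
...   | inj₁ z≤w | zz = z , here refl , λ where
        (here refl) → case zz of λ { (inj₁ p) → p ; (inj₂ p) → p }
        (there {xs = _} u∈) → ≤lex-trans z w _ z≤w (min u∈)
...   | inj₂ w≤z | _ = w , there w∈ , λ { (here refl) → w≤z ; (there u∈) → min u∈ }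

-- The least member of an equivalence class is canonical, and its class is contained in the 2 ℓ
-- entries of `equivalentSeqs`.
closedTrailSeqs-bound : ∀ {n} (G : Graph n) ℓ → 1 ≤ ℓ → length (closedTrailSeqs G ℓ) ≤ closedTrails ℓ G * (2 * ℓ)
closedTrailSeqs-bound {n} G ℓ 1≤ℓ = subst (length (closedTrailSeqs G ℓ) ≤_) (length-concatMap equivalentSeqs Canon canon-length)
  (⊆-length (Uniqueₚ.filter⁺ (T? ∘ isClosedTrail G) (allLists! (Uniqueₚ.allFin⁺ n) ℓ)) covered)
  where
  isCanonicalTrail : List (Fin n) → Bool
  isCanonicalTrail w = isClosedTrail G w ∧ isCanonical w
  Canon = filterᵇ isCanonicalTrail (allLists (allFin n) ℓ)
  canon-length : ∀ {w} → w ∈ Canon → length (equivalentSeqs w) ≡ 2 * ℓ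
  canon-length {w} w∈ = trans (length-equivalentSeqs w) (cong (2 *_)
    (allLists-length (allFin n) ℓ (proj₁ (∈-filter⁻ (T? ∘ isCanonicalTrail) {xs = allLists (allFin n) ℓ} w∈))))
  equiv-closedTrail : ∀ {w u} → ClosedTrail G w → Equiv w u → ClosedTrail G u
  equiv-closedTrail {w} c e = case e of λ where
      (inj₁ (k , refl)) → go k c
      (inj₂ (k , refl)) → go k (closedTrail-reverse G {w} c)
    where
    go : ∀ k {w} → ClosedTrail G w → ClosedTrail G (iter rotate1 k w)
    go zero    c = c
    go (suc k) {w} c = closedTrail-rotate1 G {iter rotate1 k w} (go k {w} c)
  covered : ∀ {w} → w ∈ closedTrailSeqs G ℓ → w ∈ concatMap equivalentSeqs Canon
  covered {w} w∈ = ∈-concat⁺′ (∈-equivalentSeqs⁺ 1≤w₀ (equiv-sym 1≤w e₀)) (∈-map⁺ equivalentSeqs w₀∈)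
    where
    mem = ∈-filter⁻ (T? ∘ isClosedTrail G) {xs = allLists (allFin n) ℓ} w∈
    len : length w ≡ ℓ
    len = allLists-length (allFin n) ℓ (proj₁ mem)
    1≤w : 1 ≤ length w
    1≤w = subst (1 ≤_) (sym len) 1≤ℓ
    minimum : ∃[ u ] (u ∈ equivalentSeqs w × (∀ {z} → z ∈ equivalentSeqs w → T (u ≤lex z)))
    minimum with equivalentSeqs w | length-equivalentSeqs w
    ... | []     | e = contradiction (≤-trans 1≤w (≤-trans (m≤m+n (length w) _) (≤-reflexive (sym e)))) λ ()
    ... | z ∷ zs | _ = ≤lex-minimum z zs
    w₀ = proj₁ minimum
    e₀ : Equiv w w₀
    e₀ = ∈-equivalentSeqs⁻ (proj₁ (proj₂ minimum))
    1≤w₀ : 1 ≤ length w₀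
    1≤w₀ = subst (1 ≤_) (sym (equiv-length e₀)) 1≤w
    canonical : T (isCanonical w₀)
    canonical = all⁺ (w₀ ≤lex_) (All.tabulate λ z∈ → proj₂ (proj₂ minimum)
      (∈-equivalentSeqs⁺ 1≤w (equiv-trans 1≤w e₀ (∈-equivalentSeqs⁻ z∈))))
    w₀∈ : w₀ ∈ Canon
    w₀∈ = ∈-filter⁺ (T? ∘ isCanonicalTrail)
      (subst (λ s → w₀ ∈ allLists (allFin n) s) (trans (equiv-length e₀) len) (∈-allLists ∈-allFin w₀))
      (Equivalence.from T-∧ (closedTrail⁺ G {w₀} (equiv-closedTrail (closedTrail⁻ G {w} (proj₂ mem)) e₀) , canonical))

-- Arrangements and enumerations

∈-concatMap⁻′ : ∀ {A B : Set} (f : A → List B) xs {z} → z ∈ concatMap f xs → ∃[ x ] (x ∈ xs × z ∈ f x)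
∈-concatMap⁻′ f xs z∈ with ∈-concat⁻′ (map f xs) z∈
... | zs , z∈zs , zs∈ with ∈-map⁻ f zs∈
...   | x , x∈ , refl = x , x∈ , z∈zs

∈-concatMap⁺′ : ∀ {A B : Set} (f : A → List B) {xs x z} → x ∈ xs → z ∈ f x → z ∈ concatMap f xs
∈-concatMap⁺′ f x∈ z∈ = ∈-concat⁺′ z∈ (∈-map⁺ f x∈)

-- Distinctness of the indices is an arbitrary relation R, because orientations are functions and
-- are told apart only pointwise.
concatMap! : ∀ {A B : Set} {R : A → A → Set} (f : A → List B) {xs} → AllPairs R xs → (∀ {x} → x ∈ xs → Unique (f x)) →
  (∀ {x x′ z} → x ∈ xs → x′ ∈ xs → z ∈ f x → z ∈ f x′ → ¬ R x x′) → Unique (concatMap f xs)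
concatMap! f {[]} _ _ _ = []
concatMap! {R = R} f {x ∷ xs} (h ∷ u) uf dis = Uniqueₚ.++⁺ (uf (here refl)) (concatMap! f u (λ x∈ → uf (there x∈)) (λ x∈ x′∈ → dis (there x∈) (there x′∈)))
  λ (z∈ , z∈′) → let (x′ , x′∈ , z∈″) = ∈-concatMap⁻′ f xs z∈′ in dis (here refl) (there x′∈) z∈ z∈″ (All.lookup h x′∈)

vec-ext : ∀ {A : Set} {k} {xs ys : Vec A k} → (∀ i → lookup xs i ≡ lookup ys i) → xs ≡ ys
vec-ext {xs = xs} {ys} h = trans (sym (tabulate∘lookup xs)) (trans (tabulate-cong h) (tabulate∘lookup ys))

remove : ∀ {n} → Fin n → List (Fin n) → List (Fin n)
remove x = filter (λ z → ¬? (z ≟ᶠ x))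

length-remove : ∀ {n} {x : Fin n} {xs} → Unique xs → x ∈ xs → suc (length (remove x xs)) ≡ length xs
length-remove {x = x} {z ∷ zs} (z∉ ∷ u) x∈ with z ≟ᶠ x
length-remove {x = x} {z ∷ zs} (z∉ ∷ u) x∈ | yes refl = cong (suc ∘ length) (filter-all (λ z → ¬? (z ≟ᶠ x)) (All.map (λ h e → h (sym e)) z∉))
length-remove {x = x} {z ∷ zs} (z∉ ∷ u) (here x≡z)  | no z≢x = contradiction (sym x≡z) z≢x
length-remove {x = x} {z ∷ zs} (z∉ ∷ u) (there x∈)  | no z≢x = cong suc (length-remove u x∈)

arrangements : ∀ {n} k → List (Fin n) → List (Vec (Fin n) k)
arrangements zero    N = [ [] ]
arrangements (suc k) N = concatMap (λ x → map (x ∷_) (arrangements k (remove x N))) N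

length-arrangements : ∀ {n} k {N : List (Fin n)} → Unique N → length N ≡ k → length (arrangements k N) ≡ k !
length-arrangements zero    _ _ = refl
length-arrangements (suc k) {N} u e = trans (length-concatMap _ N λ {x} x∈ → trans (length-map (x ∷_) (arrangements k (remove x N)))
  (length-arrangements k (Uniqueₚ.filter⁺ _ u) (suc-injective (trans (length-remove u x∈) e)))) (cong (_* k !) e)

arrangements! : ∀ {n} k {N : List (Fin n)} → Unique N → Unique (arrangements k N)
arrangements! zero    _ = [] ∷ []
arrangements! (suc k) {N} u = concatMap! _ u (λ {x} _ → Uniqueₚ.map⁺ (λ { refl → refl }) (arrangements! k (Uniqueₚ.filter⁺ _ u)))
  λ {x} {x′} _ _ z∈ z∈′ → case ∈-map⁻ (x ∷_) z∈ of λ { (_ , _ , refl) → case ∈-map⁻ (x′ ∷_) z∈′ of λ { (_ , _ , refl) x≢x → x≢x refl } }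

∈-arrangements⁺ : ∀ {n k} {N : List (Fin n)} (xs : Vec (Fin n) k) → (∀ i → lookup xs i ∈ N) →
  (∀ {i j} → lookup xs i ≡ lookup xs j → i ≡ j) → xs ∈ arrangements k N
∈-arrangements⁺ [] _ _ = here refl
∈-arrangements⁺ {k = suc k} {N} (x ∷ xs) mem inj = ∈-concatMap⁺′ _ (mem zero) (∈-map⁺ (x ∷_) (∈-arrangements⁺ xs
  (λ i → ∈-filter⁺ _ (mem (suc i)) (λ e → case inj {suc i} {zero} e of λ ()))
  (λ e → Fin-suc-injective (inj e))))

∈-arrangements⁻ : ∀ {n} k {N : List (Fin n)} {xs : Vec (Fin n) k} → xs ∈ arrangements k N →
  (∀ i → lookup xs i ∈ N) × (∀ {i j} → lookup xs i ≡ lookup xs j → i ≡ j)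
∈-arrangements⁻ zero {xs = []} _ = (λ ()) , λ { {()} }
∈-arrangements⁻ (suc k) {N} xs∈ with ∈-concatMap⁻′ (λ x → map (x ∷_) (arrangements k (remove x N))) N xs∈
... | x , x∈ , h with ∈-map⁻ (x ∷_) h
...   | ys , ys∈ , refl with ∈-arrangements⁻ k {remove x N} ys∈
...     | mem , inj = mem′ , inj′
  where
  un : ∀ i → lookup ys i ∈ N × lookup ys i ≢ x
  un i = ∈-filter⁻ (λ z → ¬? (z ≟ᶠ x)) {xs = N} (mem i)
  mem′ : ∀ i → lookup (x ∷ ys) i ∈ N
  mem′ zero    = x∈
  mem′ (suc i) = proj₁ (un i)
  inj′ : ∀ {i j} → lookup (x ∷ ys) i ≡ lookup (x ∷ ys) j → i ≡ j
  inj′ {zero}  {zero}  _ = refl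
  inj′ {zero}  {suc j} e = contradiction (sym e) (proj₂ (un j))
  inj′ {suc i} {zero}  e = contradiction e (proj₂ (un i))
  inj′ {suc i} {suc j} e = cong suc (inj e)

-- Pigeonhole: a missed element could be added to the k distinct entries.
arrangement-onto : ∀ {n k} {N : List (Fin n)} (xs : Vec (Fin n) k) → length N ≤ k → (∀ i → lookup xs i ∈ N) →
  (∀ {i j} → lookup xs i ≡ lookup xs j → i ≡ j) → ∀ {z} → z ∈ N → ∃[ i ] (lookup xs i ≡ z)
arrangement-onto {k = k} {N} xs N≤ mem inj {z} z∈ with any? (λ i → lookup xs i ≟ᶠ z)
... | yes found = found
... | no ¬found = contradiction (≤-trans longer N≤) 1+n≰n
  where
  longer : suc k ≤ length N
  longer = subst (λ s → suc s ≤ length N) (trans (length-map (lookup xs) (allFin k)) (length-allFin k))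
    (⊆-length (All.tabulate (λ w∈ e → case ∈-map⁻ (lookup xs) w∈ of λ { (i , _ , e′) → ¬found (i , trans (sym e′) (sym e)) })
        ∷ Uniqueₚ.map⁺ inj (Uniqueₚ.allFin⁺ k))
      λ { (here refl) → z∈ ; (there w∈) → case ∈-map⁻ (lookup xs) w∈ of λ { (i , _ , refl) → mem i } })

prodVec : ∀ {A : Set} n → (Fin n → List A) → List (Vec A n)
prodVec zero    f = [ [] ]
prodVec (suc n) f = cartesianProductWith _∷_ (f zero) (prodVec n (f ∘ suc))

length-prodVec : ∀ {A : Set} n {f : Fin n → List A} {t} → (∀ v → length (f v) ≡ t) → length (prodVec n f) ≡ t ^ n
length-prodVec zero    h = refl
length-prodVec (suc n) {f} h = trans (length-product _∷_ (f zero) (prodVec n (f ∘ suc))) (cong₂ _*_ (h zero) (length-prodVec n (h ∘ suc)))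

prodVec! : ∀ {A : Set} n {f : Fin n → List A} → (∀ v → Unique (f v)) → Unique (prodVec n f)
prodVec! zero    u = [] ∷ []
prodVec! (suc n) u = Uniqueₚ.cartesianProductWith⁺ _∷_ (λ { refl → refl , refl }) (u zero) (prodVec! n (u ∘ suc))

∈-prodVec⁺ : ∀ {A : Set} {n} {f : Fin n → List A} (xs : Vec A n) → (∀ v → lookup xs v ∈ f v) → xs ∈ prodVec n f
∈-prodVec⁺ []       h = here refl
∈-prodVec⁺ (x ∷ xs) h = ∈-cartesianProductWith⁺ _∷_ (h zero) (∈-prodVec⁺ xs (h ∘ suc))

∈-prodVec⁻ : ∀ {A : Set} n {f : Fin n → List A} {xs} → xs ∈ prodVec n f → ∀ v → lookup xs v ∈ f v
∈-prodVec⁻ (suc n) {f} xs∈ v with ∈-cartesianProductWith⁻ _∷_ (f zero) (prodVec n (f ∘ suc)) xs∈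
∈-prodVec⁻ (suc n) xs∈ zero    | _ , _ , x∈ , _ , refl = x∈
∈-prodVec⁻ (suc n) xs∈ (suc v) | _ , _ , _ , ys∈ , refl = ∈-prodVec⁻ n ys∈ v

module _ {A : Set} {_≈_ : A → A → Set} {xs : List A} where

  -- The relation on values is a parameter so that the lemma applies twice, first with equality and
  -- then with pointwise agreement, to functions of two arguments.
  allFuns-distinct : AllPairs (λ a b → ¬ (a ≈ b)) xs → ∀ k → AllPairs (λ f g → ¬ (∀ i → f i ≈ g i)) (allFuns xs k)
  allFuns-distinct u zero    = [] ∷ []
  allFuns-distinct u (suc k) = go u
    where
    tails : ∀ {zs a} → AllPairs (λ f g → ¬ (∀ i → f i ≈ g i)) zs → AllPairs (λ f g → ¬ (∀ i → f i ≈ g i)) (map (consF a) zs)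
    tails p = AllPairsₚ.map⁺ (AllPairs.map (λ ¬e e → ¬e (λ i → e (suc i))) p)
    go : ∀ {ys} → AllPairs (λ a b → ¬ (a ≈ b)) ys → AllPairs (λ f g → ¬ (∀ i → f i ≈ g i)) (concatMap (λ a → map (consF a) (allFuns xs k)) ys)
    go [] = []
    go {a ∷ ys} (h ∷ t) = AllPairsₚ.++⁺ (tails (allFuns-distinct u k)) (go t)
      (All.tabulate λ f∈ → All.tabulate λ g∈ e → case ∈-map⁻ (consF a) f∈ of λ { (_ , _ , refl) →
        case ∈-concatMap⁻′ (λ a → map (consF a) (allFuns xs k)) ys g∈ of λ { (b , b∈ , g∈′) →
        case ∈-map⁻ (consF b) g∈′ of λ { (_ , _ , refl) → All.lookup h b∈ (e zero) } } })

  ∈-allFuns : ∀ k (f : Fin k → A) → (∀ i → ∃[ a ] (a ∈ xs × a ≈ f i)) → ∃[ g ] (g ∈ allFuns xs k × (∀ i → g i ≈ f i))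
  ∈-allFuns zero    f h = (λ ()) , here refl , λ ()
  ∈-allFuns (suc k) f h with h zero | ∈-allFuns k (f ∘ suc) (h ∘ suc)
  ... | a , a∈ , e | g , g∈ , e′ = consF a g , ∈-concatMap⁺′ (λ a → map (consF a) (allFuns xs k)) a∈ (∈-map⁺ (consF a) g∈) ,
    λ { zero → e ; (suc i) → e′ i }

bools : List Bool
bools = true ∷ false ∷ []

∈-bools : ∀ b → b ∈ bools
∈-bools true  = here refl
∈-bools false = there (here refl)

bools! : Unique bools
bools! = ((λ ()) ∷ []) ∷ ([] ∷ [])

count-split : ∀ {A : Set} (p q r : A → Bool) xs →
  (∀ x → (T (p x) → T (q x) ⊎ T (r x)) × (T (q x) → T (p x)) × (T (r x) → T (p x)) × (T (q x) → ¬ T (r x))) →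
  length (filterᵇ p xs) ≡ length (filterᵇ q xs) + length (filterᵇ r xs)
count-split p q r [] h = refl
count-split p q r (x ∷ xs) h with count-split p q r xs h | p x | q x | r x | h x
... | ih | true  | true  | true  | _ , _ , _ , d = contradiction tt (d tt)
... | ih | true  | true  | false | _ = cong suc ih
... | ih | true  | false | true  | _ = trans (cong suc ih) (sym (+-suc _ _))
... | ih | true  | false | false | a , _ = case a tt of λ { (inj₁ ()) ; (inj₂ ()) }
... | ih | false | true  | _     | _ , b , _ = ⊥-elim (b tt)
... | ih | false | false | true  | _ , _ , c , _ = ⊥-elim (c tt)
... | ih | false | false | false | _ = ih

-- Eulerian orientations as propositions

module EulerianOrientations {n : ℕ} (G : Graph n) where

  record IsEO (o : Fin n → Fin n → Bool) : Set where
    field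
      edge      : ∀ {u v} → T (o u v) → T (adj G u v)
      total     : ∀ {u v} → T (adj G u v) → T (o u v) ⊎ T (o v u)
      antisym   : ∀ {u v} → T (o u v) → ¬ T (o v u)
      balanced  : ∀ v → outDeg o v ≡ inDeg o v

  eulerian⁻ : ∀ {o} → T (isEulerianOrientation G o) → IsEO o
  eulerian⁻ {o} t = record
    { edge = λ {u} {v} → edge′ u v ; total = λ {u} {v} → total′ u v ; antisym = λ {u} {v} → antisym′ u v
    ; balanced = λ v → toWitness (All.lookup (all⁻ _ (allFin n) (proj₂ (Equivalence.to T-∧ t))) (∈-allFin v)) }
    where
    oriented = proj₁ (Equivalence.to T-∧ t)
    edge′ : ∀ u v → T (o u v) → T (adj G u v)
    edge′ u v with adj G u v | o u v | o v u | All.lookup (all⁻ _ (allFin n) (All.lookup (all⁻ _ (allFin n) oriented) (∈-allFin u))) (∈-allFin v)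
    ... | true  | _     | _ | _ = λ _ → tt
    ... | false | false | _ | _ = λ ()
    total′ : ∀ u v → T (adj G u v) → T (o u v) ⊎ T (o v u)
    total′ u v with adj G u v | o u v | o v u | All.lookup (all⁻ _ (allFin n) (All.lookup (all⁻ _ (allFin n) oriented) (∈-allFin u))) (∈-allFin v)
    ... | true  | true  | _     | _ = λ _ → inj₁ tt
    ... | true  | false | true  | _ = λ _ → inj₂ tt
    ... | false | _     | _     | _ = λ ()
    antisym′ : ∀ u v → T (o u v) → ¬ T (o v u)
    antisym′ u v with adj G u v | o u v | o v u | All.lookup (all⁻ _ (allFin n) (All.lookup (all⁻ _ (allFin n) oriented) (∈-allFin u))) (∈-allFin v)
    ... | true  | true  | false | _ = λ _ ()
    ... | true  | false | _     | _ = λ ()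
    ... | false | false | _     | _ = λ ()

  -- The local condition tested by isOrientation, whose body refers to a name private to Defs.
  orientedAt : ∀ o → Σ (Fin n → Fin n → Bool) λ p → all (λ u → all (p u) (allFin n)) (allFin n) ≡ isOrientation G o
  orientedAt o = _ , refl

  eulerian⁺ : ∀ {o} → IsEO o → T (isEulerianOrientation G o)
  eulerian⁺ {o} eo = Equivalence.from (T-∧ {isOrientation G o} {all (λ v → outDeg o v ==ℕ inDeg o v) (allFin n)})
    ( subst T (proj₂ (orientedAt o)) (all⁺ (λ u → all (proj₁ (orientedAt o) u) (allFin n)) {allFin n} (All.tabulate λ {u} _ →
        all⁺ (proj₁ (orientedAt o) u) {allFin n} (All.tabulate λ {v} _ → local u v)))
    , all⁺ (λ v → outDeg o v ==ℕ inDeg o v) {allFin n} (All.tabulate λ {v} _ → fromWitness (IsEO.balanced eo v)))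
    where
    local : ∀ u v → T (proj₁ (orientedAt o) u v)
    local u v with adj G u v | o u v | o v u | IsEO.edge eo {u} {v} | IsEO.total eo {u} {v} | IsEO.antisym eo {u} {v}
    ... | true  | true  | true  | _ | _ | h = ⊥-elim (h tt tt)
    ... | true  | true  | false | _ | _ | _ = tt
    ... | true  | false | true  | _ | _ | _ = tt
    ... | true  | false | false | _ | h | _ = case h tt of λ { (inj₁ ()) ; (inj₂ ()) }
    ... | false | true  | _     | h | _ | _ = ⊥-elim (h tt)
    ... | false | false | _     | _ | _ | _ = tt

-- Labellings

exchangeAt-fst : ∀ {n m} (v : Fin n) (i j : Fin m) q → proj₁ (exchangeAt v i j q) ≡ proj₁ q
exchangeAt-fst v i j (u , k) with u ≟ᶠ v
... | yes _ = refl
... | no _  = refl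

exchangeAt-involutive : ∀ {n m} (v : Fin n) (i j : Fin m) q → exchangeAt v i j (exchangeAt v i j q) ≡ q
exchangeAt-involutive v i j (u , k) with u ≟ᶠ v in eq
... | yes _ rewrite eq = cong (u ,_) (exchange-involutive i j k)
... | no _  rewrite eq = refl

module Labellings {n : ℕ} (G : Graph n) (m : ℕ) where
  open EulerianOrientations G

  -- The i-th pair at v stands for a circuit running X (v , i) → v → Y (v , i).
  Labelling : Set
  Labelling = Vec (Vec (Fin n) m × Vec (Fin n) m) n

  X Y : Labelling → Fin n × Fin m → Fin n
  X λs (v , i) = lookup (proj₁ (lookup λs v)) i
  Y λs (v , i) = lookup (proj₂ (lookup λs v)) i

  mk : (Fin n × Fin m → Fin n) → (Fin n × Fin m → Fin n) → Labelling
  mk f g = tabulate λ v → tabulate (λ i → f (v , i)) , tabulate (λ i → g (v , i))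

  X-mk : ∀ f g p → X (mk f g) p ≡ f p
  X-mk f g (v , i) = trans (cong (λ z → lookup (proj₁ z) i) (lookup∘tabulate _ v)) (lookup∘tabulate _ i)

  Y-mk : ∀ f g p → Y (mk f g) p ≡ g p
  Y-mk f g (v , i) = trans (cong (λ z → lookup (proj₂ z) i) (lookup∘tabulate _ v)) (lookup∘tabulate _ i)

  -- The reason for storing labellings as vectors: entrywise agreement is equality, as the
  -- involution laws and the counting require.
  labelling-ext : ∀ {λs μs} → (∀ p → X λs p ≡ X μs p) → (∀ p → Y λs p ≡ Y μs p) → λs ≡ μs
  labelling-ext hX hY = vec-ext λ v → cong₂ _,_ (vec-ext λ i → hX (v , i)) (vec-ext λ i → hY (v , i))

  ins outs : (Fin n → Fin n → Bool) → Fin n → List (Fin n)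
  ins o v = filterᵇ (λ u → o u v) (allFin n)
  outs o v = filterᵇ (λ u → o v u) (allFin n)

  choices : (Fin n → Fin n → Bool) → List Labelling
  choices o = prodVec n λ v → cartesianProduct (arrangements m (ins o v)) (arrangements m (outs o v))

  record Consistent (o : Fin n → Fin n → Bool) (λs : Labelling) : Set where
    field
      X-inj : ∀ {v i j} → X λs (v , i) ≡ X λs (v , j) → i ≡ j
      Y-inj : ∀ {v i j} → Y λs (v , i) ≡ Y λs (v , j) → i ≡ j
      X-in  : ∀ p → T (o (X λs p) (proj₁ p))
      Y-out : ∀ p → T (o (proj₁ p) (Y λs p))

  ∈-filterᵇ⁻ : (p : Fin n → Bool) → ∀ {u} → u ∈ filterᵇ p (allFin n) → T (p u)
  ∈-filterᵇ⁻ p u∈ = proj₂ (∈-filter⁻ (T? ∘ p) {xs = allFin n} u∈)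

  ∈-filterᵇ⁺ : (p : Fin n → Bool) → ∀ {u} → T (p u) → u ∈ filterᵇ p (allFin n)
  ∈-filterᵇ⁺ p {u} t = ∈-filter⁺ (T? ∘ p) (∈-allFin u) t

  filterᵇ! : (p : Fin n → Bool) → Unique (filterᵇ p (allFin n))
  filterᵇ! p = Uniqueₚ.filter⁺ (T? ∘ p) (Uniqueₚ.allFin⁺ n)

  ∈-choices⁺ : ∀ {o λs} → Consistent o λs → λs ∈ choices o
  ∈-choices⁺ {o} {λs} c = ∈-prodVec⁺ λs λ v → ∈-cartesianProduct⁺
    (∈-arrangements⁺ (proj₁ (lookup λs v)) (λ i → ∈-filterᵇ⁺ (λ u → o u v) (X-in (v , i))) X-inj)
    (∈-arrangements⁺ (proj₂ (lookup λs v)) (λ i → ∈-filterᵇ⁺ (o v) (Y-out (v , i))) Y-inj)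
    where open Consistent c

  ∈-choices⁻ : ∀ {o λs} → λs ∈ choices o → Consistent o λs
  ∈-choices⁻ {o} {λs} λ∈ = record
    { X-inj = λ {v} → proj₂ (∈-arrangements⁻ m (proj₁ (local v)))
    ; Y-inj = λ {v} → proj₂ (∈-arrangements⁻ m (proj₂ (local v)))
    ; X-in  = λ { (v , i) → ∈-filterᵇ⁻ (λ u → o u v) (proj₁ (∈-arrangements⁻ m (proj₁ (local v))) i) }
    ; Y-out = λ { (v , i) → ∈-filterᵇ⁻ (o v) (proj₁ (∈-arrangements⁻ m (proj₂ (local v))) i) } }
    where
    local : ∀ v → proj₁ (lookup λs v) ∈ arrangements m (ins o v) × proj₂ (lookup λs v) ∈ arrangements m (outs o v)
    local v = ∈-cartesianProduct⁻ (arrangements m (ins o v)) (arrangements m (outs o v)) (∈-prodVec⁻ n λ∈ v)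

  EOs : List (Fin n → Fin n → Bool)
  EOs = filterᵇ (isEulerianOrientation G) (allFuns (allFuns bools n) n)

  EOs-distinct : AllPairs (λ o o′ → ¬ (∀ u v → o u v ≡ o′ u v)) EOs
  EOs-distinct = AllPairsₚ.filter⁺ (T? ∘ isEulerianOrientation G)
    (allFuns-distinct (allFuns-distinct {_≈_ = _≡_} bools! n) n)

  ∈-EOs⁻ : ∀ {o} → o ∈ EOs → IsEO o
  ∈-EOs⁻ o∈ = eulerian⁻ (proj₂ (∈-filter⁻ (T? ∘ isEulerianOrientation G) {xs = allFuns (allFuns bools n) n} o∈))

  ∈-EOs⁺ : ∀ {o} → IsEO o → ∃[ o′ ] (o′ ∈ EOs × (∀ u v → o′ u v ≡ o u v))
  ∈-EOs⁺ {o} eo with ∈-allFuns {_≈_ = λ f g → ∀ v → f v ≡ g v} n o (λ u → ∈-allFuns {_≈_ = _≡_} n (o u) (λ v → o u v , ∈-bools (o u v) , refl))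
  ... | o′ , o′∈ , e = o′ , ∈-filter⁺ (T? ∘ isEulerianOrientation G) o′∈ (eulerian⁺ eo′) , e
    where
    to : ∀ {u v} → T (o u v) → T (o′ u v)
    to {u} {v} = subst T (sym (e u v))
    from : ∀ {u v} → T (o′ u v) → T (o u v)
    from {u} {v} = subst T (e u v)
    eo′ : IsEO o′
    eo′ = record
      { edge = λ t → IsEO.edge eo (from t)
      ; total = λ t → case IsEO.total eo t of λ { (inj₁ h) → inj₁ (to h) ; (inj₂ h) → inj₂ (to h) }
      ; antisym = λ t t′ → IsEO.antisym eo (from t) (from t′)
      ; balanced = λ v → trans (cong length (filter-≐ (T? ∘ o′ v) (T? ∘ o v) (from , to) (allFin n)))
          (trans (IsEO.balanced eo v) (cong length (filter-≐ (λ u → T? (o u v)) (λ u → T? (o′ u v)) (to , from) (allFin n)))) }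

  Ω : List Labelling
  Ω = concatMap choices EOs

  module _ (reg : IsRegular (m + m) G) where

    module _ {o : Fin n → Fin n → Bool} (eo : IsEO o) where

      degree-split : ∀ v → length (ins o v) ≡ m × length (outs o v) ≡ m
      degree-split v = inm , trans (IsEO.balanced eo v) inm
        where
        total : m + m ≡ length (outs o v) + length (ins o v)
        total = trans (sym (reg v)) (count-split (adj G v) (o v) (λ u → o u v) (allFin n) λ u →
          IsEO.total eo , IsEO.edge eo , (λ t → subst T (Graph.sym G u v) (IsEO.edge eo t)) , IsEO.antisym eo)
        inm : length (ins o v) ≡ m
        inm = *-cancelˡ-≡ _ _ 2 (trans (cong (length (ins o v) +_) (+-identityʳ _)) (trans (sym (trans total (cong (_+ length (ins o v)) (IsEO.balanced eo v))))
          (cong (m +_) (sym (+-identityʳ m)))))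

      length-choices : length (choices o) ≡ (m ! * m !) ^ n
      length-choices = length-prodVec n λ v → trans (length-product _,_ (arrangements m (ins o v)) (arrangements m (outs o v)))
        (cong₂ _*_ (length-arrangements m (filterᵇ! (λ u → o u v)) (proj₁ (degree-split v)))
                   (length-arrangements m (filterᵇ! (o v)) (proj₂ (degree-split v))))

      choices! : Unique (choices o)
      choices! = prodVec! n λ v → Uniqueₚ.cartesianProduct⁺ (arrangements! m (filterᵇ! (λ u → o u v))) (arrangements! m (filterᵇ! (o v)))

      X-onto : ∀ {λs} → Consistent o λs → ∀ {u v} → T (o u v) → ∃[ i ] (X λs (v , i) ≡ u)
      X-onto {λs} c {u} {v} t = arrangement-onto (proj₁ (lookup λs v)) (≤-reflexive (proj₁ (degree-split v)))
        (λ i → ∈-filterᵇ⁺ (λ u → o u v) (Consistent.X-in c (v , i))) (Consistent.X-inj c) (∈-filterᵇ⁺ (λ u → o u v) t)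

      Y-onto : ∀ {λs} → Consistent o λs → ∀ {u v} → T (o u v) → ∃[ i ] (Y λs (u , i) ≡ v)
      Y-onto {λs} c {u} {v} t = arrangement-onto (proj₂ (lookup λs u)) (≤-reflexive (proj₂ (degree-split u)))
        (λ i → ∈-filterᵇ⁺ (o u) (Consistent.Y-out c (u , i))) (Consistent.Y-inj c) (∈-filterᵇ⁺ (o u) t)

    ∈-Ω⁻ : ∀ {λs} → λs ∈ Ω → ∃[ o ] (o ∈ EOs × IsEO o × Consistent o λs)
    ∈-Ω⁻ λ∈ with ∈-concatMap⁻′ choices EOs λ∈
    ... | o , o∈ , h = o , o∈ , ∈-EOs⁻ o∈ , ∈-choices⁻ h

    ∈-Ω⁺ : ∀ {o λs} → IsEO o → Consistent o λs → λs ∈ Ω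
    ∈-Ω⁺ eo c with ∈-EOs⁺ eo
    ... | o′ , o′∈ , e = ∈-concatMap⁺′ choices o′∈ (∈-choices⁺ (record
      { X-inj = Consistent.X-inj c ; Y-inj = Consistent.Y-inj c
      ; X-in = λ p → subst T (sym (e _ _)) (Consistent.X-in c p) ; Y-out = λ p → subst T (sym (e _ _)) (Consistent.Y-out c p) }))

    length-Ω : length Ω ≡ EO G * (m ! * m !) ^ n
    length-Ω = length-concatMap choices EOs (λ o∈ → length-choices (∈-EOs⁻ o∈))

    -- A consistent labelling determines its orientation: the Y-entries at u are exactly the
    -- out-neighbours of u.
    Ω! : Unique Ω
    Ω! = concatMap! choices EOs-distinct (λ o∈ → choices! (∈-EOs⁻ o∈)) disjoint
      where
      half : ∀ {o o′ λs} → IsEO o → Consistent o λs → Consistent o′ λs → ∀ {u v} → T (o u v) → T (o′ u v)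
      half {o′ = o′} eo c c′ {u} t with Y-onto eo c t
      ... | i , refl = Consistent.Y-out c′ (u , i)
      disjoint : ∀ {o o′ λs} → o ∈ EOs → o′ ∈ EOs → λs ∈ choices o → λs ∈ choices o′ → ¬ ¬ (∀ u v → o u v ≡ o′ u v)
      disjoint {o} {o′} o∈ o′∈ h h′ ne = ne λ u v → ≡-from (half (∈-EOs⁻ o∈) (∈-choices⁻ h) (∈-choices⁻ h′)) (half (∈-EOs⁻ o′∈) (∈-choices⁻ h′) (∈-choices⁻ h))
        where
        ≡-from : ∀ {a b} → (T a → T b) → (T b → T a) → a ≡ b
        ≡-from {true}  {true}  _ _ = refl
        ≡-from {true}  {false} f _ = ⊥-elim (f tt)
        ≡-from {false} {true}  _ g = ⊥-elim (g tt)
        ≡-from {false} {false} _ _ = refl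

    -- Junk value p when no edge comes back from the head, which does not happen on Ω.
    succ : Labelling → Fin n × Fin m → Fin n × Fin m
    succ λs p with any? (λ j → X λs (Y λs p , j) ≟ᶠ proj₁ p)
    ... | yes (j , _) = Y λs p , j
    ... | no _        = p

    -- Changes only which incoming edge is paired with which outgoing edge at v. The orientation
    -- stays, and `succ` is followed by the transposition of (v , i) and (v , j).
    swapX : Fin n → Fin m → Fin m → Labelling → Labelling
    swapX v i j λs = mk (X λs ∘ exchangeAt v i j) (Y λs)

    succ-spec : ∀ {o λs} → Consistent o λs → ∀ {p j} → X λs (Y λs p , j) ≡ proj₁ p → succ λs p ≡ (Y λs p , j)
    succ-spec {λs = λs} c {p} {j} e with any? (λ j → X λs (Y λs p , j) ≟ᶠ proj₁ p)
    ... | yes (j′ , e′) = cong (Y λs p ,_) (Consistent.X-inj c (trans e′ (sym e)))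
    ... | no ¬e         = contradiction (j , e) ¬e

    succ-char : ∀ {λs} → λs ∈ Ω → ∀ p → ∃[ j ] (X λs (Y λs p , j) ≡ proj₁ p × succ λs p ≡ (Y λs p , j))
    succ-char λ∈ p =
      let (o , _ , eo , c) = ∈-Ω⁻ λ∈
          (j , e) = X-onto eo c (Consistent.Y-out c p)
      in j , e , succ-spec c e

    X-succ : ∀ {λs} → λs ∈ Ω → ∀ p → X λs (succ λs p) ≡ proj₁ p
    X-succ {λs} λ∈ p = let (j , e , f) = succ-char λ∈ p in trans (cong (X λs) f) e

    X-swapX : ∀ v i j λs p → X (swapX v i j λs) p ≡ X λs (exchangeAt v i j p)
    X-swapX v i j λs p = X-mk (X λs ∘ exchangeAt v i j) (Y λs) p

    Y-swapX : ∀ v i j λs p → Y (swapX v i j λs) p ≡ Y λs p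
    Y-swapX v i j λs p = Y-mk (X λs ∘ exchangeAt v i j) (Y λs) p

    swapX-consistent : ∀ {o λs} → Consistent o λs → ∀ v i j → Consistent o (swapX v i j λs)
    swapX-consistent {o} {λs} c v i j = record
      { X-inj = λ {u} {k} {l} e → inj u k l (trans (sym (X-swapX v i j λs (u , k))) (trans e (X-swapX v i j λs (u , l))))
      ; Y-inj = λ {u} {k} {l} e → Consistent.Y-inj c (trans (sym (Y-swapX v i j λs (u , k))) (trans e (Y-swapX v i j λs (u , l))))
      ; X-in = λ p → subst₂ (λ a b → T (o a b)) (sym (X-swapX v i j λs p)) (exchangeAt-fst v i j p) (Consistent.X-in c (exchangeAt v i j p))
      ; Y-out = λ p → subst (λ a → T (o (proj₁ p) a)) (sym (Y-swapX v i j λs p)) (Consistent.Y-out c p) }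
      where
      same-fibre : ∀ {p q} → proj₁ p ≡ proj₁ q → X λs p ≡ X λs q → p ≡ q
      same-fibre {u , k} {_ , l} refl e = cong (u ,_) (Consistent.X-inj c e)
      inj : ∀ u k l → X λs (exchangeAt v i j (u , k)) ≡ X λs (exchangeAt v i j (u , l)) → k ≡ l
      inj u k l e = cong proj₂ (trans (sym (exchangeAt-involutive v i j (u , k)))
        (trans (cong (exchangeAt v i j) (same-fibre (trans (exchangeAt-fst v i j (u , k)) (sym (exchangeAt-fst v i j (u , l)))) e))
          (exchangeAt-involutive v i j (u , l))))

    swapX-∈ : ∀ {λs} → λs ∈ Ω → ∀ v i j → swapX v i j λs ∈ Ω
    swapX-∈ λ∈ v i j = let (_ , _ , eo , c) = ∈-Ω⁻ λ∈ in ∈-Ω⁺ eo (swapX-consistent c v i j)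

    swapX-succ : ∀ {λs} → λs ∈ Ω → ∀ v i j p → succ (swapX v i j λs) p ≡ exchangeAt v i j (succ λs p)
    swapX-succ {λs} λ∈ v i j p = trans (succ-spec (swapX-consistent c v i j) {p} {k} back) (cong (_, k) (trans (Y-swapX v i j λs p) (sym u≡)))
      where
      c = proj₂ (proj₂ (proj₂ (∈-Ω⁻ λ∈)))
      u = proj₁ (exchangeAt v i j (succ λs p))
      k = proj₂ (exchangeAt v i j (succ λs p))
      u≡ : u ≡ Y λs p
      u≡ = (trans (exchangeAt-fst v i j (succ λs p)) (cong proj₁ (proj₂ (proj₂ (succ-char λ∈ p)))))
      back : X (swapX v i j λs) (Y (swapX v i j λs) p , k) ≡ proj₁ p
      back = begin
        X (swapX v i j λs) (Y (swapX v i j λs) p , k)      ≡⟨ cong (λ z → X (swapX v i j λs) (z , k)) (trans (Y-swapX v i j λs p) (sym u≡)) ⟩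
        X (swapX v i j λs) (u , k)                         ≡⟨ X-swapX v i j λs (u , k) ⟩
        X λs (exchangeAt v i j (exchangeAt v i j (succ λs p))) ≡⟨ cong (X λs) (exchangeAt-involutive v i j (succ λs p)) ⟩
        X λs (succ λs p)                                   ≡⟨ X-succ λ∈ p ⟩
        proj₁ p                                            ∎
        where open ≡-Reasoning

    succ-injective : ∀ {λs} → λs ∈ Ω → ∀ {p q} → succ λs p ≡ succ λs q → p ≡ q
    succ-injective {λs} λ∈ {p} {q} e = same-fibre (trans (sym (X-succ λ∈ p)) (trans (cong (X λs) e) (X-succ λ∈ q)))
      (trans (sym (cong proj₁ (proj₂ (proj₂ (succ-char λ∈ p))))) (trans (cong proj₁ e) (cong proj₁ (proj₂ (proj₂ (succ-char λ∈ q))))))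
      where
      same-fibre : ∀ {p q} → proj₁ p ≡ proj₁ q → Y λs p ≡ Y λs q → p ≡ q
      same-fibre {u , k} {_ , l} refl f = cong (u ,_) (Consistent.Y-inj (proj₂ (proj₂ (proj₂ (∈-Ω⁻ λ∈)))) f)

    system : SwitchSystem G m
    system = record
      { S = Labelling ; Φ = Ω ; Φ! = Ω! ; y = Y ; φ = succ ; swap = swapX
      ; φ-tail = λ λ∈ p → cong proj₁ (proj₂ (proj₂ (succ-char λ∈ p)))
      ; y-inj = λ λ∈ → Consistent.Y-inj (proj₂ (proj₂ (proj₂ (∈-Ω⁻ λ∈))))
      ; φ-inj = succ-injective
      ; adj-y = λ λ∈ p → let (_ , _ , eo , c) = ∈-Ω⁻ λ∈ in IsEO.edge eo (Consistent.Y-out c p)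
      ; y-antisym = λ λ∈ {p} {q} e f → let (o , _ , eo , c) = ∈-Ω⁻ λ∈ in
          IsEO.antisym eo (subst (λ z → T (o (proj₁ p) z)) e (Consistent.Y-out c p)) (subst (λ z → T (o (proj₁ q) z)) f (Consistent.Y-out c q))
      ; swap-∈ = swapX-∈
      ; swap-invol = λ {λs} _ v i j → labelling-ext
          (λ p → trans (X-swapX v i j (swapX v i j λs) p) (trans (X-swapX v i j λs (exchangeAt v i j p)) (cong (X λs) (exchangeAt-involutive v i j p))))
          (λ p → trans (Y-swapX v i j (swapX v i j λs) p) (Y-swapX v i j λs p))
      ; swap-y = λ {λs} _ v i j p → Y-swapX v i j λs p
      ; swap-φ = swapX-succ }

-- Flips

-- Two perfect matchings on a finite set form even cycles, hence a bipartite graph.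
module TwoMatchings {D : Set} {K : ℕ} (idx : D → Fin K) (idx-inj : ∀ {g h} → idx g ≡ idx h → g ≡ h)
  (τ ε : D → D) (τ-invol : ∀ h → τ (τ h) ≡ h) (ε-invol : ∀ h → ε (ε h) ≡ h)
  (τ-free : ∀ h → τ h ≢ h) (ε-free : ∀ h → ε h ≢ h) where

  open Orbit {D} idx idx-inj

  private
    ψ : D → D
    ψ h = τ (ε h)

    ψ-inj : ∀ {g h} → ψ g ≡ ψ h → g ≡ h
    ψ-inj {g} {h} e = trans (sym (ε-invol g)) (trans (cong ε (trans (sym (τ-invol (ε g))) (trans (cong τ e) (τ-invol (ε h))))) (ε-invol h))

    -- Evenness of the cycles: cancelling ε and τ at the ends lowers the exponent by two, down to a
    -- fixed point of ε or τ. So h and ε h lie in different orbits of ψ, the two colour classes of a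
    -- cycle.
    ψ-never-ε : ∀ k h → iter ψ k h ≢ ε h
    ψ-never-ε zero          h e = ε-free h (sym e)
    ψ-never-ε (suc zero)    h e = τ-free (ε h) e
    ψ-never-ε (suc (suc k)) h e = ψ-never-ε k (ψ h)
      (trans (sym (ε-invol (iter ψ k (ψ h)))) (cong ε (trans (sym (τ-invol _)) (cong τ (trans (cong ψ (iter-shift ψ k h)) e)))))

    leaderOf : D → D
    leaderOf h = proj₁ (leader-exists ψ-inj h)

    leaderOf-reach : ∀ {g h} → Reach ψ g h → leaderOf g ≡ leaderOf h
    leaderOf-reach {g} {h} r = leader-unique ψ-inj (proj₁ (proj₂ (leader-exists ψ-inj g))) (proj₁ (proj₂ (leader-exists ψ-inj h)))
      (reach-trans ψ ψ-inj (reach-sym ψ ψ-inj (proj₂ (proj₂ (leader-exists ψ-inj g)))) (reach-trans ψ ψ-inj r (proj₂ (proj₂ (leader-exists ψ-inj h)))))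

    leaderOf-ε : ∀ h → leaderOf h ≢ leaderOf (ε h)
    leaderOf-ε h e = let (k , f) = reach-trans ψ ψ-inj (proj₂ (proj₂ (leader-exists ψ-inj h)))
                           (subst (λ z → Reach ψ z (ε h)) (sym e) (reach-sym ψ ψ-inj (proj₂ (proj₂ (leader-exists ψ-inj (ε h))))))
      in ψ-never-ε (toℕ k) h f

    rank : D → ℕ
    rank h = toℕ (idx (leaderOf h))

    less : ℕ → ℕ → Bool
    less a b = ⌊ a <? b ⌋

    less-flip : ∀ {a b} → a ≢ b → less b a ≡ not (less a b)
    less-flip {a} {b} a≢b with a <? b | b <? a
    ... | yes a<b | yes b<a = contradiction b<a (<-asym a<b)
    ... | yes _   | no _    = refl
    ... | no _    | yes _   = refl
    ... | no a≮b  | no b≮a  = contradiction (≤-antisym (≮⇒≥ b≮a) (≮⇒≥ a≮b)) a≢b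

    rank-ε : ∀ h → rank h ≢ rank (ε h)
    rank-ε h e = leaderOf-ε h (idx-inj (toℕ-injective e))

  -- The two orbits on a cycle are told apart by comparing the indices of their leaders.
  sign : D → Bool
  sign h = less (rank h) (rank (ε h))

  sign-ε : ∀ h → sign (ε h) ≡ not (sign h)
  sign-ε h = trans (cong (λ z → less (rank (ε h)) (rank z)) (ε-invol h)) (less-flip (rank-ε h))

  -- τ h lies in the ψ-orbit of ε h, and ε (τ h) in that of h, so the comparison is reversed.
  sign-τ : ∀ h → sign (τ h) ≡ not (sign h)
  sign-τ h = trans (cong₂ less
    (cong (toℕ ∘ idx) (sym (leaderOf-reach (reach-iter ψ ψ-inj 1 (cong τ (ε-invol h))))))
    (cong (toℕ ∘ idx) (leaderOf-reach (reach-iter ψ ψ-inj 1 (trans (cong τ (ε-invol (τ h))) (τ-invol h))))))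
    (less-flip (rank-ε h))

xor-cancelʳ : ∀ a b c → a xor c ≡ b xor c → a ≡ b
xor-cancelʳ true  true  _     _ = refl
xor-cancelʳ false false _     _ = refl
xor-cancelʳ true  false true  ()
xor-cancelʳ true  false false ()
xor-cancelʳ false true  true  ()
xor-cancelʳ false true  false ()

xor-twice : ∀ b c → (b xor c) xor c ≡ b
xor-twice true  true  = refl
xor-twice true  false = refl
xor-twice false true  = refl
xor-twice false false = refl

module Flips {n : ℕ} (G : Graph n) (m : ℕ) (reg : IsRegular (m + m) G) where
  open EulerianOrientations G
  open Labellings G m

  -- The boolean names the member of the pair, so that a flip acts on it by xor.
  ent : Labelling → Fin n × Fin m → Bool → Fin n
  ent μ p true  = Y μ p
  ent μ p false = X μ p

  record IsLab (μ : Labelling) : Set where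
    field
      ent-adj : ∀ p b → T (adj G (proj₁ p) (ent μ p b))
      ent-inj : ∀ {v i j b c} → ent μ (v , i) b ≡ ent μ (v , j) c → i ≡ j × b ≡ c

  ent-ext : ∀ {λs μs} → (∀ p b → ent λs p b ≡ ent μs p b) → λs ≡ μs
  ent-ext h = labelling-ext (λ p → h p false) (λ p → h p true)

  ix : Fin m → Bool → Fin (m + m)
  ix i false = i ↑ˡ m
  ix i true  = m ↑ʳ i

  ix⁻¹ : Fin (m + m) → Fin m × Bool
  ix⁻¹ k = [ (λ i → i , false) , (λ i → i , true) ]′ (splitAt m k)

  ix⁻¹-ix : ∀ i b → ix⁻¹ (ix i b) ≡ (i , b)
  ix⁻¹-ix i false = cong [ (λ i → i , false) , (λ i → i , true) ]′ (splitAt-↑ˡ m i m)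
  ix⁻¹-ix i true  = cong [ (λ i → i , false) , (λ i → i , true) ]′ (splitAt-↑ʳ m m i)

  ix-ix⁻¹ : ∀ k → ix (proj₁ (ix⁻¹ k)) (proj₂ (ix⁻¹ k)) ≡ k
  ix-ix⁻¹ k with splitAt m k in eq
  ... | inj₁ i = splitAt⁻¹-↑ˡ eq
  ... | inj₂ i = splitAt⁻¹-↑ʳ eq

  nbrs : Fin n → List (Fin n)
  nbrs v = filterᵇ (adj G v) (allFin n)

  halve : Vec (Fin n) (m + m) → Vec (Fin n) m × Vec (Fin n) m
  halve xs = tabulate (λ i → lookup xs (ix i false)) , tabulate (λ i → lookup xs (ix i true))

  halve-injective : ∀ {xs ys} → halve xs ≡ halve ys → xs ≡ ys
  halve-injective {xs} {ys} e = vec-ext λ k → subst (λ k → lookup xs k ≡ lookup ys k) (ix-ix⁻¹ k) (go (proj₁ (ix⁻¹ k)) (proj₂ (ix⁻¹ k)))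
    where
    go : ∀ i b → lookup xs (ix i b) ≡ lookup ys (ix i b)
    go i false = trans (sym (lookup∘tabulate (λ i → lookup xs (ix i false)) i)) (trans (cong (λ z → lookup (proj₁ z) i) e) (lookup∘tabulate (λ i → lookup ys (ix i false)) i))
    go i true  = trans (sym (lookup∘tabulate (λ i → lookup xs (ix i true)) i)) (trans (cong (λ z → lookup (proj₂ z) i) e) (lookup∘tabulate (λ i → lookup ys (ix i true)) i))

  joined : Labelling → Fin n → Vec (Fin n) (m + m)
  joined μ v = tabulate λ k → ent μ (v , proj₁ (ix⁻¹ k)) (proj₂ (ix⁻¹ k))

  lookup-joined : ∀ μ v i b → lookup (joined μ v) (ix i b) ≡ ent μ (v , i) b
  lookup-joined μ v i b = trans (lookup∘tabulate _ (ix i b)) (cong (λ z → ent μ (v , proj₁ z) (proj₂ z)) (ix⁻¹-ix i b))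

  halve-joined : ∀ μ v → halve (joined μ v) ≡ lookup μ v
  halve-joined μ v = cong₂ _,_
    (vec-ext λ i → trans (lookup∘tabulate _ i) (lookup-joined μ v i false))
    (vec-ext λ i → trans (lookup∘tabulate _ i) (lookup-joined μ v i true))

  Labs : List Labelling
  Labs = prodVec n λ v → map halve (arrangements (m + m) (nbrs v))

  length-Labs : length Labs ≡ ((m + m) !) ^ n
  length-Labs = length-prodVec n λ v → trans (length-map halve (arrangements (m + m) (nbrs v)))
    (length-arrangements (m + m) (filterᵇ! (adj G v)) (reg v))

  Labs! : Unique Labs
  Labs! = prodVec! n λ v → Uniqueₚ.map⁺ halve-injective (arrangements! (m + m) (filterᵇ! (adj G v)))

  module _ {μ : Labelling} (lab : IsLab μ) where
    joined-adj : ∀ v k → lookup (joined μ v) k ∈ nbrs v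
    joined-adj v k = ∈-filterᵇ⁺ (adj G v) (subst (λ z → T (adj G v z)) (sym (lookup∘tabulate _ k)) (IsLab.ent-adj lab (v , proj₁ (ix⁻¹ k)) (proj₂ (ix⁻¹ k))))

    joined-inj : ∀ v {k l} → lookup (joined μ v) k ≡ lookup (joined μ v) l → k ≡ l
    joined-inj v {k} {l} e =
      let (f , g) = IsLab.ent-inj lab {v} {proj₁ (ix⁻¹ k)} {proj₁ (ix⁻¹ l)} {proj₂ (ix⁻¹ k)} {proj₂ (ix⁻¹ l)} (trans (sym (lookup∘tabulate _ k)) (trans e (lookup∘tabulate _ l)))
      in trans (sym (ix-ix⁻¹ k)) (trans (cong₂ ix f g) (ix-ix⁻¹ l))

    ∈-Labs⁺ : μ ∈ Labs
    ∈-Labs⁺ = ∈-prodVec⁺ μ λ v → subst (_∈ map halve (arrangements (m + m) (nbrs v))) (halve-joined μ v)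
      (∈-map⁺ halve (∈-arrangements⁺ (joined μ v) (joined-adj v) (joined-inj v)))

    ent-onto : ∀ {v u} → T (adj G v u) → ∃[ i ] ∃[ b ] (ent μ (v , i) b ≡ u)
    ent-onto {v} {u} a =
      let (k , e) = arrangement-onto (joined μ v) (≤-reflexive (reg v)) (joined-adj v) (joined-inj v) (∈-filterᵇ⁺ (adj G v) a)
      in proj₁ (ix⁻¹ k) , proj₂ (ix⁻¹ k) , trans (sym (lookup∘tabulate _ k)) e

  ∈-Labs⁻ : ∀ {μ} → μ ∈ Labs → IsLab μ
  ∈-Labs⁻ {μ} μ∈ = record
    { ent-adj = λ { (v , i) b → subst (λ z → T (adj G v z)) (at v i b) (∈-filterᵇ⁻ (adj G v) (proj₁ (arr v) (ix i b))) }
    ; ent-inj = λ {v} {i} {j} {b} {c} e →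
        let f = trans (sym (ix⁻¹-ix i b)) (trans (cong ix⁻¹ (proj₂ (arr v) (trans (at v i b) (trans e (sym (at v j c)))))) (ix⁻¹-ix j c))
        in cong proj₁ f , cong proj₂ f }
    where
    source : ∀ v → ∃[ xs ] (xs ∈ arrangements (m + m) (nbrs v) × lookup μ v ≡ halve xs)
    source v = ∈-map⁻ halve (∈-prodVec⁻ n μ∈ v)
    arr : ∀ v → (∀ k → lookup (proj₁ (source v)) k ∈ nbrs v) × (∀ {k l} → lookup (proj₁ (source v)) k ≡ lookup (proj₁ (source v)) l → k ≡ l)
    arr v = ∈-arrangements⁻ (m + m) (proj₁ (proj₂ (source v)))
    at : ∀ v i b → lookup (proj₁ (source v)) (ix i b) ≡ ent μ (v , i) b
    at v i false = sym (trans (cong (λ z → lookup (proj₁ z) i) (proj₂ (proj₂ (source v)))) (lookup∘tabulate _ i))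
    at v i true  = sym (trans (cong (λ z → lookup (proj₂ z) i) (proj₂ (proj₂ (source v)))) (lookup∘tabulate _ i))

  Ω⇒IsLab : ∀ {λs} → λs ∈ Ω → IsLab λs
  Ω⇒IsLab {λs} λ∈ = record { ent-adj = adjacent ; ent-inj = injective }
    where
    o = proj₁ (∈-Ω⁻ reg λ∈)
    eo = proj₁ (proj₂ (proj₂ (∈-Ω⁻ reg λ∈)))
    c = proj₂ (proj₂ (proj₂ (∈-Ω⁻ reg λ∈)))
    adjacent : ∀ p b → T (adj G (proj₁ p) (ent λs p b))
    adjacent p true  = IsEO.edge eo (Consistent.Y-out c p)
    adjacent p false = subst T (Graph.sym G _ _) (IsEO.edge eo (Consistent.X-in c p))
    clash : ∀ {v i j} → X λs (v , i) ≢ Y λs (v , j)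
    clash {v} {i} {j} e = IsEO.antisym eo (subst (λ z → T (o z v)) e (Consistent.X-in c (v , i))) (Consistent.Y-out c (v , j))
    injective : ∀ {v i j b b′} → ent λs (v , i) b ≡ ent λs (v , j) b′ → i ≡ j × b ≡ b′
    injective {b = true}  {true}  e = Consistent.Y-inj c e , refl
    injective {b = false} {false} e = Consistent.X-inj c e , refl
    injective {b = true}  {false} e = ⊥-elim (clash (sym e))
    injective {b = false} {true}  e = ⊥-elim (clash e)

  Flip : Set
  Flip = Vec (Vec Bool m) n

  at : Flip → Fin n × Fin m → Bool
  at e (v , i) = lookup (lookup e v) i

  flipOf : (Fin n × Fin m → Bool) → Flip
  flipOf f = tabulate λ v → tabulate λ i → f (v , i)

  at-flipOf : ∀ f p → at (flipOf f) p ≡ f p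
  at-flipOf f (v , i) = trans (cong (λ z → lookup z i) (lookup∘tabulate _ v)) (lookup∘tabulate _ i)

  allFlips : List Flip
  allFlips = prodVec n λ _ → prodVec m λ _ → bools

  length-allFlips : length allFlips ≡ (2 ^ m) ^ n
  length-allFlips = length-prodVec n λ _ → length-prodVec m λ _ → refl

  allFlips! : Unique allFlips
  allFlips! = prodVec! n λ _ → prodVec! m λ _ → bools!

  ∈-allFlips : ∀ e → e ∈ allFlips
  ∈-allFlips e = ∈-prodVec⁺ e λ v → ∈-prodVec⁺ (lookup e v) λ i → ∈-bools _

  flip : Flip → Labelling → Labelling
  flip e μ = mk (λ p → ent μ p (at e p)) (λ p → ent μ p (not (at e p)))

  ent-flip : ∀ e μ p b → ent (flip e μ) p b ≡ ent μ p (b xor at e p)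
  ent-flip e μ p true  = Y-mk (λ p → ent μ p (at e p)) (λ p → ent μ p (not (at e p))) p
  ent-flip e μ p false = X-mk (λ p → ent μ p (at e p)) (λ p → ent μ p (not (at e p))) p

  flip-flip : ∀ e μ → flip e (flip e μ) ≡ μ
  flip-flip e μ = ent-ext λ p b → trans (ent-flip e (flip e μ) p b) (trans (ent-flip e μ p (b xor at e p)) (cong (ent μ p) (xor-twice b (at e p))))

  flip-IsLab : ∀ e {μ} → IsLab μ → IsLab (flip e μ)
  flip-IsLab e {μ} lab = record
    { ent-adj = λ p b → subst (λ z → T (adj G (proj₁ p) z)) (sym (ent-flip e μ p b)) (IsLab.ent-adj lab p (b xor at e p))
    ; ent-inj = λ {v} {i} {j} {b} {c} f → inj v i j b c (trans (sym (ent-flip e μ (v , i) b)) (trans f (ent-flip e μ (v , j) c))) }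
    where
    inj : ∀ v i j b c → ent μ (v , i) (b xor at e (v , i)) ≡ ent μ (v , j) (c xor at e (v , j)) → i ≡ j × b ≡ c
    inj v i j b c f with IsLab.ent-inj lab {v} {i} {j} {b xor at e (v , i)} {c xor at e (v , j)} f
    ... | refl , g = refl , xor-cancelʳ b c (at e (v , i)) g

-- Consistent labellings in a flip class: upper bound

-- Gives all code words the common length B. Truncation does not occur in use, since only labellings
-- with at most B leaders are encoded.
pad : ∀ B → List Bool → Vec Bool B
pad zero    _        = []
pad (suc B) []       = false ∷ pad B []
pad (suc B) (b ∷ bs) = b ∷ pad B bs

pad-injective : ∀ {A : Set} {f g : A → Bool} B xs → length xs ≤ B → pad B (map f xs) ≡ pad B (map g xs) → ∀ {x} → x ∈ xs → f x ≡ g x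
pad-injective (suc B) (x ∷ xs) _         e (here refl) = cong Vec-head e
  where
  Vec-head : Vec Bool (suc B) → Bool
  Vec-head (b ∷ _) = b
pad-injective (suc B) (x ∷ xs) (s≤s le)  e (there x∈)  = pad-injective B xs le (cong Vec-tail e) x∈
  where
  Vec-tail : Vec Bool (suc B) → Vec Bool B
  Vec-tail (_ ∷ bs) = bs

module UpperCount {n : ℕ} (G : Graph n) (m : ℕ) (reg : IsRegular (m + m) G) where
  open Labellings G m
  open Flips G m reg
  open Orbit {Fin n × Fin m} position-index position-index-injective

  φ : Labelling → Fin n × Fin m → Fin n × Fin m
  φ = succ reg

  leaders : Labelling → List (Fin n × Fin m)
  leaders λs = filter (leader? (φ λs)) (positions n m)

  -- Two consistent labellings differing by the flip δ: δ is constant along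
  -- circuits, and flipped circuits are run through backwards.
  module Compare {λ₁ λ₂ : Labelling} (∈₁ : λ₁ ∈ Ω) (∈₂ : λ₂ ∈ Ω) (δ : Fin n × Fin m → Bool)
    (rel : ∀ p b → ent λ₂ p b ≡ ent λ₁ p (b xor δ p)) where

    private
      c₂ = proj₂ (proj₂ (proj₂ (∈-Ω⁻ reg ∈₂)))
      eo₂ = proj₁ (proj₂ (proj₂ (∈-Ω⁻ reg ∈₂)))
      lab₁ = Ω⇒IsLab ∈₁

    -- If p is not flipped, both labellings leave along the same edge; if it is flipped, λ₂
    -- traverses that edge back to p. The edge has a single entry at its other end, which forces the
    -- same value of δ there.
    step : ∀ p → δ (φ λ₁ p) ≡ δ p × (φ λ₂ p ≡ φ λ₁ p ⊎ φ λ₂ (φ λ₁ p) ≡ p)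
    step p@(v , i) = subst (λ q → δ q ≡ δ p × (φ λ₂ p ≡ q ⊎ φ λ₂ q ≡ p)) (sym q≡) (go (δ p) refl)
      where
      u = Y λ₁ p
      j = proj₁ (succ-char reg ∈₁ p)
      Xj : X λ₁ (u , j) ≡ v
      Xj = proj₁ (proj₂ (succ-char reg ∈₁ p))
      q≡ : φ λ₁ p ≡ (u , j)
      q≡ = proj₂ (proj₂ (succ-char reg ∈₁ p))
      go : ∀ d → δ p ≡ d → δ (u , j) ≡ d × (φ λ₂ p ≡ (u , j) ⊎ φ λ₂ (u , j) ≡ p)
      go false δp = trans (cong (λ k → δ (u , k)) (sym (proj₁ same))) (proj₂ same) , inj₁ (trans (proj₂ (proj₂ (succ-char reg ∈₂ p))) (cong₂ _,_ Y₂ (proj₁ same)))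
        where
        Y₂ : Y λ₂ p ≡ u
        Y₂ = trans (rel p true) (cong (λ d → ent λ₁ p (true xor d)) δp)
        j₂ = proj₁ (succ-char reg ∈₂ p)
        same : j₂ ≡ j × δ (u , j₂) ≡ false
        same = IsLab.ent-inj lab₁ {u} {j₂} {j} {δ (u , j₂)} {false}
          (trans (sym (rel (u , j₂) false)) (trans (cong (λ z → X λ₂ (z , j₂)) (sym Y₂)) (trans (proj₁ (proj₂ (succ-char reg ∈₂ p))) (sym Xj))))
      go true δp = trans (cong (λ k → δ (u , k)) (sym (proj₁ same))) (not-injective (proj₂ same)) ,
        inj₂ (trans (succ-spec reg c₂ {u , j} {i} (trans (cong (λ z → X λ₂ (z , i)) Yq) X₂)) (cong (_, i) Yq))
        where
        X₂ : X λ₂ p ≡ u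
        X₂ = trans (rel p false) (cong (λ d → ent λ₁ p (false xor d)) δp)
        found : ∃[ k ] (Y λ₂ (u , k) ≡ v)
        found = Y-onto reg eo₂ c₂ (subst (λ z → T (proj₁ (∈-Ω⁻ reg ∈₂) z v)) X₂ (Consistent.X-in c₂ p))
        k = proj₁ found
        same : k ≡ j × not (δ (u , k)) ≡ false
        same = IsLab.ent-inj lab₁ {u} {k} {j} {not (δ (u , k))} {false}
          (trans (sym (rel (u , k) true)) (trans (proj₂ found) (sym Xj)))
        not-injective : ∀ {b} → not b ≡ false → b ≡ true
        not-injective {true} _ = refl
        Yq : Y λ₂ (u , j) ≡ v
        Yq = trans (cong (λ z → Y λ₂ (u , z)) (sym (proj₁ same))) (proj₂ found)

    reach : ∀ {p q} → Reach (φ λ₁) p q → Reach (φ λ₂) p q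
    reach {p} r = reach-stable (φ λ₁) (succ-injective reg ∈₁) (Reach (φ λ₂) p) (λ {q} pr → reach-trans (φ λ₂) inj₂′ pr (one q)) r (reach-refl (φ λ₂) inj₂′)
      where
      inj₂′ : ∀ {p q} → φ λ₂ p ≡ φ λ₂ q → p ≡ q
      inj₂′ = succ-injective reg ∈₂
      one : ∀ q → Reach (φ λ₂) q (φ λ₁ q)
      one q = [ reach-iter (φ λ₂) inj₂′ 1 , (λ e → reach-sym (φ λ₂) inj₂′ (reach-iter (φ λ₂) inj₂′ 1 e)) ]′ (proj₂ (step q))

    leader : ∀ {p} → Leader (φ λ₂) p → Leader (φ λ₁) p
    leader ℓ = leader-intro λ q r → leader-least ℓ (reach r)

    δ-const : ∀ {p q} → Reach (φ λ₁) p q → δ q ≡ δ p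
    δ-const = reach-invariant (φ λ₁) (succ-injective reg ∈₁) δ (λ p → proj₁ (step p))

  few? : ∀ B → Decidable (λ λs → length (leaders λs) ≤ B)
  few? B λs = length (leaders λs) ≤? B

  -- The two labellings differ by the flip `δ`, constant along circuits, and have the same leaders.
  -- Equal code words make `δ` vanish at the leaders, hence everywhere.
  flip-encoding-injective : ∀ B {λ₁ λ₂ e₁ e₂} → λ₁ ∈ Ω → λ₂ ∈ Ω → length (leaders λ₁) ≤ B →
    flip e₁ λ₁ ≡ flip e₂ λ₂ → pad B (map (at e₁) (leaders λ₁)) ≡ pad B (map (at e₂) (leaders λ₂)) → λ₁ ≡ λ₂ × e₁ ≡ e₂
  flip-encoding-injective B {λ₁} {λ₂} {e₁} {e₂} ∈₁ ∈₂ le ef eb =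
    ent-ext (λ p b → trans (cong (ent λ₁ p) (sym (trans (cong (b xor_) (δ≡false p)) (xor-false b)))) (sym (rel p b))) ,
    vec-ext λ v → vec-ext λ i → at≡ (v , i)
    where
    δ : Fin n × Fin m → Bool
    δ p = at e₁ p xor at e₂ p
    xor-false : ∀ b → b xor false ≡ b
    xor-false true  = refl
    xor-false false = refl
    shuffle : ∀ b c d → (b xor d) xor c ≡ b xor (c xor d)
    shuffle true  true  true  = refl
    shuffle true  true  false = refl
    shuffle true  false true  = refl
    shuffle true  false false = refl
    shuffle false true  true  = refl
    shuffle false true  false = refl
    shuffle false false true  = refl
    shuffle false false false = refl
    rel : ∀ p b → ent λ₂ p b ≡ ent λ₁ p (b xor δ p)
    rel p b = trans (cong (ent λ₂ p) (sym (xor-twice b (at e₂ p)))) (trans (sym (ent-flip e₂ λ₂ p (b xor at e₂ p)))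
      (trans (cong (λ z → ent z p (b xor at e₂ p)) (sym ef)) (trans (ent-flip e₁ λ₁ p (b xor at e₂ p)) (cong (ent λ₁ p) (shuffle b (at e₁ p) (at e₂ p))))))
    rel′ : ∀ p b → ent λ₁ p b ≡ ent λ₂ p (b xor δ p)
    rel′ p b = trans (cong (ent λ₁ p) (sym (xor-twice b (δ p)))) (sym (rel p (b xor δ p)))
    module C₁ = Compare ∈₁ ∈₂ δ rel
    module C₂ = Compare ∈₂ ∈₁ δ rel′
    leaders≡ : leaders λ₁ ≡ leaders λ₂
    leaders≡ = filter-≐ (leader? (φ λ₁)) (leader? (φ λ₂)) (C₂.leader , C₁.leader) (positions n m)
    agree : ∀ {p} → p ∈ leaders λ₁ → at e₁ p ≡ at e₂ p
    agree = pad-injective B (leaders λ₁) le (trans eb (cong (λ z → pad B (map (at e₂) z)) (sym leaders≡)))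
    same-xor : ∀ {a b} → a ≡ b → a xor b ≡ false
    same-xor {true}  refl = refl
    same-xor {false} refl = refl
    xor-same : ∀ {a b} → a xor b ≡ false → a ≡ b
    xor-same {true}  {true}  _ = refl
    xor-same {false} {false} _ = refl
    δ≡false : ∀ p → δ p ≡ false
    δ≡false p = let (q , ℓ , r) = leader-exists (succ-injective reg ∈₁) p in
      trans (sym (C₁.δ-const r)) (same-xor (agree (∈-filter⁺ (leader? (φ λ₁)) (∈-positions q) ℓ)))
    at≡ : ∀ p → at e₁ p ≡ at e₂ p
    at≡ p = xor-same (δ≡false p)

  upper-count : ∀ B → length (filter (few? B) Ω) * (2 ^ m) ^ n ≤ 2 ^ B * ((m + m) !) ^ n
  upper-count B = begin
    length few * (2 ^ m) ^ n                           ≡⟨ cong (length few *_) length-allFlips ⟨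
    length few * length allFlips                       ≡⟨ length-product _,_ few allFlips ⟨
    length (cartesianProduct few allFlips)             ≤⟨ inj-length code (Uniqueₚ.cartesianProduct⁺ (Uniqueₚ.filter⁺ (few? B) (Ω! reg)) allFlips!) mem inj ⟩
    length (cartesianProduct bits Labs)                ≡⟨ length-product _,_ bits Labs ⟩
    length bits * length Labs                          ≡⟨ cong₂ _*_ (length-prodVec B (λ _ → refl)) length-Labs ⟩
    2 ^ B * ((m + m) !) ^ n                            ∎
    where
    open ≤-Reasoning
    few = filter (few? B) Ω
    bits = prodVec B λ _ → bools
    code : Labelling × Flip → Vec Bool B × Labelling
    code (λs , e) = pad B (map (at e) (leaders λs)) , flip e λs
    un : ∀ {x} → x ∈ cartesianProduct few allFlips → proj₁ x ∈ Ω × length (leaders (proj₁ x)) ≤ B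
    un x∈ = ∈-filter⁻ (few? B) {xs = Ω} (proj₁ (∈-cartesianProduct⁻ few allFlips x∈))
    mem : ∀ {x} → x ∈ cartesianProduct few allFlips → code x ∈ cartesianProduct bits Labs
    mem {λs , e} x∈ = ∈-cartesianProduct⁺ (∈-prodVec⁺ _ λ _ → ∈-bools _) (∈-Labs⁺ (flip-IsLab e (Ω⇒IsLab (proj₁ (un x∈)))))
    inj : ∀ {x x′} → x ∈ cartesianProduct few allFlips → x′ ∈ cartesianProduct few allFlips → code x ≡ code x′ → x ≡ x′
    inj x∈ x′∈ eq = let (a , b) = flip-encoding-injective B (proj₁ (un x∈)) (proj₁ (un x′∈)) (proj₂ (un x∈)) (cong proj₂ eq) (cong proj₁ eq)
      in cong₂ _,_ a b

-- Consistent labellings in a flip class: existence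

image-count : ∀ {n k} (p : Fin n → Bool) (f : Fin k → Fin n) → (∀ {i j} → f i ≡ f j → i ≡ j) →
  (∀ i → T (p (f i))) → (∀ {z} → T (p z) → ∃[ i ] (f i ≡ z)) → length (filterᵇ p (allFin n)) ≡ k
image-count {n} {k} p f inj pf onto = ≤-antisym
  (subst (length (filterᵇ p (allFin n)) ≤_) (length-allFin k)
    (rel-length {R = λ z i → f i ≡ z} (Uniqueₚ.filter⁺ (T? ∘ p) (Uniqueₚ.allFin⁺ n))
      (λ z∈ → let (i , e) = onto (proj₂ (∈-filter⁻ (T? ∘ p) {xs = allFin n} z∈)) in i , ∈-allFin i , e)
      (λ _ _ e e′ → trans (sym e) e′)))
  (subst (_≤ length (filterᵇ p (allFin n))) (length-allFin k)
    (inj-length f (Uniqueₚ.allFin⁺ k) (λ {i} _ → ∈-filter⁺ (T? ∘ p) (∈-allFin (f i)) (pf i)) (λ _ _ → inj)))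

module LowerCount {n : ℕ} (G : Graph n) (m : ℕ) (reg : IsRegular (m + m) G) where
  open EulerianOrientations G
  open Labellings G m
  open Flips G m reg

  -- An entry of a labelling, that is, an edge seen from one of its ends.
  Dart : Set
  Dart = (Fin n × Fin m) × Bool

  dart-index : Dart → Fin (n * m * 2)
  dart-index (p , b) = combine (position-index p) (if b then suc zero else zero)

  dart-index-injective : ∀ {g h} → dart-index g ≡ dart-index h → g ≡ h
  dart-index-injective {p , b} {q , c} e =
    let (f , g) = combine-injective (position-index p) (if b then suc zero else zero) (position-index q) (if c then suc zero else zero) e
    in cong₂ _,_ (position-index-injective f) (bool b c g)
    where
    bool : ∀ b c → (if b then suc zero else zero) ≡ (if c then Fin.suc {1} zero else zero) → b ≡ c
    bool true  true  _ = refl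
    bool false false _ = refl

  module Oriented {λs : Labelling} (lab : IsLab λs)
    (partner : ∀ p b → ∃[ j ] (ent λs (ent λs p b , j) (not b) ≡ proj₁ p)) where

    -- Edges leave the end where they are Y-entries; `partner` makes them X-entries at the other
    -- end.
    o : Fin n → Fin n → Bool
    o u v = ⌊ any? (λ i → Y λs (u , i) ≟ᶠ v) ⌋

    o-X : ∀ {u v} → T (o u v) → ∃[ i ] (X λs (v , i) ≡ u)
    o-X {u} {v} t = let (i , e) = toWitness t ; (j , f) = partner (u , i) true in j , trans (cong (λ z → X λs (z , j)) (sym e)) f

    X-o : ∀ p → T (o (X λs p) (proj₁ p))
    X-o p = let (j , f) = partner p false in fromWitness (j , f)

    antisymmetric : ∀ {u v} → T (o u v) → ¬ T (o v u)
    antisymmetric {u} {v} t t′ = let (i , e) = toWitness t ; (j , f) = o-X t′ in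
      case proj₂ (IsLab.ent-inj lab {u} {i} {j} {true} {false} (trans e (sym f))) of λ ()

    eulerian : IsEO o
    eulerian = record
      { edge = λ {u} {v} t → let (i , e) = toWitness t in subst (λ z → T (adj G u z)) e (IsLab.ent-adj lab (u , i) true)
      ; total = λ {u} {v} a → let (i , b , e) = ent-onto lab a in total′ u v i b e
      ; antisym = antisymmetric
      ; balanced = λ v → trans
          (image-count (o v) (λ i → Y λs (v , i)) (λ e → proj₁ (IsLab.ent-inj lab {v} {b = true} {true} e)) (λ i → fromWitness (i , refl)) toWitness)
          (sym (image-count (λ u → o u v) (λ i → X λs (v , i)) (λ e → proj₁ (IsLab.ent-inj lab {v} {b = false} {false} e)) (λ i → X-o (v , i)) o-X)) }
      where
      total′ : ∀ u v i b → ent λs (u , i) b ≡ v → T (o u v) ⊎ T (o v u)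
      total′ u v i true  e = inj₁ (fromWitness (i , e))
      total′ u v i false e = inj₂ (subst (λ z → T (o z u)) e (X-o (u , i)))

    consistent : Consistent o λs
    consistent = record
      { X-inj = λ {v} e → proj₁ (IsLab.ent-inj lab {v} {b = false} {false} e)
      ; Y-inj = λ {v} e → proj₁ (IsLab.ent-inj lab {v} {b = true} {true} e)
      ; X-in = X-o
      ; Y-out = λ { (v , i) → fromWitness (i , refl) } }

    ∈Ω : λs ∈ Ω
    ∈Ω = ∈-Ω⁺ reg eulerian consistent

  module _ {μ : Labelling} (lab : IsLab μ) where

    private
      back : ∀ p b → ∃[ j ] ∃[ c ] (ent μ (ent μ p b , j) c ≡ proj₁ p)
      back p b = ent-onto lab (subst T (Graph.sym G (proj₁ p) (ent μ p b)) (IsLab.ent-adj lab p b))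

      reverseDart : Dart → Dart
      reverseDart (p , b) = let (j , c , _) = back p b in (ent μ p b , j) , c

      other : Dart → Dart
      other (p , b) = p , not b

      other-involutive : ∀ h → other (other h) ≡ h
      other-involutive (p , b) = cong (p ,_) (not-involutive b)

      other-free : ∀ h → other h ≢ h
      other-free (p , true)  ()
      other-free (p , false) ()

      dart≡ : ∀ {v u i j b c} → v ≡ u → ent μ (v , i) b ≡ ent μ (u , j) c → ((v , i) , b) ≡ ((u , j) , c)
      dart≡ {v} {i = i} {j} {b} {c} refl e = let (f , g) = IsLab.ent-inj lab {v} {i} {j} {b} {c} e in cong₂ (λ k d → ((v , k) , d)) f g

      reverse-involutive′ : ∀ h → reverseDart (reverseDart h) ≡ h
      reverse-involutive′ ((v , i) , b) = dart≡ e (proj₂ (proj₂ (back (u , j) c)))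
        where
        u = ent μ (v , i) b
        j = proj₁ (back (v , i) b)
        c = proj₁ (proj₂ (back (v , i) b))
        e : ent μ (u , j) c ≡ v
        e = proj₂ (proj₂ (back (v , i) b))

      reverse-free : ∀ h → reverseDart h ≢ h
      reverse-free (p , b) e = subst T (irrefl G (proj₁ p))
        (subst (λ z → T (adj G (proj₁ p) z)) (cong (proj₁ ∘ proj₁) e) (IsLab.ent-adj lab p b))

    module Signed (sign : Dart → Bool) (sign-other : ∀ h → sign (other h) ≡ not (sign h))
      (sign-reverse : ∀ h → sign (reverseDart h) ≡ not (sign h)) where

      -- After this flip the side of an entry is its colour. Edges joining darts of opposite colour
      -- is then exactly the condition `partner`.
      flipping : Flip
      flipping = flipOf (λ p → not (sign (p , true)))

      ε : Fin n × Fin m → Bool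
      ε = at flipping

      sign-at : ∀ p b → sign (p , b xor ε p) ≡ b
      sign-at p b = trans (cong (λ z → sign (p , b xor z)) (at-flipOf (λ p → not (sign (p , true))) p)) (cases b (sign (p , true)) refl (sign-other (p , true)))
        where
        cases : ∀ b s → sign (p , true) ≡ s → sign (p , false) ≡ not (sign (p , true)) → sign (p , b xor not s) ≡ b
        cases true  true  e f = e
        cases true  false e f = trans f (cong not e)
        cases false true  e f = trans f (cong not e)
        cases false false e f = e

      partner : ∀ p b → ∃[ j ] (ent (flip flipping μ) (ent (flip flipping μ) p b , j) (not b) ≡ proj₁ p)
      partner p b = subst (λ u → ∃[ j ] (ent (flip flipping μ) (u , j) (not b) ≡ proj₁ p)) (sym (ent-flip flipping μ p b))
        (j , trans (ent-flip flipping μ q (not b)) (trans (cong (ent μ q) (sym c≡)) (proj₂ (proj₂ (back p b′)))))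
        where
        b′ = b xor ε p
        j = proj₁ (back p b′)
        c = proj₁ (proj₂ (back p b′))
        q : Fin n × Fin m
        q = ent μ p b′ , j
        sign-q : sign (q , c) ≡ not b
        sign-q = trans (sign-reverse (p , b′)) (cong not (sign-at p b))
        c≡ : c ≡ not b xor ε q
        c≡ = trans (sym (xor-twice c (ε q))) (cong (_xor ε q) (trans (sym (sign-at q (c xor ε q))) (trans (cong (λ z → sign (q , z)) (xor-twice c (ε q))) sign-q)))

      signed∈Ω : ∃[ e ] (flip e μ ∈ Ω)
      signed∈Ω = flipping , Oriented.∈Ω (flip-IsLab flipping lab) partner

    -- The darts carry two perfect matchings, the pairs at vertices and the ends of edges; a
    -- 2-colouring proper for both chooses a direction for every circuit.
    orientable : ∃[ e ] (flip e μ ∈ Ω)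
    orientable = Signed.signed∈Ω sign sign-τ sign-ε
      where
      open TwoMatchings dart-index dart-index-injective other reverseDart
        other-involutive reverse-involutive′ other-free reverse-free

  -- Every flip class contains a consistent labelling, and μ is recovered from the flip and its
  -- result because flips are involutions.
  lower-count : ((m + m) !) ^ n ≤ (2 ^ m) ^ n * length Ω
  lower-count = begin
    ((m + m) !) ^ n                        ≡⟨ length-Labs ⟨
    length Labs                            ≤⟨ rel-length {R = λ μ x → flip (proj₁ x) (proj₂ x) ≡ μ} Labs!
                                                (λ {μ} μ∈ → let (e , h) = orientable (∈-Labs⁻ μ∈) in
                                                  (e , flip e μ) , ∈-cartesianProduct⁺ (∈-allFlips e) h , flip-flip e μ)
                                                (λ _ _ f g → trans (sym f) g) ⟩
    length (cartesianProduct allFlips Ω)   ≡⟨ length-product _,_ allFlips Ω ⟩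
    length allFlips * length Ω             ≡⟨ cong (_* length Ω) length-allFlips ⟩
    (2 ^ m) ^ n * length Ω                 ∎
    where open ≤-Reasoning

-- Elementary estimates

-- (1 + 1/s)^k ≥ 1 + k/s, cleared of denominators.
bernoulli : ∀ s k → s ^ k * (s + k) ≤ suc s ^ k * s
bernoulli s zero = ≤-reflexive (cong (_+ 0) (+-identityʳ s))
bernoulli s (suc k) = begin
  s * s ^ k * (s + suc k)           ≡⟨ solve 3 (λ s k a → s :* a :* (s :+ (con 1 :+ k)) := a :* (s :* s :+ s :* k :+ s)) refl s k (s ^ k) ⟩
  s ^ k * (s * s + s * k + s)       ≤⟨ *-monoʳ-≤ (s ^ k) (m≤m+n _ k) ⟩
  s ^ k * (s * s + s * k + s + k)   ≡⟨ solve 3 (λ s k a → a :* (s :* s :+ s :* k :+ s :+ k) := (con 1 :+ s) :* (a :* (s :+ k))) refl s k (s ^ k) ⟩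
  suc s * (s ^ k * (s + k))         ≤⟨ *-monoʳ-≤ (suc s) (bernoulli s k) ⟩
  suc s * (suc s ^ k * s)           ≡⟨ *-assoc (suc s) (suc s ^ k) s ⟨
  suc s * suc s ^ k * s             ∎
  where
  open ≤-Reasoning
  open +-*-Solver

double-power : ∀ s → 1 ≤ s → 2 * s ^ s ≤ suc s ^ s
double-power s@(suc _) _ = *-cancelʳ-≤ (2 * s ^ s) (suc s ^ s) s
  (subst (_≤ suc s ^ s * s) (solve 2 (λ a s → a :* (s :+ s) := con 2 :* a :* s) refl (s ^ s) s) (bernoulli s s))
  where open +-*-Solver

factorial-bound : ∀ x → 2 ^ x * suc x ! ≤ suc x ^ suc x
factorial-bound zero = ≤-refl
factorial-bound (suc x) = begin
  2 * 2 ^ x * (suc (suc x) * suc x !)       ≡⟨ solve 3 (λ a s f → con 2 :* a :* (s :* f) := s :* (con 2 :* (a :* f))) refl (2 ^ x) (suc (suc x)) (suc x !) ⟩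
  suc (suc x) * (2 * (2 ^ x * suc x !))     ≤⟨ *-monoʳ-≤ (suc (suc x)) (*-monoʳ-≤ 2 (factorial-bound x)) ⟩
  suc (suc x) * (2 * suc x ^ suc x)         ≤⟨ *-monoʳ-≤ (suc (suc x)) (double-power (suc x) (s≤s z≤n)) ⟩
  suc (suc x) * suc (suc x) ^ suc x         ∎
  where
  open ≤-Reasoning
  open +-*-Solver

∈⇒≤sum : ∀ {xs x} → x ∈ xs → x ≤ sum xs
∈⇒≤sum {x ∷ xs} (here refl) = m≤m+n x (sum xs)
∈⇒≤sum {z ∷ xs} (there x∈)  = ≤-trans (∈⇒≤sum x∈) (m≤n+m (sum xs) z)

fallProd-self : ∀ x → fallProd x x ≡ 1
fallProd-self zero = refl
fallProd-self (suc x) with suc x <? suc x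
... | yes lt = contradiction lt (<-irrefl refl)
... | no _   = refl

-- Only the x-th term of the partial sum of exp x is used; already x ^ x / x ! ≥ 2 ^ (x - 1).
exp-bound : ∀ x → 2 ^ x * suc x ! ≤ expPartialScaled (suc x) (suc x)
exp-bound x = ≤-trans (factorial-bound x) (subst (_≤ expPartialScaled (suc x) (suc x))
  (trans (cong (suc x ^ suc x *_) (fallProd-self (suc x))) (*-identityʳ _))
  (∈⇒≤sum {map term (upTo (suc (suc x)))} (∈-map⁺ term (∈-upTo⁺ {suc (suc x)} {suc x} ≤-refl))))
  where
  term : ℕ → ℕ
  term k = suc x ^ k * fallProd k (suc x)

-- (1 - ℓ/m)^k ≥ 1 - kℓ/m, cleared of denominators; `shrink` is the inductive step (1 - kℓ/m)(1 -
-- ℓ/m) ≥ 1 - (k+1)ℓ/m.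
power-shift : ∀ m ℓ k → k * ℓ ≤ m → m ^ k * (m ∸ k * ℓ) ≤ (m ∸ ℓ) ^ k * m
power-shift m ℓ zero    _ = ≤-refl
power-shift m ℓ (suc k) h = begin
  m * m ^ k * (m ∸ (ℓ + k * ℓ))        ≡⟨ solve 3 (λ m a c → m :* a :* c := a :* (m :* c)) refl m (m ^ k) (m ∸ (ℓ + k * ℓ)) ⟩
  m ^ k * (m * (m ∸ (ℓ + k * ℓ)))      ≤⟨ *-monoʳ-≤ (m ^ k) shrink ⟩
  m ^ k * ((m ∸ k * ℓ) * (m ∸ ℓ))      ≡⟨ *-assoc (m ^ k) (m ∸ k * ℓ) (m ∸ ℓ) ⟨
  m ^ k * (m ∸ k * ℓ) * (m ∸ ℓ)        ≤⟨ *-monoˡ-≤ (m ∸ ℓ) (power-shift m ℓ k (≤-trans (m≤n+m (k * ℓ) ℓ) h)) ⟩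
  (m ∸ ℓ) ^ k * m * (m ∸ ℓ)            ≡⟨ solve 3 (λ a m c → a :* m :* c := c :* a :* m) refl ((m ∸ ℓ) ^ k) m (m ∸ ℓ) ⟩
  (m ∸ ℓ) * (m ∸ ℓ) ^ k * m            ∎
  where
  open ≤-Reasoning
  open +-*-Solver
  r = m ∸ (ℓ + k * ℓ)
  m≡ : m ≡ ℓ + k * ℓ + r
  m≡ = sym (m+[n∸m]≡n h)
  shrink : m * r ≤ (m ∸ k * ℓ) * (m ∸ ℓ)
  shrink = begin
    m * r                                              ≡⟨ cong (_* r) m≡ ⟩
    (ℓ + k * ℓ + r) * r                                ≤⟨ m≤m+n _ (ℓ * (k * ℓ)) ⟩
    (ℓ + k * ℓ + r) * r + ℓ * (k * ℓ)                  ≡⟨ solve 3 (λ ℓ t r → (ℓ :+ t :+ r) :* r :+ ℓ :* t := (ℓ :+ r) :* (t :+ r)) refl ℓ (k * ℓ) r ⟩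
    (ℓ + r) * (k * ℓ + r)                              ≡⟨ cong₂ _*_ (sym m∸kℓ) (sym m∸ℓ) ⟩
    (m ∸ k * ℓ) * (m ∸ ℓ)                              ∎
    where
    m∸kℓ : m ∸ k * ℓ ≡ ℓ + r
    m∸kℓ = trans (cong (_∸ k * ℓ) (trans m≡ (solve 3 (λ ℓ t r → ℓ :+ t :+ r := t :+ (ℓ :+ r)) refl ℓ (k * ℓ) r))) (m+n∸m≡n (k * ℓ) (ℓ + r))
    m∸ℓ : m ∸ ℓ ≡ k * ℓ + r
    m∸ℓ = trans (cong (_∸ ℓ) (trans m≡ (+-assoc ℓ (k * ℓ) r))) (m+n∸m≡n ℓ (k * ℓ + r))

power-half : ∀ m ℓ k → 1 ≤ m → 2 * (k * ℓ) ≤ m → m ^ k ≤ 2 * (m ∸ ℓ) ^ k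
power-half m@(suc _) ℓ k _ h = *-cancelʳ-≤ (m ^ k) (2 * (m ∸ ℓ) ^ k) m (begin
  m ^ k * m                        ≤⟨ *-monoʳ-≤ (m ^ k) half ⟩
  m ^ k * (2 * (m ∸ k * ℓ))        ≡⟨ solve 2 (λ a c → a :* (con 2 :* c) := con 2 :* (a :* c)) refl (m ^ k) (m ∸ k * ℓ) ⟩
  2 * (m ^ k * (m ∸ k * ℓ))        ≤⟨ *-monoʳ-≤ 2 (power-shift m ℓ k (≤-trans (m≤m+n (k * ℓ) _) h)) ⟩
  2 * ((m ∸ ℓ) ^ k * m)            ≡⟨ *-assoc 2 ((m ∸ ℓ) ^ k) m ⟨
  2 * (m ∸ ℓ) ^ k * m              ∎)
  where
  open ≤-Reasoning
  open +-*-Solver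
  half : m ≤ 2 * (m ∸ k * ℓ)
  half = subst (m ≤_) (sym (*-distribˡ-∸ 2 m (k * ℓ))) (m+n≤o⇒m≤o∸n m (≤-trans (+-monoʳ-≤ m h) (≤-reflexive (cong (m +_) (sym (+-identityʳ m))))))

-- Raising the base by one at most doubles its fifth power: `power-half` with k = 5 and ℓ = 1 asks
-- for a base of at least 10, hence the shift by 10.
fifth-power-bound : ∀ x → (10 + x) ^ 5 ≤ 10 ^ 5 * 2 ^ x
fifth-power-bound zero = ≤-refl
fifth-power-bound (suc x) = begin
  (10 + suc x) ^ 5              ≤⟨ power-half (10 + suc x) 1 5 (s≤s z≤n) (m≤m+n 10 (suc x)) ⟩
  2 * (10 + suc x ∸ 1) ^ 5      ≡⟨ cong (λ z → 2 * z ^ 5) (cong (_∸ 1) (+-suc 10 x)) ⟩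
  2 * (10 + x) ^ 5              ≤⟨ *-monoʳ-≤ 2 (fifth-power-bound x) ⟩
  2 * (10 ^ 5 * 2 ^ x)          ≡⟨ solve 2 (λ a c → con 2 :* (a :* c) := a :* (con 2 :* c)) refl (10 ^ 5) (2 ^ x) ⟩
  10 ^ 5 * (2 * 2 ^ x)          ∎
  where
  open ≤-Reasoning
  open +-*-Solver

-- Four powers serve the product L³ (1 + Λ); the fifth is spent on the constant C.
poly≤exp : ∀ C x → 10 ^ 5 * C ≤ x → C * (10 + x) ^ 4 ≤ 2 ^ x
poly≤exp C x h = *-cancelˡ-≤ (10 ^ 5) (begin
  10 ^ 5 * (C * (10 + x) ^ 4)      ≡⟨ *-assoc (10 ^ 5) C _ ⟨
  10 ^ 5 * C * (10 + x) ^ 4        ≤⟨ *-monoˡ-≤ ((10 + x) ^ 4) (≤-trans h (m≤n+m x 10)) ⟩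
  (10 + x) * (10 + x) ^ 4          ≤⟨ fifth-power-bound x ⟩
  10 ^ 5 * 2 ^ x                   ∎)
  where open ≤-Reasoning

binary-length : ∀ m → 1 ≤ m → ∃[ x ] (2 ^ x ≤ m × m < 2 ^ suc x)
binary-length (suc zero) _ = 0 , s≤s z≤n , s≤s (s≤s z≤n)
binary-length (suc (suc m)) _ with binary-length (suc m) (s≤s z≤n)
... | x , lo , hi with suc (suc m) <? 2 ^ suc x
...   | yes lt = x , ≤-trans lo (n≤1+n _) , lt
...   | no ge = suc x , ≮⇒≥ ge , ≤-trans (s≤s hi) (≤-trans (+-monoˡ-≤ (2 ^ suc x) (m^n>0 2 (suc x))) (≤-reflexive (cong (2 ^ suc x +_) (sym (+-identityʳ _)))))

^-distribʳ-* : ∀ t a b → (a * b) ^ t ≡ a ^ t * b ^ t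
^-distribʳ-* zero    a b = refl
^-distribʳ-* (suc t) a b = trans (cong (a * b *_) (^-distribʳ-* t a b))
  (solve 4 (λ a b x y → a :* b :* (x :* y) := a :* x :* (b :* y)) refl a b (a ^ t) (b ^ t))
  where open +-*-Solver

-- (a/b)^b ≥ (1 + 1/b)^b ≥ 2, applied to t blocks of length b inside n.
ratio-power : ∀ {a b} n t → 1 ≤ b → b < a → b * t ≤ n → b ^ n * 2 ^ t ≤ a ^ n
ratio-power {a} {b} n t 1≤b b<a bt≤n = begin
  b ^ n * 2 ^ t                              ≡⟨ cong (λ z → b ^ z * 2 ^ t) (sym (m+[n∸m]≡n bt≤n)) ⟩
  b ^ (b * t + r) * 2 ^ t                    ≡⟨ cong (_* 2 ^ t) (trans (^-distribˡ-+-* b (b * t) r) (cong (_* b ^ r) (sym (^-*-assoc b b t)))) ⟩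
  (b ^ b) ^ t * b ^ r * 2 ^ t                ≡⟨ solve 3 (λ x y z → x :* y :* z := z :* x :* y) refl ((b ^ b) ^ t) (b ^ r) (2 ^ t) ⟩
  2 ^ t * (b ^ b) ^ t * b ^ r                ≡⟨ cong (_* b ^ r) (^-distribʳ-* t 2 (b ^ b)) ⟨
  (2 * b ^ b) ^ t * b ^ r                    ≤⟨ *-mono-≤ (^-monoˡ-≤ t (≤-trans (double-power b 1≤b) (^-monoˡ-≤ b b<a))) (^-monoˡ-≤ r (<⇒≤ b<a)) ⟩
  (a ^ b) ^ t * a ^ r                        ≡⟨ trans (cong (_* a ^ r) (^-*-assoc a b t)) (sym (^-distribˡ-+-* a (b * t) r)) ⟩
  a ^ (b * t + r)                            ≡⟨ cong (a ^_) (m+[n∸m]≡n bt≤n) ⟩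
  a ^ n                                      ∎
  where
  open ≤-Reasoning
  open +-*-Solver
  r = n ∸ b * t

central-binomial : ∀ m → paulingBinom (m + m) * (m ! * m !) ≡ (m + m) !
central-binomial m = begin
  paulingBinom (m + m) * (m ! * m !)                 ≡⟨ cong (λ h → ((m + m) choose h) * (m ! * m !)) (sym (n≡⌊n+n/2⌋ m)) ⟩
  ((m + m) choose m) * (m ! * m !)                          ≡⟨ cong (λ h → ((m + m) choose m) * (m ! * h !)) (sym (m+n∸m≡n m m)) ⟩
  ((m + m) choose m) * (m ! * (m + m ∸ m) !)                ≡⟨ cong (_* (m ! * (m + m ∸ m) !)) (nCk≡n!/k![n-k]! (m≤m+n m m)) ⟩
  _                                                  ≡⟨ m/n*n≡m {{m !* (m + m ∸ m) !≢0}} (k![n∸k]!∣n! (m≤m+n m m)) ⟩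
  (m + m) !                                          ∎
  where open ≡-Reasoning

-- Comparison with Pauling's estimate

module Estimate {n : ℕ} (G : Graph n) (m : ℕ) (reg : IsRegular (m + m) G) where
  open Labellings G m
  open UpperCount G m reg
  open LowerCount G m reg

  private
    W = length Ω
    F = (m ! * m !) ^ n
    P = paulingBinom (m + m) ^ n

    Labs-split : ((m + m) !) ^ n ≡ P * F
    Labs-split = trans (cong (_^ n) (sym (central-binomial m))) (^-distribʳ-* n (paulingBinom (m + m)) (m ! * m !))

    F>0 : 1 ≤ F
    F>0 = m^n>0 (m ! * m !) {{m*n≢0 (m !) (m !) {{m !≢0}} {{m !≢0}}}} n

  pauling-lower : P ≤ 2 ^ (m * n) * EO G
  pauling-lower = *-cancelʳ-≤ P (2 ^ (m * n) * EO G) F {{>-nonZero F>0}} (begin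
    P * F                            ≡⟨ Labs-split ⟨
    ((m + m) !) ^ n                  ≤⟨ lower-count ⟩
    (2 ^ m) ^ n * W                  ≡⟨ cong₂ _*_ (^-*-assoc 2 m n) (length-Ω reg) ⟩
    2 ^ (m * n) * (EO G * F)         ≡⟨ *-assoc (2 ^ (m * n)) (EO G) F ⟨
    2 ^ (m * n) * EO G * F           ∎)
    where open ≤-Reasoning

  -- Half of the labellings suffice: the loss is a single factor 2, counted in the exponent t + 1.
  pauling-upper : ∀ t → W ≤ 2 * length (filter (few? t) Ω) → 2 ^ (m * n) * EO G ≤ 2 ^ suc t * P
  pauling-upper t h = *-cancelʳ-≤ (2 ^ (m * n) * EO G) (2 ^ suc t * P) F {{>-nonZero F>0}} (begin
    2 ^ (m * n) * EO G * F                      ≡⟨ *-assoc (2 ^ (m * n)) (EO G) F ⟩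
    2 ^ (m * n) * (EO G * F)                    ≡⟨ cong₂ _*_ (^-*-assoc 2 m n) (length-Ω reg) ⟨
    (2 ^ m) ^ n * W                             ≤⟨ *-monoʳ-≤ ((2 ^ m) ^ n) h ⟩
    (2 ^ m) ^ n * (2 * few)                     ≡⟨ solve 2 (λ x f → x :* (con 2 :* f) := con 2 :* (f :* x)) refl ((2 ^ m) ^ n) few ⟩
    2 * (few * (2 ^ m) ^ n)                     ≤⟨ *-monoʳ-≤ 2 (upper-count t) ⟩
    2 * (2 ^ t * ((m + m) !) ^ n)               ≡⟨ cong (λ z → 2 * (2 ^ t * z)) Labs-split ⟩
    2 * (2 ^ t * (P * F))                       ≡⟨ solve 3 (λ x p f → con 2 :* (x :* (p :* f)) := con 2 :* x :* p :* f) refl (2 ^ t) P F ⟩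
    2 ^ suc t * P * F                           ∎)
    where
    open ≤-Reasoning
    open +-*-Solver
    few = length (filter (few? t) Ω)

  open Circuits (system reg) using (leaderTotal)
  open Switching (system reg) using (ΦP; ∈-ΦP⁺; leader?)

  markov : ∀ L t → 2 * leaderTotal L ≤ W * suc t → W ≤ 2 * length (filter (few? t) Ω)
  markov L t h = +-cancelʳ-≤ W W (2 * few) (begin
    W + W                       ≡⟨ cong (W +_) (+-identityʳ W) ⟨
    2 * W                       ≡⟨ cong (2 *_) (filter-split (few? t) Ω) ⟩
    2 * (few + many)            ≡⟨ *-distribˡ-+ 2 few many ⟩
    2 * few + 2 * many          ≤⟨ +-monoʳ-≤ (2 * few) 2many≤W ⟩
    2 * few + W                 ∎)
    where
    open ≤-Reasoning
    open +-*-Solver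
    many? : Decidable (λ λs → ¬ (length (leaders λs) ≤ t))
    many? λs = ¬? (few? t λs)
    few = length (filter (few? t) Ω)
    many = length (filter many? Ω)
    counted : suc t * many ≤ leaderTotal L
    counted = mult-length {R = λ λs x → λs ≡ proj₁ x} (suc t) (Uniqueₚ.filter⁺ many? (Ω! reg))
      (λ {λs} λ∈ → let (λ∈Ω , big) = ∈-filter⁻ many? {xs = Ω} λ∈ in
        map (λs ,_) (leaders λs) , Uniqueₚ.map⁺ (λ { refl → refl }) (Uniqueₚ.filter⁺ _ (positions! n m)) ,
        subst (suc t ≤_) (sym (length-map (λs ,_) (leaders λs))) (≰⇒> big) ,
        λ z∈ → let (p , p∈ , e) = ∈-map⁻ (λs ,_) z∈ in
          subst (_∈ filter (λ x → leader? (succ reg (proj₁ x)) (proj₂ x)) ΦP) (sym e)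
            (∈-filter⁺ _ (∈-ΦP⁺ λ∈Ω) (proj₂ (∈-filter⁻ (leader? (succ reg λs)) {xs = positions n m} p∈))) ,
          cong proj₁ (sym e))
      (λ _ _ e f → trans e (sym f))
    2many≤W : 2 * many ≤ W
    2many≤W = *-cancelʳ-≤ (2 * many) W (suc t) (≤-trans (≤-reflexive (solve 2 (λ x s → con 2 :* x :* s := con 2 :* (s :* x)) refl many (suc t)))
      (≤-trans (*-monoʳ-≤ 2 counted) h))

  module _ (p q ℓmax : ℕ) (1≤q : 1 ≤ q)
    (hyp : ∀ ℓ → 3 ≤ ℓ → ℓ ≤ ℓmax → ∀ M →
      q * closedTrails ℓ G * expPartialScaled M (ℓ + 1) ≤ p * ((m + m) ^ (ℓ ∸ 1) * n) * (M !)) where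

    -- The exponential series at ℓ + 1 is cut off after the term of index ℓ + 1, so that `exp-bound`
    -- yields e^(ℓ+1) ≥ 2^ℓ. This turns d^(ℓ-1) into m^(ℓ-1) and leaves a factor 2.
    trails-bound : ∀ k → 3 ≤ suc k → suc k ≤ ℓmax → 2 * closedTrails (suc k) G ≤ p * (m ^ k * n)
    trails-bound k 3≤ ≤max = *-cancelʳ-≤ (2 * c) (p * (m ^ k * n)) (2 ^ k * N !) {{>-nonZero (*-mono-≤ (m^n>0 2 k) (1≤n! N))}} (begin
      2 * c * (2 ^ k * N !)                     ≡⟨ solve 3 (λ c x f → con 2 :* c :* (x :* f) := c :* (con 2 :* x :* f)) refl c (2 ^ k) (N !) ⟩
      c * (2 ^ suc k * N !)                     ≤⟨ *-monoˡ-≤ (2 ^ suc k * N !) (≤-trans (≤-reflexive (sym (*-identityˡ c))) (*-monoˡ-≤ c 1≤q)) ⟩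
      q * c * (2 ^ suc k * N !)                 ≤⟨ *-monoʳ-≤ (q * c) (exp-bound (suc k)) ⟩
      q * c * expPartialScaled N N              ≡⟨ cong (λ z → q * c * expPartialScaled N z) (+-comm 1 (suc k)) ⟩
      q * c * expPartialScaled N (suc k + 1)    ≤⟨ hyp (suc k) 3≤ ≤max N ⟩
      p * ((m + m) ^ k * n) * N !               ≡⟨ cong (λ z → p * (z * n) * N !) (trans (cong (λ z → (m + z) ^ k) (sym (+-identityʳ m))) (^-distribʳ-* k 2 m)) ⟩
      p * (2 ^ k * m ^ k * n) * N !             ≡⟨ solve 5 (λ p x y n f → p :* (x :* y :* n) :* f := p :* (y :* n) :* (x :* f)) refl p (2 ^ k) (m ^ k) n (N !) ⟩
      p * (m ^ k * n) * (2 ^ k * N !)           ∎)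
      where
      open ≤-Reasoning
      open +-*-Solver
      c = closedTrails (suc k) G
      N = suc (suc k)

    module _ (L : ℕ) (L≤ : L ≤ ℓmax) (1≤m : 1 ≤ m) (2LL≤m : 2 * (L * L) ≤ m) where
      open Returns (system reg) L
      open Circuits (system reg) L using (badTotal; leaderTotal-bound)

      -- The 2 ℓ sequences per trail account for L, the leading 2 for replacing (m - ℓ)^(ℓ-1) by
      -- m^(ℓ-1), which is where m ≥ 2 L² enters.
      firstRet-estimate : ∀ ℓ → ℓ < L → firstRetTotal ℓ ≤ 2 * (L * (p * n)) * W
      firstRet-estimate ℓ ℓ<L with 3 ≤? ℓ
      ... | no 3≰ℓ = ≤-trans (≤-reflexive (cong length (filter-none (firstRet? ℓ) (All.tabulate λ x∈ fr → 3≰ℓ (firstRet≥3 (Switching.∈-ΦP⁻ (system reg) x∈) fr))))) z≤n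
      firstRet-estimate (suc k) ℓ<L | yes 3≤ℓ = *-cancelʳ-≤ fr (2 * (L * (p * n)) * W) a {{>-nonZero a>0}} (begin
        fr * a                                        ≡⟨ *-comm fr a ⟩
        a * fr                                        ≤⟨ firstRet-bound k ⟩
        W * length (closedTrailSeqs G (suc k))        ≤⟨ *-monoʳ-≤ W (closedTrailSeqs-bound G (suc k) (s≤s z≤n)) ⟩
        W * (c * (2 * suc k))                         ≡⟨ solve 3 (λ w c k → w :* (c :* (con 2 :* k)) := w :* (k :* (con 2 :* c))) refl W c (suc k) ⟩
        W * (suc k * (2 * c))                         ≤⟨ *-monoʳ-≤ W (*-mono-≤ (<⇒≤ ℓ<L) (≤-trans (trails-bound k 3≤ℓ (≤-trans (<⇒≤ ℓ<L) L≤)) (*-monoʳ-≤ p (*-monoˡ-≤ n (power-half m (suc k) k 1≤m 2kk))))) ⟩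
        W * (L * (p * (2 * a * n)))                   ≡⟨ solve 5 (λ w l p a n → w :* (l :* (p :* (con 2 :* a :* n))) := con 2 :* (l :* (p :* n)) :* w :* a) refl W L p a n ⟩
        2 * (L * (p * n)) * W * a                     ∎)
        where
        open ≤-Reasoning
        open +-*-Solver
        fr = firstRetTotal (suc k)
        c = closedTrails (suc k) G
        a = (m ∸ suc k) ^ k
        2kk : 2 * (k * suc k) ≤ m
        2kk = ≤-trans (*-monoʳ-≤ 2 (*-mono-≤ (≤-trans (n≤1+n k) (<⇒≤ ℓ<L)) (<⇒≤ ℓ<L))) 2LL≤m
        1≤L : 1 ≤ L
        1≤L = ≤-trans (s≤s z≤n) ℓ<L
        k<m : suc k < m
        k<m = ≤-trans ℓ<L (≤-trans (≤-trans (≤-reflexive (sym (*-identityˡ L))) (*-monoˡ-≤ L 1≤L)) (≤-trans (m≤m+n (L * L) _) 2LL≤m))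
        a>0 : 1 ≤ a
        a>0 = m^n>0 (m ∸ suc k) {{>-nonZero (m<n⇒0<n∸m k<m)}} k

      -- Three factors L: the shift to the repetition, the length of the first return, and the
      -- sequences per trail.
      bad-estimate : badTotal ≤ 2 * (L * L * L * (p * n)) * W
      bad-estimate = begin
        badTotal                                      ≤⟨ bad-bound ⟩
        L * retTotal                                  ≤⟨ *-monoʳ-≤ L ret-split ⟩
        L * sumTo L firstRetTotal                     ≤⟨ *-monoʳ-≤ L (sumTo-const L firstRet-estimate) ⟩
        L * (L * (2 * (L * (p * n)) * W))             ≡⟨ solve 3 (λ l x w → l :* (l :* (con 2 :* (l :* x) :* w)) := con 2 :* (l :* l :* l :* x) :* w) refl L (p * n) W ⟩
        2 * (L * L * L * (p * n)) * W                 ∎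
        where
        open ≤-Reasoning
        open +-*-Solver

      -- The two error terms balance for L = 8 b Λ.
      leader-estimate : ∀ b Λ → m < 2 ^ Λ → 1 ≤ b → 1 ≤ Λ → L ≡ 8 * b * Λ → 32 * b * (L * L * L) * (1 + Λ) * p ≤ m →
        4 * b * leaderTotal L ≤ W * n
      leader-estimate b Λ m< 1≤b 1≤Λ L≡ big = *-cancelˡ-≤ (2 * (L * m)) {{>-nonZero (*-mono-≤ {1} {2} (s≤s z≤n) (*-mono-≤ 1≤L 1≤m))}} (begin
        2 * (L * m) * (4 * b * lt)                                     ≡⟨ solve 4 (λ l m b t → con 2 :* (l :* m) :* (con 4 :* b :* t) := con 8 :* b :* (l :* (m :* t))) refl L m b lt ⟩
        8 * b * (L * (m * lt))                                         ≤⟨ *-monoʳ-≤ (8 * b) (leaderTotal-bound Λ m<) ⟩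
        8 * b * (m * (Λ * (W * n)) + L * (2 * badTotal + Λ * (2 * badTotal)))
                                                                       ≤⟨ *-monoʳ-≤ (8 * b) (+-monoʳ-≤ (m * (Λ * (W * n))) (*-monoʳ-≤ L (+-mono-≤ (*-monoʳ-≤ 2 bad-estimate) (*-monoʳ-≤ Λ (*-monoʳ-≤ 2 bad-estimate))))) ⟩
        8 * b * (m * (Λ * (W * n)) + L * (2 * bad + Λ * (2 * bad)))    ≡⟨ expand ⟩
        8 * b * Λ * m * (W * n) + 32 * b * (L * L * L) * (1 + Λ) * p * (L * (W * n))
                                                                       ≤⟨ +-mono-≤ (≤-reflexive (cong (λ z → z * m * (W * n)) (sym L≡))) (*-monoˡ-≤ (L * (W * n)) big) ⟩
        L * m * (W * n) + m * (L * (W * n))                            ≡⟨ solve 3 (λ l m w → l :* m :* w :+ m :* (l :* w) := con 2 :* (l :* m) :* w) refl L m (W * n) ⟩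
        2 * (L * m) * (W * n)                                          ∎)
        where
        open ≤-Reasoning
        open +-*-Solver
        lt = leaderTotal L
        bad = 2 * (L * L * L * (p * n)) * W
        1≤L : 1 ≤ L
        1≤L = subst (1 ≤_) (sym L≡) (*-mono-≤ {1} {8 * b} (*-mono-≤ {1} {8} (s≤s z≤n) 1≤b) 1≤Λ)
        expand : 8 * b * (m * (Λ * (W * n)) + L * (2 * bad + Λ * (2 * bad))) ≡ 8 * b * Λ * m * (W * n) + 32 * b * (L * L * L) * (1 + Λ) * p * (L * (W * n))
        expand = solve 7 (λ b m a w n l p →
            con 8 :* b :* (m :* (a :* (w :* n)) :+ l :* (con 2 :* (con 2 :* (l :* l :* l :* (p :* n)) :* w) :+ a :* (con 2 :* (con 2 :* (l :* l :* l :* (p :* n)) :* w))))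
            := con 8 :* b :* a :* m :* (w :* n) :+ con 32 :* b :* (l :* l :* l) :* (con 1 :+ a) :* p :* (l :* (w :* n)))
          refl b m Λ W n L p

-- Choice of the parameters

2^-cancel-≤ : ∀ {u v} → 2 ^ u ≤ 2 ^ v → u ≤ v
2^-cancel-≤ {u} {v} h = ≮⇒≥ λ v<u → <⇒≱ (^-monoʳ-< 2 (s≤s (s≤s z≤n)) v<u) h

-- t + 1 is n / b rounded down. The first inequality keeps 2^(t+1) below (a/b)^n, the second
-- compares t + 1 with the average number of circuits.
quotient-bounds : ∀ n b → 1 ≤ b → b ≤ n → ∃[ t ] (b * suc t ≤ n × n ≤ 2 * b * suc t)
quotient-bounds n b@(suc _) _ b≤n with n / b | m≡m%n+[m/n]*n n b
... | zero  | e = contradiction (≤-trans (s≤s (≤-reflexive (trans e (+-identityʳ (n % b))))) (m%n<n n b)) (≤⇒≯ b≤n)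
... | suc t | e = t , ≤-trans (≤-reflexive (*-comm b (suc t))) (≤-trans (m≤n+m (suc t * b) (n % b)) (≤-reflexive (sym e))) , (begin
  n                              ≡⟨ e ⟩
  n % b + suc t * b              ≤⟨ +-monoˡ-≤ (suc t * b) (≤-trans (<⇒≤ (m%n<n n b)) (m≤m+n b (t * b))) ⟩
  suc t * b + suc t * b          ≡⟨ solve 2 (λ b t → t :* b :+ t :* b := con 2 :* b :* t) refl b (suc t) ⟩
  2 * b * suc t                  ∎)
  where
  open ≤-Reasoning
  open +-*-Solver

-- The factor 32 b (8 b)³ p remains when L = 8 b Λ is put into the size condition of
-- `leader-estimate`; 10^5 times it is where `poly≤exp` applies.
threshold : ℕ → ℕ → ℕ
threshold b p = 10 ^ 5 * (32 * b * (8 * b * (8 * b) * (8 * b)) * p)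

pauling-estimate : ∀ {n} (G : Graph n) d m → d ≡ m + m → IsRegular d G → ∀ p q ℓmax → 1 ≤ p → 1 ≤ q →
  (∀ ℓ → 3 ≤ ℓ → ℓ ≤ ℓmax → ∀ M → q * closedTrails ℓ G * expPartialScaled M (ℓ + 1) ≤ p * (d ^ (ℓ ∸ 1) * n) * (M !)) →
  ∀ {a b} → 1 ≤ b → b < a → b ≤ n → 2 * 2 ^ threshold b p ≤ d → d ^ (8 * b) ≤ 2 ^ ℓmax →
  (b ^ n * paulingBinom d ^ n ≤ a ^ n * (2 ^ (⌊ d /2⌋ * n) * EO G))
  × (b ^ n * (2 ^ (⌊ d /2⌋ * n) * EO G) ≤ a ^ n * paulingBinom d ^ n)
pauling-estimate {n} G d m refl reg p q ℓmax 1≤p 1≤q hyp {a} {b} 1≤b b<a b≤n large long =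
  subst (λ h → (b ^ n * P ≤ a ^ n * (2 ^ (h * n) * EO G)) × (b ^ n * (2 ^ (h * n) * EO G) ≤ a ^ n * P)) (n≡⌊n+n/2⌋ m)
    (*-mono-≤ (^-monoˡ-≤ n (<⇒≤ b<a)) pauling-lower , upper)
  where
  open Estimate G m reg
  open ≤-Reasoning
  open +-*-Solver
  P = paulingBinom (m + m) ^ n
  θ = threshold b p
  2^θ≤m : 2 ^ θ ≤ m
  2^θ≤m = *-cancelˡ-≤ 2 (≤-trans large (≤-reflexive (cong (m +_) (sym (+-identityʳ m)))))
  1≤m : 1 ≤ m
  1≤m = ≤-trans (m^n>0 2 θ) 2^θ≤m
  x = proj₁ (binary-length m 1≤m)
  2^x≤m : 2 ^ x ≤ m
  2^x≤m = proj₁ (proj₂ (binary-length m 1≤m))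
  Λ = suc x
  m<2^Λ : m < 2 ^ Λ
  m<2^Λ = proj₂ (proj₂ (binary-length m 1≤m))
  θ≤x : θ ≤ x
  θ≤x = ≮⇒≥ λ x<θ → <⇒≱ m<2^Λ (≤-trans (^-monoʳ-≤ 2 x<θ) 2^θ≤m)
  L = 8 * b * Λ
  1≤L : 1 ≤ L
  1≤L = *-mono-≤ {1} {8 * b} (*-mono-≤ {1} {8} (s≤s z≤n) 1≤b) (s≤s z≤n)
  big : 32 * b * (L * L * L) * (1 + Λ) * p ≤ m
  big = begin
    32 * b * (L * L * L) * (1 + Λ) * p           ≡⟨ solve 4 (λ b l a p → con 32 :* b :* (con 8 :* b :* a :* (con 8 :* b :* a) :* (con 8 :* b :* a)) :* l :* p
                                                      := con 32 :* b :* (con 8 :* b :* (con 8 :* b) :* (con 8 :* b)) :* p :* (l :* (a :* (a :* a)))) refl b (1 + Λ) Λ p ⟩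
    κ * ((1 + Λ) * (Λ * (Λ * Λ)))                ≤⟨ *-monoʳ-≤ κ (*-mono-≤ 1+Λ≤ (*-mono-≤ Λ≤ (*-mono-≤ Λ≤ (≤-trans Λ≤ (≤-reflexive (sym (*-identityʳ (10 + x)))))))) ⟩
    κ * (10 + x) ^ 4                             ≤⟨ poly≤exp κ x θ≤x ⟩
    2 ^ x                                        ≤⟨ 2^x≤m ⟩
    m                                            ∎
    where
    κ = 32 * b * (8 * b * (8 * b) * (8 * b)) * p
    Λ≤ : Λ ≤ 10 + x
    Λ≤ = +-monoˡ-≤ x {1} {10} (s≤s z≤n)
    1+Λ≤ : 1 + Λ ≤ 10 + x
    1+Λ≤ = +-monoˡ-≤ x {2} {10} (s≤s (s≤s z≤n))
  2LL≤m : 2 * (L * L) ≤ m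
  2LL≤m = ≤-trans (begin
    2 * (L * L)                               ≤⟨ *-monoˡ-≤ (L * L) {2} {32 * b} (*-mono-≤ {2} {32} {1} (s≤s (s≤s z≤n)) 1≤b) ⟩
    32 * b * (L * L)                          ≤⟨ *-monoʳ-≤ (32 * b) (≤-trans (≤-reflexive (sym (*-identityʳ (L * L)))) (*-monoʳ-≤ (L * L) 1≤L)) ⟩
    32 * b * (L * L * L)                      ≡⟨ solve 1 (λ z → z := z :* con 1 :* con 1) refl (32 * b * (L * L * L)) ⟩
    32 * b * (L * L * L) * 1 * 1              ≤⟨ *-mono-≤ (*-monoʳ-≤ (32 * b * (L * L * L)) {1} {1 + Λ} (s≤s z≤n)) 1≤p ⟩
    32 * b * (L * L * L) * (1 + Λ) * p        ∎) big
  -- 2^Λ = 2 · 2^x ≤ 2 m = d, so L is at most 8 b times the binary logarithm of d.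
  L≤ℓmax : L ≤ ℓmax
  L≤ℓmax = 2^-cancel-≤ (begin
    2 ^ (8 * b * Λ)          ≡⟨ cong (2 ^_) (*-comm (8 * b) Λ) ⟩
    2 ^ (Λ * (8 * b))        ≡⟨ ^-*-assoc 2 Λ (8 * b) ⟨
    (2 ^ Λ) ^ (8 * b)        ≤⟨ ^-monoˡ-≤ (8 * b) (+-mono-≤ 2^x≤m (≤-trans (≤-reflexive (+-identityʳ (2 ^ x))) 2^x≤m)) ⟩
    (m + m) ^ (8 * b)        ≤⟨ long ⟩
    2 ^ ℓmax                 ∎)
  t = proj₁ (quotient-bounds n b 1≤b b≤n)
  leaders≤ : 4 * b * Circuits.leaderTotal (Labellings.system G m reg) L ≤ length (Labellings.Ω G m) * n
  leaders≤ = leader-estimate p q ℓmax 1≤q hyp L L≤ℓmax 1≤m 2LL≤m b Λ m<2^Λ 1≤b (s≤s z≤n) refl big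
  -- The factor 4 b splits into 2 b, lost by rounding in `quotient-bounds`, and 2 for Markov's
  -- inequality.
  half : 2 * Circuits.leaderTotal (Labellings.system G m reg) L ≤ length (Labellings.Ω G m) * suc t
  half = *-cancelˡ-≤ (2 * b) {{>-nonZero (*-mono-≤ {1} {2} (s≤s z≤n) 1≤b)}} (begin
    2 * b * (2 * lt)             ≡⟨ solve 2 (λ b l → con 2 :* b :* (con 2 :* l) := con 4 :* b :* l) refl b lt ⟩
    4 * b * lt                   ≤⟨ leaders≤ ⟩
    W * n                        ≤⟨ *-monoʳ-≤ W (proj₂ (proj₂ (quotient-bounds n b 1≤b b≤n))) ⟩
    W * (2 * b * suc t)          ≡⟨ solve 3 (λ w b t → w :* (con 2 :* b :* t) := con 2 :* b :* (w :* t)) refl W b (suc t) ⟩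
    2 * b * (W * suc t)          ∎)
    where
    lt = Circuits.leaderTotal (Labellings.system G m reg) L
    W = length (Labellings.Ω G m)
  upper : b ^ n * (2 ^ (m * n) * EO G) ≤ a ^ n * P
  upper = begin
    b ^ n * (2 ^ (m * n) * EO G)      ≤⟨ *-monoʳ-≤ (b ^ n) (pauling-upper t (markov L t half)) ⟩
    b ^ n * (2 ^ suc t * P)           ≡⟨ *-assoc (b ^ n) (2 ^ suc t) P ⟨
    b ^ n * 2 ^ suc t * P             ≤⟨ *-monoˡ-≤ P (ratio-power n (suc t) 1≤b b<a (proj₁ (proj₂ (quotient-bounds n b 1≤b b≤n)))) ⟩
    a ^ n * P                         ∎

theorem2p1 : (d : ℕ → ℕ) (G : (n : ℕ) → Graph n)
    → (∀ n → IsRegular (d n) (G n))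
    → (∀ n → 2 ∣ d n)
    → (∀ K → ∃[ N ] (∀ n → N ≤ n → K ≤ d n))
    → (ℓmax : ℕ → ℕ)
    → (∀ K → ∃[ N ] (∀ n → N ≤ n → d n ^ K ≤ 2 ^ ℓmax n))
    → (p q : ℕ) → 1 ≤ p → 1 ≤ q
    → (∀ n ℓ → 3 ≤ ℓ → ℓ ≤ ℓmax n → ∀ M →
    q * closedTrails ℓ (G n) * expPartialScaled M (ℓ + 1)
    ≤ p * (d n ^ (ℓ ∸ 1) * n) * (M !))
    → ∀ a b → 1 ≤ b → b < a →
    ∃[ N ] (∀ n → N ≤ n →
    (b ^ n * paulingBinom (d n) ^ n ≤ a ^ n * (2 ^ (⌊ d n /2⌋ * n) * EO (G n)))
    × (b ^ n * (2 ^ (⌊ d n /2⌋ * n) * EO (G n)) ≤ a ^ n * paulingBinom (d n) ^ n))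
theorem2p1 d G reg even d→∞ ℓmax long p q 1≤p 1≤q hyp a b 1≤b b<a =
  -- N₁ brings d above the threshold, N₂ makes room for L below ℓmax, and b ≤ n makes n / b
  -- positive.
  N₁ + N₂ + b , λ n N≤n →
    let m = _∣_.quotient (even n)
        d≡m+m = trans (_∣_.equality (even n)) (trans (*-comm m 2) (cong (m +_) (+-identityʳ m)))
    in pauling-estimate (G n) (d n) m d≡m+m (reg n) p q (ℓmax n) 1≤p 1≤q (hyp n) 1≤b b<a
         (≤-trans (m≤n+m b (N₁ + N₂)) N≤n)
         (proj₂ (d→∞ (2 * 2 ^ threshold b p)) n (≤-trans (≤-trans (m≤m+n N₁ N₂) (m≤m+n (N₁ + N₂) b)) N≤n))
         (proj₂ (long (8 * b)) n (≤-trans (≤-trans (m≤n+m N₂ N₁) (m≤m+n (N₁ + N₂) b)) N≤n))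
  where
  N₁ = proj₁ (d→∞ (2 * 2 ^ threshold b p))
  N₂ = proj₁ (long (8 * b))
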